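{- Let $k\ge2$ and $0<\alpha<1$. Among all $k$-uniform linear unicyclic hypergraphs with $m$ hyperedges and girth $g$ ($3\le g\le m$), $C_g^{(k)}\odot S_{m-g}^{(k)}$ has the largest $2$-nd order $\mathcal{A}_\alpha$-spectral moment. Among all $k$-uniform linear unicyclic hypergraphs with $m$ hyperedges, $C_3^{(k)}\odot S_{m-3}^{(k)}$ has the largest $2$-nd order $\mathcal{A}_\alpha$-spectral moment, and $C^{(k)}_{3;m-4,1,0}$ has the second largest $2$-nd order $\mathcal{A}_\alpha$-spectral moment.
   Context: Hypergraphs are finite; $k$-uniform means every hyperedge has exactly $k$ vertices; linear means any two distinct hyperedges share at most one vertex; unicyclic means connected with exactly one cycle; the girth is the minimum length of a cycle. A cored vertex is a vertex of degree one. "Adding a pendant hyperedge to a vertex $v$" means adding a new hyperedge consisting of $v$ and $k-1$ new vertices. The hypercycle $C_g^{(k)}$ is obtained from the cycle graph $C_g$ by inserting $k-2$ new (cored) vertices into each edge. $C_g^{(k)}\odot S_{m-g}^{(k)}$ is obtained from $C_g^{(k)}$ by adding $m-g$ pendant hyperedges to a non-cored vertex of $C_g^{(k)}$. $C^{(k)}_{3;n_1,n_2,n_3}$ is obtained from $C_3^{(k)}$ by adding $n_1,n_2,n_3$ pendant hyperedges to the three non-cored vertices of $C_3^{(k)}$, respectively. For a $k$-uniform hypergraph $\mathcal{H}$ on $[n]$, $\mathcal{A}(\mathcal{H})$ is the $k$-order $n$-dimensional tensor with entry $\frac1{(k-1)!}$ at $(i_1,\dots,i_k)$ if $\{i_1,\dots,i_k\}\in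 E(\mathcal{H})$ and $0$ otherwise; $\mathcal{D}(\mathcal{H})$ is the diagonal tensor of vertex degrees; $\mathcal{A}_\alpha(\mathcal{H})=\alpha\mathcal{D}(\mathcal{H})+(1-\alpha)\mathcal{A}(\mathcal{H})$. The $d$-th order $\mathcal{A}_\alpha$-spectral moment of $\mathcal{H}$ is the sum of the $d$-th powers of all $n(k-1)^{n-1}$ eigenvalues of $\mathcal{A}_\alpha(\mathcal{H})$; it equals the $d$-th order trace $\mathrm{Tr}_d(\mathcal{A}_\alpha(\mathcal{H}))$, where for a $k$-order $n$-dimensional tensor $\mathcal{T}$ and $d\ge1$, $$\mathrm{Tr}_{d}(\mathcal{T})=(k-1)^{n-1}\sum_{d_1+\cdots+d_n=d}\ \prod_{i=1}^{n}\frac{1}{(d_i(k-1))!}\Big(\sum_{\gamma\in[n]^{k-1}}(\mathcal{T})_{i\gamma}\frac{\partial}{\partial a_{i\gamma}}\Big)^{d_i}\mathrm{tr}\big(A^{d(k-1)}\big),$$ with $A=(a_{ij})$ an $n\times n$ matrix of indeterminates, $d_i\ge0$ integers, $\frac{\partial}{\partial a_{i\gamma}}=\frac{\partial}{\partial a_{i i_2}}\cdots\frac{\partial}{\partial a_{i i_k}}$ for $\gamma=i_2\cdots i_k$.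
   Formalization: The second-largest claim is stated for m ≥ 5: for m = 3 the hypergraph C_{3;m-4,1,0} is undefined, and for m = 4 it is isomorphic to C_3 ⊙ S_1, hence the largest rather than the second largest. -}

module Defs where

open import Algebra.Bundles using (CommutativeRing)
import Algebra.Definitions.RawMonoid as RawMonoidDefinitions
open import Data.Bool.Base using (if_then_else_)
import Data.Bool.Properties as Bool
open import Data.Fin.Base using (Fin; toℕ; _↑ˡ_; splitAt)
open import Data.Fin.Patterns using (0F; 1F; 2F)
import Data.Fin.Properties as Fin
open import Data.Fin.Subset using (Subset; _∈_; _∩_; _∪_; ⁅_⁆; ⊤; ⊥; ∣_∣)
open import Data.Fin.Subset.Properties using (_∈?_)
open import Data.List.Base as List using (List; []; _∷_; _++_; [_]; allFin; upTo; concatMap; cartesianProductWith)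
open import Data.Nat.Base as ℕ using (ℕ; zero; suc; _∸_; _!; NonZero)
open import Data.Nat.DivMod using (_mod_)
open import Data.Nat.GeneralisedArithmetic using (fold)
open import Data.Nat.Properties using (_!≢0)
open import Data.Product.Base using (Σ; ∃; _×_; _,_; proj₁; proj₂)
open import Data.Sum.Base using (_⊎_; inj₂; [_,_]′)
open import Data.Vec.Base as Vec using (Vec; []; _∷_; lookup)
import Data.Vec.Properties as Vec
open import Data.Vec.Relation.Unary.All using (all?)
open import Function.Base using (_∘_)
open import Function.Bundles using (_⇔_; _↔_; Inverse)
open import Function.Definitions using (Injective)
open import Level using (_⊔_) renaming (suc to lsuc)
open import Relation.Binary.Construct.Closure.ReflexiveTransitive using (Star)
open import Relation.Binary.Core using (Rel)
open import Relation.Binary.Definitions using (Cotransitive; Tight)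
open import Relation.Binary.PropositionalEquality using (_≡_; _≢_)
open import Relation.Binary.Structures using (IsStrictPartialOrder)
open import Relation.Nullary using (¬_; Dec; does)

------------------------------------------------------------------------
-- Hypergraphs

-- Hyperedges are indexed by Fin size.  Repeated hyperedges are not
-- excluded here, but a k-uniform linear hypergraph with k ≥ 2 has none:
-- two equal hyperedges with different indices would share k vertices.

record Hypergraph : Set where
  field
    order : ℕ
    size  : ℕ
    edge  : Fin size → Subset order

open Hypergraph public

degree : (H : Hypergraph) → Fin (order H) → ℕ
degree H v = List.length (List.filter (λ e → v ∈? edge H e) (allFin (size H)))

IsUniform : ℕ → Hypergraph → Set
IsUniform k H = ∀ e → ∣ edge H e ∣ ≡ k

IsLinear : Hypergraph → Set
IsLinear H = ∀ e f → e ≢ f → ∣ edge H e ∩ edge H f ∣ ℕ.≤ 1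

Adjacent : (H : Hypergraph) → Rel (Fin (order H)) _
Adjacent H u v = ∃ λ e → u ∈ edge H e × v ∈ edge H e

IsConnected : Hypergraph → Set
IsConnected H = ∀ u v → Star (Adjacent H) u v

-- Cyclic successor i ↦ i + 1 mod n.
next : ∀ {n} → Fin n → Fin n
next {suc n} i = suc (toℕ i) mod suc n

-- A cycle v₀ e₀ v₁ e₁ … vₗ₋₁ eₗ₋₁ v₀ with l ≥ 2 distinct vertices and
-- l distinct hyperedges, where vᵢ , vᵢ₊₁ ∈ eᵢ.
record Cycle (H : Hypergraph) : Set where
  field
    len         : ℕ
    2≤len       : 2 ℕ.≤ len
    vert        : Fin len → Fin (order H)
    hedge       : Fin len → Fin (size H)
    vert-inj    : Injective _≡_ _≡_ vert
    hedge-inj   : Injective _≡_ _≡_ hedge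
    vert∈       : ∀ i → vert i ∈ edge H (hedge i)
    vert-next∈  : ∀ i → vert (next i) ∈ edge H (hedge i)

open Cycle public

-- A cycle is regarded as a subgraph of the vertex/hyperedge incidence
-- graph, so that the choice of starting vertex and of direction does
-- not matter.
Uses : ∀ {H} → Cycle H → Fin (order H) → Fin (size H) → Set
Uses C v e = ∃ λ i → hedge C i ≡ e × (vert C i ≡ v ⊎ vert C (next i) ≡ v)

SameCycle : ∀ {H} → Rel (Cycle H) _
SameCycle C D = ∀ v e → Uses C v e ⇔ Uses D v e

IsUnicyclic : Hypergraph → Set
IsUnicyclic H = IsConnected H × (Σ (Cycle H) λ C → ∀ D → SameCycle C D)

HasGirth : ℕ → Hypergraph → Set
HasGirth g H = (Σ (Cycle H) λ C → len C ≡ g) × (∀ (C : Cycle H) → g ℕ.≤ len C)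

record LinearUnicyclic (k m : ℕ) (H : Hypergraph) : Set where
  field
    uniform   : IsUniform k H
    linear    : IsLinear H
    unicyclic : IsUnicyclic H
    size≡m    : size H ≡ m

LinearUnicyclicOfGirth : (k m g : ℕ) → Hypergraph → Set
LinearUnicyclicOfGirth k m g H = LinearUnicyclic k m H × HasGirth g H

record _≅_ (G H : Hypergraph) : Set where
  field
    onVertices : Fin (order G) ↔ Fin (order H)
    onEdges    : Fin (size G) ↔ Fin (size H)
    incidence  : ∀ v e → v ∈ edge G e ⇔
                         Inverse.to onVertices v ∈ edge H (Inverse.to onEdges e)

------------------------------------------------------------------------
-- Hypercycles and pendant hyperedges

-- The i-th of p consecutive blocks of q elements.
block : ∀ {p} q → Fin p → Subset (p ℕ.* q)
block q i = Vec.concat (Vec.tabulate λ j → if does (i Fin.≟ j) then ⊤ {q} else ⊥)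

cycleGraph : ℕ → Hypergraph
cycleGraph g = record
  { order = g
  ; size  = g
  ; edge  = λ i → ⁅ i ⁆ ∪ ⁅ next i ⁆
  }

-- Insert q new vertices into every hyperedge.
insertCored : ℕ → Hypergraph → Hypergraph
insertCored q H = record
  { order = order H ℕ.+ size H ℕ.* q
  ; size  = size H
  ; edge  = λ e → edge H e Vec.++ block q e
  }

hypercycle : (k g : ℕ) → Hypergraph
hypercycle k g = insertCored (k ∸ 2) (cycleGraph g)

-- The vertices of the underlying cycle graph; for g ≥ 3 these are the
-- non-cored ones.
joint : ∀ k g → Fin g → Fin (order (hypercycle k g))
joint k g i = i ↑ˡ (g ℕ.* (k ∸ 2))

-- Add p pendant hyperedges, each with k - 1 new vertices, to v.
addPendants : ℕ → ℕ → (H : Hypergraph) → Fin (order H) → Hypergraph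
addPendants k p H v = record
  { order = order H ℕ.+ p ℕ.* (k ∸ 1)
  ; size  = size H ℕ.+ p
  ; edge  = λ e → [ (λ old → edge H old Vec.++ ⊥)
                  , (λ new → ⁅ v ⁆ Vec.++ block (k ∸ 1) new)
                  ]′ (splitAt (size H) e)
  }

oldVertex : ∀ k p H v → Fin (order H) → Fin (order (addPendants k p H v))
oldVertex k p H v u = u ↑ˡ (p ℕ.* (k ∸ 1))

-- C_g^{(k)} ⊙ S_p^{(k)}, the pendant hyperedges being attached to the
-- non-cored vertex j of the hypercycle.
hypercycle⊙star : (k g p : ℕ) → Fin g → Hypergraph
hypercycle⊙star k g p j = addPendants k p (hypercycle k g) (joint k g j)

-- C^{(k)}_{3;n₁,n₂,n₃}
C₃-pendants : (k n₁ n₂ n₃ : ℕ) → Hypergraph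
C₃-pendants k n₁ n₂ n₃ = addPendants k n₃ H₂ (old₂ (old₁ (joint k 3 2F)))
  where
  H₀   = hypercycle k 3
  v₁   = joint k 3 0F
  H₁   = addPendants k n₁ H₀ v₁
  old₁ = oldVertex k n₁ H₀ v₁
  v₂   = old₁ (joint k 3 1F)
  H₂   = addPendants k n₂ H₁ v₂
  old₂ = oldVertex k n₂ H₁ v₂

------------------------------------------------------------------------
-- Ordered fields

-- Neither decidability nor totality of the order is assumed, so that
-- the real numbers are an instance both classically (where these are
-- the usual linearly ordered fields) and constructively.
record OrderedField c ℓ₁ ℓ₂ : Set (lsuc (c ⊔ ℓ₁ ⊔ ℓ₂)) where
  field
    commutativeRing : CommutativeRing c ℓ₁

  open CommutativeRing commutativeRing public

  infix 4 _<_ _≤_ _#_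
  field
    _<_                  : Rel Carrier ℓ₂
    isStrictPartialOrder : IsStrictPartialOrder _≈_ _<_
    <-cotransitive       : Cotransitive _<_

  _≤_ : Rel Carrier ℓ₂
  x ≤ y = ¬ (y < x)

  _#_ : Rel Carrier ℓ₂
  x # y = x < y ⊎ y < x

  field
    #-tight      : Tight _≈_ _#_
    0<1          : 0# < 1#
    +-monoˡ-<    : ∀ {x y} z → x < y → x + z < y + z
    *-pos        : ∀ {x y} → 0# < x → 0# < y → 0# < x * y
    invertible   : ∀ {x} → x # 0# → ∃ λ y → x * y ≈ 1#

  private
    module <ₒ = IsStrictPartialOrder isStrictPartialOrder

  open RawMonoidDefinitions +-rawMonoid using () renaming (_×_ to _×ᶠ_)

  fromℕ : ℕ → Carrier
  fromℕ n = n ×ᶠ 1#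

  0<fromℕ : ∀ n → .{{NonZero n}} → 0# < fromℕ n
  0<fromℕ (suc zero)    = <ₒ.<-respʳ-≈ (sym (+-identityʳ 1#)) 0<1
  0<fromℕ (suc (suc n)) =
    <ₒ.trans (0<fromℕ (suc n))
             (<ₒ.<-respˡ-≈ (+-identityˡ _) (+-monoˡ-< (fromℕ (suc n)) 0<1))

  -- 1 / n!
  recip! : ℕ → Carrier
  recip! n = proj₁ (invertible (inj₂ (0<fromℕ (n !) {{n !≢0}})))

  sum : List Carrier → Carrier
  sum = List.foldr _+_ 0#

------------------------------------------------------------------------
-- Enumerations

-- All elements of [n]^p.
tuples : (n p : ℕ) → List (Vec (Fin n) p)
tuples n zero    = [ [] ]
tuples n (suc p) = cartesianProductWith _∷_ (allFin n) (tuples n p)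

-- All (d₁,…,dₙ) of natural numbers with d₁ + ⋯ + dₙ = d.
compositions : (n d : ℕ) → List (Vec ℕ n)
compositions zero    zero    = [ [] ]
compositions zero    (suc d) = []
compositions (suc n) d       =
  concatMap (λ d₁ → List.map (d₁ ∷_) (compositions n (d ∸ d₁))) (upTo (suc d))

module Spectral {c ℓ₁ ℓ₂} (F : OrderedField c ℓ₁ ℓ₂) where

  open OrderedField F

  ----------------------------------------------------------------------
  -- Polynomials in the n² indeterminates aᵢⱼ

  -- A monomial is a product of indeterminates written as a word (whose
  -- order is irrelevant), and a polynomial is a formal sum of terms.

  Indeterminate : ℕ → Set
  Indeterminate n = Fin n × Fin n

  Monomial : ℕ → Set
  Monomial n = List (Indeterminate n)

  Poly : ℕ → Set c
  Poly n = List (Carrier × Monomial n)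

  module _ {n : ℕ} where

    0ᵖ 1ᵖ : Poly n
    0ᵖ = []
    1ᵖ = [ 1# , [] ]

    _*ᵖ_ : Poly n → Poly n → Poly n
    _*ᵖ_ = cartesianProductWith λ (x , u) (y , w) → x * y , u ++ w

    _·ᵖ_ : Carrier → Poly n → Poly n
    x ·ᵖ P = List.map (λ (y , w) → x * y , w) P

    ∑ᵖ : ∀ {a} {A : Set a} → List A → (A → Poly n) → Poly n
    ∑ᵖ xs f = concatMap f xs

    -- By the Leibniz rule, the derivative of a word with respect to x
    -- is the sum, over the occurrences of x, of the word with that
    -- occurrence deleted.
    ∂-word : Indeterminate n → Monomial n → List (Monomial n)
    ∂-word x             []            = []
    ∂-word x@(i , j) (y@(i′ , j′) ∷ w) =
      (if does (i Fin.≟ i′) then (if does (j Fin.≟ j′) then [ w ] else []) else [])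
      ++ List.map (y ∷_) (∂-word x w)

    ∂ : Indeterminate n → Poly n → Poly n
    ∂ x P = ∑ᵖ P λ (y , w) → List.map (y ,_) (∂-word x w)

    constantTerm : Poly n → Carrier
    constantTerm P = sum (List.map (λ { (x , []) → x ; (x , _ ∷ _) → 0# }) P)

    PolyMatrix : Set c
    PolyMatrix = Fin n → Fin n → Poly n

    generic : PolyMatrix
    generic i j = [ 1# , [ i , j ] ]

    1ᵐ : PolyMatrix
    1ᵐ i j = if does (i Fin.≟ j) then 1ᵖ else 0ᵖ

    _*ᵐ_ : PolyMatrix → PolyMatrix → PolyMatrix
    (M *ᵐ N) i j = ∑ᵖ (allFin n) λ l → M i l *ᵖ N l j

    _^ᵐ_ : PolyMatrix → ℕ → PolyMatrix
    M ^ᵐ p = fold 1ᵐ (M *ᵐ_) p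

    tr : PolyMatrix → Poly n
    tr M = ∑ᵖ (allFin n) λ i → M i i

  ----------------------------------------------------------------------
  -- Tensors of order k ≥ 1 and dimension n, with entries Tᵢᵧ indexed by
  -- i ∈ [n] and γ ∈ [n]^{k-1}

  Tensor : (k n : ℕ) → Set c
  Tensor k n = Fin n → Vec (Fin n) (k ∸ 1) → Carrier

  module _ {k n : ℕ} (T : Tensor k n) where

    -- ∑ᵧ Tᵢᵧ ∂/∂aᵢᵧ
    operator : Fin n → Poly n → Poly n
    operator i P = ∑ᵖ (tuples n (k ∸ 1)) λ γ →
      T i γ ·ᵖ Vec.foldr (λ _ → Poly n) (λ j → ∂ (i , j)) P γ

    -- In Tr the operators, of total order d(k-1), are applied to a form
    -- of degree d(k-1); the result is a constant polynomial.
    applyOperators : Vec ℕ n → Poly n → Poly n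
    applyOperators ds P = List.foldr
      (λ i Q → recip! (lookup ds i ℕ.* (k ∸ 1)) ·ᵖ fold Q (operator i) (lookup ds i))
      P (allFin n)

    Tr : ℕ → Carrier
    Tr d = fromℕ ((k ∸ 1) ℕ.^ (n ∸ 1)) *
      sum (List.map (λ ds → constantTerm (applyOperators ds (tr (generic ^ᵐ (d ℕ.* (k ∸ 1))))))
                    (compositions n d))

  ----------------------------------------------------------------------
  -- The A_α tensor of a hypergraph

  module _ (k : ℕ) (H : Hypergraph) where

    private n = order H

    support : ∀ {p} → Vec (Fin n) p → Subset n
    support = Vec.foldr (λ _ → Subset n) (λ i S → ⁅ i ⁆ ∪ S) ⊥

    isEdge? : (S : Subset n) → Dec (∃ λ e → S ≡ edge H e)
    isEdge? S = Fin.any? λ e → Vec.≡-dec Bool._≟_ S (edge H e)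

    adjacencyTensor : Tensor k n
    adjacencyTensor i γ =
      if does (isEdge? (support (i ∷ γ))) then recip! (k ∸ 1) else 0#

    degreeTensor : Tensor k n
    degreeTensor i γ = if does (all? (i Fin.≟_) γ) then fromℕ (degree H i) else 0#

    Aα : Carrier → Tensor k n
    Aα α i γ = α * degreeTensor i γ + (1# - α) * adjacencyTensor i γ

  -- The d-th order A_α-spectral moment (d ≥ 1), as the d-th order trace.
  spectralMoment : (k : ℕ) (α : Carrier) (d : ℕ) → Hypergraph → Carrier
  spectralMoment k α d H = Tr {k} (Aα k H α) d

  ----------------------------------------------------------------------
  -- Extremal hypergraphs

  record IsLargest (P : Hypergraph → Set) (f : Hypergraph → Carrier)
                   (G : Hypergraph) : Set ℓ₂ where
    field
      member : P G
      bound  : ∀ H → P H → f H ≤ f G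

  -- G is second largest, after the largest G₁: its value is below that
  -- of G₁, and no hypergraph other than G₁ (up to isomorphism) has a
  -- greater value.
  record IsSecondLargestAfter (G₁ : Hypergraph) (P : Hypergraph → Set)
                              (f : Hypergraph → Carrier)
                              (G : Hypergraph) : Set ℓ₂ where
    field
      member : P G
      below  : f G < f G₁
      bound  : ∀ H → P H → ¬ (H ≅ G₁) → f H ≤ f G

-- Only closed walks contribute to the second trace.  For d = 2eᵢ they consist of
-- loops at i and give (α dᵢ)²; for d = eᵢ + eⱼ they stay within {i, j}, which for
-- k ≥ 3 contains no hyperedge and for k = 2 gives the same amount for every edge.
-- Hence Tr₂ = (k-1)^(n-1) (α² ∑ dᵢ² + R) with R depending on k, α and m alone.
-- Adding the hyperedges one by one, each meeting the earlier ones, shows that a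
-- connected unicyclic hypergraph has n = m(k-1) vertices, so that the excesses
-- xᵢ = dᵢ - 1 ≥ 0 have sum m and it remains to maximise ∑ xᵢ².
--
-- The g vertices of the cycle have xᵢ ≥ 1; subtracting 1 there leaves y with
-- ∑ y = p = m - g, and ∑ xᵢ² ≤ g + 2p + p², attained by the hypercycle with all
-- pendant hyperedges at one vertex.  Let now g = 3.  If every xᵢ ≤ p, then
-- ∑ xᵢ² ≤ p² + 5, which is the value of the second hypergraph.  If some vertex has
-- x > p, an excess of at most 2 is left for the others; this determines the
-- hypergraph up to isomorphism as the first one.

module Submission where

open import Defs
open import Data.Fin.Base using (Fin)
open import Data.Nat.Base as ℕ using (ℕ; _∸_)
open import Data.Product.Base using (_×_; _,_)

-- Two obstacles shape the proof. A `Poly` is a bare list of terms, so the trace is not simplified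
-- as a polynomial but read through linear functionals; the operators then act by transposes that
-- delete arcs from the words of closed walks. A term survives only if the arcs of its tensor
-- indices are exactly those of a closed walk, and the balance of heads and tails confines the
-- indices. The field order is neither decidable nor total, so degrees are compared in ℕ and only
-- the final inequality is moved to the field.
--
-- The factor (k-1)^(n-1) makes the number of vertices matter for the comparison itself. It is found
-- by tracking r = |es|(k-1) + 1 - |⋃ es| along a growing list of hyperedges: r = 0 excludes cycles,
-- r = 1 provides one, r ≥ 2 provides two different ones, so a unique cycle forces r = 1.
--
-- For the second place, the star is not unfolded to build an isomorphism: it has a vertex of large
-- excess itself, so that it and any rival with such a vertex fit one description, which determines
-- the hypergraph.

module Trace where

  open import Data.Fin.Base using (Fin; zero; suc)
  open import Data.Fin.Properties using (suc-injective; _≟_)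
  open import Data.List.Base as List
    using (List; []; _∷_; _++_; map; concatMap; cartesianProductWith; allFin; [_]; upTo)
  open import Data.List.Membership.Propositional using (_∈_; find)
  open import Data.List.Membership.Propositional.Properties
    using (∈-map⁻; ∈-concatMap⁻; ∈-map⁺; ∈-++⁺ˡ; ∈-++⁺ʳ; ∈-++⁻)
  import Data.List.Properties as List
  open import Data.List.Relation.Binary.Permutation.Propositional
    using (_↭_; ↭-refl; ↭-trans; ↭-reflexive; prep; swap; ↭-sym)
  open import Data.List.Relation.Binary.Permutation.Propositional.Properties
    using (++⁺ˡ; shift; drop-∷; ∷↭∷ʳ; ∈-resp-↭)
  open import Data.List.Relation.Unary.Any using (here; there; Any; satisfied)
  open import Data.Nat.Base as ℕ using (ℕ; _!; _∸_)
  open import Data.Nat.GeneralisedArithmetic using (fold)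
  open import Data.Nat.Properties as ℕ using (_!≢0)
  open import Data.Product.Base using (_,_; proj₁; proj₂; _×_)
  open import Data.Sum.Base using (_⊎_; inj₁; inj₂) renaming (swap to ⊎-swap)
  open import Data.Vec.Base as Vec using (Vec; []; _∷_; lookup)
  import Data.Vec.Properties as Vec
  open import Function.Base using (_∘_; id)
  open import Level using (Level; _⊔_)
  open import Relation.Binary.PropositionalEquality as ≡ using (_≡_; _≢_)
  open import Relation.Nullary using (yes; no; ¬_; contradiction)
  open import Relation.Nullary.Decidable using (dec-true; dec-false)

  module Traces {c ℓ₁ ℓ₂} (F : OrderedField c ℓ₁ ℓ₂) where

    open OrderedField F hiding (zero)
    open Spectral F
    open import Relation.Binary.Reasoning.Setoid setoid
    open import Algebra.Properties.CommutativeSemigroup +-commutativeSemigroup using (interchange)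
    open import Algebra.Properties.CommutativeSemigroup *-commutativeSemigroup using (x∙yz≈y∙xz)
    open import Algebra.Properties.Semiring.Mult semiring using (×1-homo-*)

    private variable
      ℓ ℓ′ ℓ″ : Level
      A : Set ℓ
      B : Set ℓ′
      D : Set ℓ″

    -- Finite sums over lists, indices and tuples

    ∑ₗ : List A → (A → Carrier) → Carrier
    ∑ₗ xs f = sum (map f xs)

    ∑ₗ-cong-∈ : ∀ (xs : List A) {f g} → (∀ {x} → x ∈ xs → f x ≈ g x) → ∑ₗ xs f ≈ ∑ₗ xs g
    ∑ₗ-cong-∈ []       h = refl
    ∑ₗ-cong-∈ (x ∷ xs) h = +-cong (h (here ≡.refl)) (∑ₗ-cong-∈ xs (h ∘ there))

    ∑ₗ-cong : ∀ (xs : List A) {f g} → (∀ x → f x ≈ g x) → ∑ₗ xs f ≈ ∑ₗ xs g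
    ∑ₗ-cong xs h = ∑ₗ-cong-∈ xs (λ {x} _ → h x)

    ∑ₗ-0 : ∀ (xs : List A) → ∑ₗ xs (λ _ → 0#) ≈ 0#
    ∑ₗ-0 []       = refl
    ∑ₗ-0 (x ∷ xs) = trans (+-identityˡ _) (∑ₗ-0 xs)

    ∑ₗ-zero : ∀ (xs : List A) {f} → (∀ {x} → x ∈ xs → f x ≈ 0#) → ∑ₗ xs f ≈ 0#
    ∑ₗ-zero xs h = trans (∑ₗ-cong-∈ xs h) (∑ₗ-0 xs)

    ∑ₗ-++ : ∀ (xs ys : List A) f → ∑ₗ (xs ++ ys) f ≈ ∑ₗ xs f + ∑ₗ ys f
    ∑ₗ-++ []       ys f = sym (+-identityˡ _)
    ∑ₗ-++ (x ∷ xs) ys f = trans (+-congˡ (∑ₗ-++ xs ys f)) (sym (+-assoc _ _ _))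

    ∑ₗ-map : ∀ (h : A → B) xs f → ∑ₗ (map h xs) f ≈ ∑ₗ xs (f ∘ h)
    ∑ₗ-map h xs f = reflexive (≡.cong sum (≡.sym (List.map-∘ xs)))

    ∑ₗ-concatMap : ∀ (h : A → List B) xs f → ∑ₗ (concatMap h xs) f ≈ ∑ₗ xs (λ x → ∑ₗ (h x) f)
    ∑ₗ-concatMap h []       f = refl
    ∑ₗ-concatMap h (x ∷ xs) f = trans (∑ₗ-++ (h x) _ f) (+-congˡ (∑ₗ-concatMap h xs f))

    ∑ₗ-cartesianProductWith : ∀ (h : A → B → D) xs ys f →
      ∑ₗ (cartesianProductWith h xs ys) f ≈ ∑ₗ xs (λ x → ∑ₗ ys (λ y → f (h x y)))
    ∑ₗ-cartesianProductWith h []       ys f = refl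
    ∑ₗ-cartesianProductWith h (x ∷ xs) ys f = trans (∑ₗ-++ (map (h x) ys) _ f)
      (+-cong (∑ₗ-map (h x) ys f) (∑ₗ-cartesianProductWith h xs ys f))

    ∑ₗ-distribˡ-* : ∀ (xs : List A) y f → y * ∑ₗ xs f ≈ ∑ₗ xs (λ x → y * f x)
    ∑ₗ-distribˡ-* []       y f = zeroʳ y
    ∑ₗ-distribˡ-* (x ∷ xs) y f = trans (distribˡ y _ _) (+-congˡ (∑ₗ-distribˡ-* xs y f))

    ∑ₗ-distrib-+ : ∀ (xs : List A) f g → ∑ₗ xs (λ x → f x + g x) ≈ ∑ₗ xs f + ∑ₗ xs g
    ∑ₗ-distrib-+ []       f g = sym (+-identityˡ _)
    ∑ₗ-distrib-+ (x ∷ xs) f g = trans (+-congˡ (∑ₗ-distrib-+ xs f g)) (interchange _ _ _ _)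

    ∑ₗ-comm : ∀ (xs : List A) (ys : List B) (f : A → B → Carrier) →
      ∑ₗ xs (λ x → ∑ₗ ys (f x)) ≈ ∑ₗ ys (λ y → ∑ₗ xs (λ x → f x y))
    ∑ₗ-comm []       ys f = sym (∑ₗ-0 ys)
    ∑ₗ-comm (x ∷ xs) ys f =
      trans (+-congˡ (∑ₗ-comm xs ys f)) (sym (∑ₗ-distrib-+ ys (f x) _))

    ∑ₗ-allFin : ∀ n (f : Fin (ℕ.suc n) → Carrier) →
      ∑ₗ (allFin (ℕ.suc n)) f ≈ f zero + ∑ₗ (allFin n) (f ∘ suc)
    ∑ₗ-allFin n f = +-congˡ (trans
      (reflexive (≡.cong (λ xs → ∑ₗ xs f) (≡.sym (List.map-tabulate id suc))))
      (∑ₗ-map suc (allFin n) f))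

    ∑ₗ-allFin-single : ∀ {n} (i : Fin n) f → (∀ j → j ≢ i → f j ≈ 0#) → ∑ₗ (allFin n) f ≈ f i
    ∑ₗ-allFin-single {ℕ.suc n} zero f h = begin
      ∑ₗ (allFin (ℕ.suc n)) f              ≈⟨ ∑ₗ-allFin n f ⟩
      f zero + ∑ₗ (allFin n) (f ∘ suc)     ≈⟨ +-congˡ (∑ₗ-zero (allFin n) λ _ → h _ λ ()) ⟩
      f zero + 0#                          ≈⟨ +-identityʳ _ ⟩
      f zero                               ∎
    ∑ₗ-allFin-single {ℕ.suc n} (suc i) f h = begin
      ∑ₗ (allFin (ℕ.suc n)) f              ≈⟨ ∑ₗ-allFin n f ⟩
      f zero + ∑ₗ (allFin n) (f ∘ suc)     ≈⟨ +-congʳ (h zero λ ()) ⟩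
      0# + ∑ₗ (allFin n) (f ∘ suc)         ≈⟨ +-identityˡ _ ⟩
      ∑ₗ (allFin n) (f ∘ suc)              ≈⟨ ∑ₗ-allFin-single i (f ∘ suc) (λ j j≢i → h (suc j) (j≢i ∘ suc-injective)) ⟩
      f (suc i)                            ∎

    ∑ₗ-allFin-double : ∀ {n} (i j : Fin n) f → i ≢ j → (∀ l → l ≢ i → l ≢ j → f l ≈ 0#) →
      ∑ₗ (allFin n) f ≈ f i + f j
    ∑ₗ-allFin-double {ℕ.suc n} zero zero f i≢j h with () ← i≢j ≡.refl
    ∑ₗ-allFin-double {ℕ.suc n} zero (suc j) f i≢j h = trans (∑ₗ-allFin n f)
      (+-congˡ (∑ₗ-allFin-single j (f ∘ suc) λ l l≢j → h (suc l) (λ ()) (l≢j ∘ suc-injective)))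
    ∑ₗ-allFin-double {ℕ.suc n} (suc i) zero f i≢j h = trans (∑ₗ-allFin n f) (trans
      (+-congˡ (∑ₗ-allFin-single i (f ∘ suc) λ l l≢i → h (suc l) (l≢i ∘ suc-injective) (λ ())))
      (+-comm _ _))
    ∑ₗ-allFin-double {ℕ.suc n} (suc i) (suc j) f i≢j h = trans (∑ₗ-allFin n f) (trans
      (+-congʳ (h zero (λ ()) (λ ())))
      (trans (+-identityˡ _) (∑ₗ-allFin-double i j (f ∘ suc) (i≢j ∘ ≡.cong suc)
        λ l l≢i l≢j → h (suc l) (l≢i ∘ suc-injective) (l≢j ∘ suc-injective))))

    ∑ₗ-tuples-single : ∀ {n p} (γ : Vec (Fin n) p) f → (∀ δ → δ ≢ γ → f δ ≈ 0#) →
      ∑ₗ (tuples n p) f ≈ f γ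
    ∑ₗ-tuples-single [] f h = +-identityʳ _
    ∑ₗ-tuples-single {n} {ℕ.suc p} (i ∷ γ) f h = begin
      ∑ₗ (tuples n (ℕ.suc p)) f
        ≈⟨ ∑ₗ-cartesianProductWith _∷_ (allFin n) (tuples n p) f ⟩
      ∑ₗ (allFin n) (λ j → ∑ₗ (tuples n p) (λ δ → f (j ∷ δ)))
        ≈⟨ ∑ₗ-allFin-single i _ (λ j j≢i → ∑ₗ-zero (tuples n p) λ {δ} _ → h (j ∷ δ) (j≢i ∘ Vec.∷-injectiveˡ)) ⟩
      ∑ₗ (tuples n p) (λ δ → f (i ∷ δ))
        ≈⟨ ∑ₗ-tuples-single γ _ (λ δ δ≢γ → h (i ∷ δ) (δ≢γ ∘ Vec.∷-injectiveʳ)) ⟩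
      f (i ∷ γ) ∎


    -- Polynomials read through linear functionals

    Functional : ℕ → Set c
    Functional n = Monomial n → Carrier

    -- A polynomial is only ever inspected through linear functionals of its
    -- terms.  Every operation on polynomials then becomes one on functionals,
    -- the derivatives acting by their transposes.
    infix 8 ⟦_⟧_
    ⟦_⟧_ : ∀ {n} → Poly n → Functional n → Carrier
    ⟦ P ⟧ φ = ∑ₗ P λ (y , w) → y * φ w

    module _ {n : ℕ} where

      infix 4 _≋_
      -- Term lists have no normal form, so equal polynomials may be different lists. This is the
      -- equality that the operators respect.
      _≋_ : Poly n → Poly n → Set _
      P ≋ Q = ∀ φ → ⟦ P ⟧ φ ≈ ⟦ Q ⟧ φ

      ⟦⟧-cong : ∀ (P : Poly n) {φ ψ} → (∀ w → φ w ≈ ψ w) → ⟦ P ⟧ φ ≈ ⟦ P ⟧ ψ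
      ⟦⟧-cong P h = ∑ₗ-cong P λ (y , w) → *-congˡ (h w)

      ⟦∑ᵖ⟧ : ∀ {a} {A : Set a} (xs : List A) (f : A → Poly n) φ →
             ⟦ ∑ᵖ xs f ⟧ φ ≈ ∑ₗ xs λ x → ⟦ f x ⟧ φ
      ⟦∑ᵖ⟧ xs f φ = ∑ₗ-concatMap f xs _

      ⟦·ᵖ⟧ : ∀ x (P : Poly n) φ → ⟦ x ·ᵖ P ⟧ φ ≈ x * ⟦ P ⟧ φ
      ⟦·ᵖ⟧ x P φ = begin
        ⟦ x ·ᵖ P ⟧ φ                       ≈⟨ ∑ₗ-map _ P _ ⟩
        ∑ₗ P (λ (y , w) → x * y * φ w)     ≈⟨ ∑ₗ-cong P (λ _ → *-assoc _ _ _) ⟩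
        ∑ₗ P (λ (y , w) → x * (y * φ w))   ≈⟨ ∑ₗ-distribˡ-* P x _ ⟨
        x * ⟦ P ⟧ φ                        ∎

      ⟦∂⟧ : ∀ x (P : Poly n) φ → ⟦ ∂ x P ⟧ φ ≈ ⟦ P ⟧ λ w → ∑ₗ (∂-word x w) φ
      ⟦∂⟧ x P φ = begin
        ⟦ ∂ x P ⟧ φ
          ≈⟨ ∑ₗ-concatMap _ P _ ⟩
        ∑ₗ P (λ (y , w) → ∑ₗ (map (y ,_) (∂-word x w)) λ (y , w) → y * φ w)
          ≈⟨ ∑ₗ-cong P (λ (y , w) → ∑ₗ-map (y ,_) (∂-word x w) _) ⟩
        ∑ₗ P (λ (y , w) → ∑ₗ (∂-word x w) λ w → y * φ w)
          ≈⟨ ∑ₗ-cong P (λ (y , w) → ∑ₗ-distribˡ-* (∂-word x w) y φ) ⟨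
        ⟦ P ⟧ (λ w → ∑ₗ (∂-word x w) φ) ∎

      ∂-words : ∀ {p} → Fin n → Vec (Fin n) p → Monomial n → List (Monomial n)
      ∂-words i []      w = [ w ]
      ∂-words i (j ∷ γ) w = concatMap (∂-word (i , j)) (∂-words i γ w)

      ⟦∂s⟧ : ∀ {p} i (γ : Vec (Fin n) p) (P : Poly n) φ →
             ⟦ Vec.foldr (λ _ → Poly n) (λ j → ∂ (i , j)) P γ ⟧ φ ≈
             ⟦ P ⟧ λ w → ∑ₗ (∂-words i γ w) φ
      ⟦∂s⟧ i []      P φ = ⟦⟧-cong P λ w → sym (+-identityʳ _)
      ⟦∂s⟧ i (j ∷ γ) P φ = begin
        ⟦ ∂ (i , j) Q ⟧ φ
          ≈⟨ ⟦∂⟧ (i , j) Q φ ⟩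
        ⟦ Q ⟧ (λ w → ∑ₗ (∂-word (i , j) w) φ)
          ≈⟨ ⟦∂s⟧ i γ P _ ⟩
        ⟦ P ⟧ (λ w → ∑ₗ (∂-words i γ w) λ w → ∑ₗ (∂-word (i , j) w) φ)
          ≈⟨ ⟦⟧-cong P (λ w → ∑ₗ-concatMap _ (∂-words i γ w) φ) ⟨
        ⟦ P ⟧ (λ w → ∑ₗ (∂-words i (j ∷ γ) w) φ) ∎
        where Q = Vec.foldr (λ _ → Poly n) (λ j → ∂ (i , j)) P γ

      ∂-word-↭ : ∀ x {w w′ : Monomial n} → w′ ∈ ∂-word x w → w ↭ x ∷ w′
      ∂-word-↭ x@(i , j) {(i′ , j′) ∷ w} w′∈ with i ≟ i′ | j ≟ j′
      ... | yes ≡.refl | yes ≡.refl with w′∈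
      ...   | here ≡.refl = ↭-refl
      ...   | there w′∈ with _ , v∈ , ≡.refl ← ∈-map⁻ _ w′∈ =
              ↭-trans (prep _ (∂-word-↭ x v∈)) (swap _ _ ↭-refl)
      ∂-word-↭ x@(i , j) {(i′ , j′) ∷ w} w′∈ | yes _ | no _
        with _ , v∈ , ≡.refl ← ∈-map⁻ _ w′∈ =
          ↭-trans (prep _ (∂-word-↭ x v∈)) (swap _ _ ↭-refl)
      ∂-word-↭ x@(i , j) {(i′ , j′) ∷ w} w′∈ | no _ | _
        with _ , v∈ , ≡.refl ← ∈-map⁻ _ w′∈ =
          ↭-trans (prep _ (∂-word-↭ x v∈)) (swap _ _ ↭-refl)

      arcs : ∀ {p} → Fin n → Vec (Fin n) p → Monomial n
      arcs i γ = map (i ,_) (Vec.toList γ)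

      -- Each derivative deletes one occurrence of its arc. A word on which the derivatives along γ
      -- do not vanish must therefore contain all arcs of γ, which is how a nonzero term constrains
      -- a walk.
      ∂-words-↭ : ∀ {p} i (γ : Vec (Fin n) p) {w w′} → w′ ∈ ∂-words i γ w → w ↭ arcs i γ ++ w′
      ∂-words-↭ i []      (here ≡.refl) = ↭-refl
      ∂-words-↭ i (j ∷ γ) {w} {w′} w′∈ = go (∈-concatMap⁻ (∂-word (i , j)) {xs = ∂-words i γ w} w′∈)
        where
        go : Any ((w′ ∈_) ∘ ∂-word (i , j)) (∂-words i γ w) → w ↭ arcs i (j ∷ γ) ++ w′
        go a with _ , v∈ , w′∈v ← find a =
          ↭-trans (∂-words-↭ i γ v∈)
            (↭-trans (++⁺ˡ (arcs i γ) (∂-word-↭ (i , j) w′∈v)) (shift (i , j) (arcs i γ) w′))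

      -- The coefficient of the empty word: what remains of a term once all its arcs are deleted.
      ε : Functional n
      ε []      = 1#
      ε (_ ∷ _) = 0#

      module _ {k : ℕ} (T : Tensor k n) where

        operatorᵗ : Fin n → Functional n → Functional n
        operatorᵗ i φ w = ∑ₗ (tuples n (k ℕ.∸ 1)) λ γ → T i γ * ∑ₗ (∂-words i γ w) φ

        -- On a word, the arcs leaving i are deleted first and those leaving j second. Transposition
        -- reverses composition, so `operator i` applied after `operator j` gives `operatorᵗ² j i`.
        operatorᵗ² : Fin n → Fin n → Functional n
        operatorᵗ² i j = operatorᵗ i (operatorᵗ j ε)

        ⟦operator⟧ : ∀ i (P : Poly n) φ → ⟦ operator {k} T i P ⟧ φ ≈ ⟦ P ⟧ (operatorᵗ i φ)
        ⟦operator⟧ i P φ = begin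
          ⟦ operator {k} T i P ⟧ φ
            ≈⟨ ⟦∑ᵖ⟧ Γ _ φ ⟩
          ∑ₗ Γ (λ γ → ⟦ T i γ ·ᵖ Vec.foldr (λ _ → Poly n) (λ j → ∂ (i , j)) P γ ⟧ φ)
            ≈⟨ ∑ₗ-cong Γ (λ γ → trans (⟦·ᵖ⟧ (T i γ) (Vec.foldr (λ _ → Poly n) (λ j → ∂ (i , j)) P γ) φ) (*-congˡ (⟦∂s⟧ i γ P φ))) ⟩
          ∑ₗ Γ (λ γ → T i γ * ∑ₗ P (λ (y , w) → y * ∑ₗ (∂-words i γ w) φ))
            ≈⟨ ∑ₗ-cong Γ (λ γ → trans (∑ₗ-distribˡ-* P (T i γ) _) (∑ₗ-cong P λ _ → x∙yz≈y∙xz _ _ _)) ⟩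
          ∑ₗ Γ (λ γ → ∑ₗ P (λ (y , w) → y * (T i γ * ∑ₗ (∂-words i γ w) φ)))
            ≈⟨ ∑ₗ-comm Γ P _ ⟩
          ∑ₗ P (λ (y , w) → ∑ₗ Γ (λ γ → y * (T i γ * ∑ₗ (∂-words i γ w) φ)))
            ≈⟨ ∑ₗ-cong P (λ (y , w) → ∑ₗ-distribˡ-* Γ y _) ⟨
          ⟦ P ⟧ (operatorᵗ i φ) ∎
          where Γ = tuples n (k ℕ.∸ 1)

      constantTerm≈⟦⟧ε : ∀ (P : Poly n) → constantTerm P ≈ ⟦ P ⟧ ε
      constantTerm≈⟦⟧ε []                = refl
      constantTerm≈⟦⟧ε ((x , []) ∷ P)    = +-cong (sym (*-identityʳ x)) (constantTerm≈⟦⟧ε P)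
      constantTerm≈⟦⟧ε ((x , _ ∷ _) ∷ P) = +-cong (sym (zeroʳ x)) (constantTerm≈⟦⟧ε P)

      -- The monomials of entry (i , j) of the p-th power of the generic matrix, each with
      -- coefficient 1.
      walks : ℕ → Fin n → Fin n → List (Monomial n)
      walks ℕ.zero    i j with i ≟ j
      ... | yes _ = [ [] ]
      ... | no  _ = []
      walks (ℕ.suc p) i j = concatMap (λ l → map ((i , l) ∷_) (walks p l j)) (allFin n)

      ∑ₗ-walks : ∀ p i j φ → ∑ₗ (walks (ℕ.suc p) i j) φ ≈
        ∑ₗ (allFin n) λ l → ∑ₗ (walks p l j) (φ ∘ ((i , l) ∷_))
      ∑ₗ-walks p i j φ = trans (∑ₗ-concatMap _ (allFin n) φ)
        (∑ₗ-cong (allFin n) λ l → ∑ₗ-map ((i , l) ∷_) (walks p l j) φ)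

      closedWalkSum : ℕ → Functional n → Carrier
      closedWalkSum p φ = ∑ₗ (allFin n) λ a → ∑ₗ (walks p a a) φ

      ⟦generic*⟧ : ∀ i l (P : Poly n) φ → ⟦ generic i l *ᵖ P ⟧ φ ≈ ⟦ P ⟧ (φ ∘ ((i , l) ∷_))
      ⟦generic*⟧ i l P φ = begin
        ⟦ generic i l *ᵖ P ⟧ φ
          ≈⟨ ∑ₗ-cartesianProductWith (λ (x , u) (y , w) → x * y , u ++ w) (generic i l) P _ ⟩
        ∑ₗ P (λ (y , w) → 1# * y * φ ((i , l) ∷ w)) + 0#
          ≈⟨ +-identityʳ _ ⟩
        ∑ₗ P (λ (y , w) → 1# * y * φ ((i , l) ∷ w))
          ≈⟨ ∑ₗ-cong P (λ _ → *-congʳ (*-identityˡ _)) ⟩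
        ⟦ P ⟧ (φ ∘ ((i , l) ∷_)) ∎

      ⟦generic^⟧ : ∀ p i j φ → ⟦ (generic ^ᵐ p) i j ⟧ φ ≈ ∑ₗ (walks p i j) φ
      ⟦generic^⟧ ℕ.zero i j φ with i ≟ j
      ... | yes _ = +-congʳ (*-identityˡ _)
      ... | no  _ = refl
      ⟦generic^⟧ (ℕ.suc p) i j φ = begin
        ⟦ (generic ^ᵐ ℕ.suc p) i j ⟧ φ
          ≈⟨ ⟦∑ᵖ⟧ (allFin n) _ φ ⟩
        ∑ₗ (allFin n) (λ l → ⟦ generic i l *ᵖ (generic ^ᵐ p) l j ⟧ φ)
          ≈⟨ ∑ₗ-cong (allFin n) (λ l → trans (⟦generic*⟧ i l ((generic ^ᵐ p) l j) φ) (⟦generic^⟧ p l j _)) ⟩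
        ∑ₗ (allFin n) (λ l → ∑ₗ (walks p l j) (φ ∘ ((i , l) ∷_)))
          ≈⟨ ∑ₗ-walks p i j φ ⟨
        ∑ₗ (walks (ℕ.suc p) i j) φ ∎

      ⟦tr⟧ : ∀ p φ → ⟦ tr (generic ^ᵐ p) ⟧ φ ≈ closedWalkSum p φ
      ⟦tr⟧ p φ = trans (⟦∑ᵖ⟧ (allFin n) _ φ) (∑ₗ-cong (allFin n) λ a → ⟦generic^⟧ p a a φ)

      -- Every arc starts where the previous one ends, so both sides list the vertices visited by
      -- the walk.
      walk-tails-heads : ∀ p {i j w} → w ∈ walks p i j →
        map proj₁ w ++ [ j ] ≡ i ∷ map proj₂ w
      walk-tails-heads ℕ.zero {i} {j} w∈ with i ≟ j | w∈
      ... | yes ≡.refl | here ≡.refl = ≡.refl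
      walk-tails-heads (ℕ.suc p) {i} {j} w∈ = go (∈-concatMap⁻ (λ l → map ((i , l) ∷_) (walks p l j)) {xs = allFin n} w∈)
        where
        go : ∀ {w} → Any (λ l → w ∈ map ((i , l) ∷_) (walks p l j)) (allFin n) →
             map proj₁ w ++ [ j ] ≡ i ∷ map proj₂ w
        go a with l , w∈′ ← satisfied a with _ , v∈ , ≡.refl ← ∈-map⁻ _ w∈′ =
          ≡.cong (i ∷_) (walk-tails-heads p v∈)

      -- The two ends of the vertex sequence agree and cancel: every vertex is left as often as it
      -- is entered.
      closed-walk-↭ : ∀ p {a w} → w ∈ walks p a a → map proj₁ w ↭ map proj₂ w
      closed-walk-↭ p {a} {w} w∈ = drop-∷ (↭-trans (∷↭∷ʳ a (map proj₁ w)) (↭-reflexive (walk-tails-heads p w∈)))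


    -- Expansion of the second trace over the compositions of 2

    recip!-inverse : ∀ n → recip! n * fromℕ (n !) ≈ 1#
    recip!-inverse n = trans (*-comm _ _) (proj₂ (invertible (inj₂ (0<fromℕ (n !) {{n !≢0}}))))

    recip!-one : ∀ n → n ! ≡ 1 → recip! n ≈ 1#
    recip!-one n n!≡1 = begin
      recip! n                   ≈⟨ *-identityʳ _ ⟨
      recip! n * 1#              ≈⟨ *-congˡ (+-identityʳ 1#) ⟨
      recip! n * fromℕ 1         ≈⟨ *-congˡ (reflexive (≡.cong fromℕ n!≡1)) ⟨
      recip! n * fromℕ (n !)     ≈⟨ recip!-inverse n ⟩
      1#                         ∎

    ∑< : ∀ n → (Fin n → Fin n → Carrier) → Carrier
    ∑< ℕ.zero    f = 0#
    ∑< (ℕ.suc n) f = ∑ₗ (allFin n) (f zero ∘ suc) + ∑< n λ i j → f (suc i) (suc j)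

    ∑<-cong : ∀ n {f g} → (∀ i j → i ≢ j → f i j ≈ g i j) → ∑< n f ≈ ∑< n g
    ∑<-cong ℕ.zero    h = refl
    ∑<-cong (ℕ.suc n) h = +-cong (∑ₗ-cong (allFin n) λ j → h zero (suc j) λ ())
      (∑<-cong n λ i j i≢j → h (suc i) (suc j) λ { ≡.refl → i≢j ≡.refl })

    ∑<-0 : ∀ n → ∑< n (λ _ _ → 0#) ≈ 0#
    ∑<-0 ℕ.zero    = refl
    ∑<-0 (ℕ.suc n) = trans (+-cong (∑ₗ-0 (allFin n)) (∑<-0 n)) (+-identityˡ 0#)

    module Composed {x r} {X : Set x} (_~_ : X → X → Set r) (~-trans : ∀ {P Q R} → P ~ Q → Q ~ R → P ~ R) where

      compose : ∀ {n} → (Fin n → ℕ → X → X) → Vec ℕ n → X → X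
      compose {n} h ds P = List.foldr (λ i → h i (lookup ds i)) P (allFin n)

      compose-∷ : ∀ {n} (h : Fin (ℕ.suc n) → ℕ → X → X) d ds P →
        compose h (d ∷ ds) P ≡ h zero d (compose (h ∘ suc) ds P)
      compose-∷ {n} h d ds P = ≡.cong (h zero d) (≡.trans
        (≡.cong (List.foldr _ P) (≡.sym (List.map-tabulate {n = n} id suc)))
        (List.foldr-map _ suc P (allFin n)))

      record Steps {n} (h : Fin n → ℕ → X → X) : Set (x ⊔ r) where
        field
          cong  : ∀ i d {P Q} → P ~ Q → h i d P ~ h i d Q
          unit  : ∀ i P → h i 0 P ~ P
      open Steps

      shift-steps : ∀ {n} {h : Fin (ℕ.suc n) → ℕ → X → X} → Steps h → Steps (h ∘ suc)
      shift-steps s = record { cong = cong s ∘ suc ; unit = unit s ∘ suc }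

      Respects : (X → Carrier) → Set _
      Respects V = ∀ {P Q} → P ~ Q → V P ≈ V Q

      first-part : ∀ {n} h (V : X → Carrier) P d e →
        ∑ₗ (map (d ∷_) (compositions n e)) (λ ds → V (compose h ds P)) ≈
        ∑ₗ (compositions n e) λ ds → V (h zero d (compose (h ∘ suc) ds P))
      first-part {n} h V P d e = trans (∑ₗ-map (d ∷_) (compositions n e) _)
        (∑ₗ-cong (compositions n e) λ ds → reflexive (≡.cong V (compose-∷ h d ds P)))

      -- `V` is arbitrary so that the outermost step `h zero d` can be absorbed into it; the
      -- induction on n then continues with the remaining steps.
      compositions-0 : ∀ n h → Steps h → ∀ V → Respects V → ∀ P →
        ∑ₗ (compositions n 0) (λ ds → V (compose h ds P)) ≈ V P
      compositions-0 ℕ.zero    h s V V-resp P = +-identityʳ _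
      compositions-0 (ℕ.suc n) h s V V-resp P = begin
        ∑ₗ (compositions (ℕ.suc n) 0) (λ ds → V (compose h ds P))
          ≈⟨ ∑ₗ-concatMap (λ d₁ → map (d₁ ∷_) (compositions n (0 ∸ d₁))) (upTo 1) _ ⟩
        ∑ₗ (map (0 ∷_) (compositions n 0)) (λ ds → V (compose h ds P)) + 0#
          ≈⟨ trans (+-identityʳ _) (first-part h V P 0 0) ⟩
        ∑ₗ (compositions n 0) (λ ds → V (h zero 0 (compose (h ∘ suc) ds P)))
          ≈⟨ compositions-0 n (h ∘ suc) (shift-steps s) (V ∘ h zero 0) (V-resp ∘ cong s zero 0) P ⟩
        V (h zero 0 P)
          ≈⟨ V-resp (unit s zero P) ⟩
        V P ∎

      compositions-1 : ∀ n h → Steps h → ∀ V → Respects V → ∀ P →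
        ∑ₗ (compositions n 1) (λ ds → V (compose h ds P)) ≈ ∑ₗ (allFin n) λ i → V (h i 1 P)
      compositions-1 ℕ.zero    h s V V-resp P = refl
      compositions-1 (ℕ.suc n) h s V V-resp P = begin
        ∑ₗ (compositions (ℕ.suc n) 1) G
          ≈⟨ ∑ₗ-concatMap (λ d₁ → map (d₁ ∷_) (compositions n (1 ∸ d₁))) (upTo 2) _ ⟩
        ∑ₗ (map (0 ∷_) (compositions n 1)) G + (∑ₗ (map (1 ∷_) (compositions n 0)) G + 0#)
          ≈⟨ +-cong (first-part h V P 0 1) (trans (+-identityʳ _) (first-part h V P 1 0)) ⟩
        ∑ₗ (compositions n 1) (λ ds → V (h zero 0 (compose (h ∘ suc) ds P))) +
        ∑ₗ (compositions n 0) (λ ds → V (h zero 1 (compose (h ∘ suc) ds P)))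
          ≈⟨ +-cong (compositions-1 n (h ∘ suc) (shift-steps s) (V ∘ h zero 0) (V-resp ∘ cong s zero 0) P)
                    (compositions-0 n (h ∘ suc) (shift-steps s) (V ∘ h zero 1) (V-resp ∘ cong s zero 1) P) ⟩
        ∑ₗ (allFin n) (λ i → V (h zero 0 (h (suc i) 1 P))) + V (h zero 1 P)
          ≈⟨ +-comm _ _ ⟩
        V (h zero 1 P) + ∑ₗ (allFin n) (λ i → V (h zero 0 (h (suc i) 1 P)))
          ≈⟨ +-congˡ (∑ₗ-cong (allFin n) λ i → V-resp (unit s zero _)) ⟩
        V (h zero 1 P) + ∑ₗ (allFin n) (λ i → V (h (suc i) 1 P))
          ≈⟨ ∑ₗ-allFin n _ ⟨
        ∑ₗ (allFin (ℕ.suc n)) (λ i → V (h i 1 P)) ∎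
        where
        G = λ ds → V (compose h ds P)

      -- The first part is 0, 1 or 2 and leaves 2, 1 or 0 to the other indices. First part 1 yields
      -- the row of `∑<` at `zero`, first part 2 the diagonal term at `zero`.
      compositions-2 : ∀ n h → Steps h → ∀ V → Respects V → ∀ P →
        ∑ₗ (compositions n 2) (λ ds → V (compose h ds P)) ≈
        ∑ₗ (allFin n) (λ i → V (h i 2 P)) + ∑< n λ i j → V (h i 1 (h j 1 P))
      compositions-2 ℕ.zero    h s V V-resp P = sym (+-identityˡ _)
      compositions-2 (ℕ.suc n) h s V V-resp P = begin
        ∑ₗ (compositions (ℕ.suc n) 2) G
          ≈⟨ ∑ₗ-concatMap (λ d₁ → map (d₁ ∷_) (compositions n (2 ∸ d₁))) (upTo 3) _ ⟩
        ∑ₗ (map (0 ∷_) (compositions n 2)) G + (∑ₗ (map (1 ∷_) (compositions n 1)) G +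
          (∑ₗ (map (2 ∷_) (compositions n 0)) G + 0#))
          ≈⟨ +-cong (first-part h V P 0 2) (+-cong (first-part h V P 1 1) (trans (+-identityʳ _) (first-part h V P 2 0))) ⟩
        ∑ₗ (compositions n 2) (λ ds → V (h zero 0 (compose (h ∘ suc) ds P))) +
        (∑ₗ (compositions n 1) (λ ds → V (h zero 1 (compose (h ∘ suc) ds P))) +
         ∑ₗ (compositions n 0) (λ ds → V (h zero 2 (compose (h ∘ suc) ds P))))
          ≈⟨ +-cong (trans (∑ₗ-cong (compositions n 2) λ ds → V-resp (unit s zero _))
                           (compositions-2 n (h ∘ suc) (shift-steps s) V V-resp P))
              (+-cong (compositions-1 n (h ∘ suc) (shift-steps s) (V ∘ h zero 1) (V-resp ∘ cong s zero 1) P)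
                      (compositions-0 n (h ∘ suc) (shift-steps s) (V ∘ h zero 2) (V-resp ∘ cong s zero 2) P)) ⟩
        (S + R) + (Q + V (h zero 2 P))
          ≈⟨ +-congˡ (+-comm _ _) ⟩
        (S + R) + (V (h zero 2 P) + Q)
          ≈⟨ interchange S R _ Q ⟩
        (S + V (h zero 2 P)) + (R + Q)
          ≈⟨ +-cong (+-comm _ _) (+-comm _ _) ⟩
        (V (h zero 2 P) + S) + (Q + R)
          ≈⟨ +-congʳ (∑ₗ-allFin n _) ⟨
        ∑ₗ (allFin (ℕ.suc n)) (λ i → V (h i 2 P)) + (Q + R) ∎
        where
        S = ∑ₗ (allFin n) λ i → V (h (suc i) 2 P)
        R = ∑< n λ i j → V (h (suc i) 1 (h (suc j) 1 P))
        Q = ∑ₗ (allFin n) λ i → V (h zero 1 (h (suc i) 1 P))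
        G = λ ds → V (compose h ds P)

    module _ {k n : ℕ} (T : Tensor k n) where

      private
        q = k ∸ 1
        step : Fin n → ℕ → Poly n → Poly n
        step i d Q = recip! (d ℕ.* q) ·ᵖ fold Q (operator {k} T i) d

      open Composed {X = Poly n} _≋_ (λ P≋Q Q≋R φ → trans (P≋Q φ) (Q≋R φ))

      private
        fold-cong : ∀ i d {P Q : Poly n} → P ≋ Q →
          fold P (operator {k} T i) d ≋ fold Q (operator {k} T i) d
        fold-cong i ℕ.zero    P≋Q = P≋Q
        fold-cong i (ℕ.suc d) {P} {Q} P≋Q φ = begin
          ⟦ operator {k} T i (fold P (operator {k} T i) d) ⟧ φ
            ≈⟨ ⟦operator⟧ {k = k} T i (fold P (operator {k} T i) d) φ ⟩
          ⟦ fold P (operator {k} T i) d ⟧ _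
            ≈⟨ fold-cong i d {P} {Q} P≋Q _ ⟩
          ⟦ fold Q (operator {k} T i) d ⟧ _
            ≈⟨ ⟦operator⟧ {k = k} T i (fold Q (operator {k} T i) d) φ ⟨
          ⟦ operator {k} T i (fold Q (operator {k} T i) d) ⟧ φ ∎

        steps : Steps step
        steps = record
          { cong = λ i d {P} {Q} P≋Q φ → trans (⟦·ᵖ⟧ _ (fold P (operator {k} T i) d) φ)
              (trans (*-congˡ (fold-cong i d {P} {Q} P≋Q φ)) (sym (⟦·ᵖ⟧ _ (fold Q (operator {k} T i) d) φ)))
          ; unit = λ i P φ → trans (⟦·ᵖ⟧ _ P φ) (trans (*-congʳ (recip!-one 0 ≡.refl)) (*-identityˡ _))
          }

        ⟦step-1⟧ : ∀ i P φ → ⟦ step i 1 P ⟧ φ ≈ recip! (1 ℕ.* q) * ⟦ P ⟧ (operatorᵗ {k = k} T i φ)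
        ⟦step-1⟧ i P φ = trans (⟦·ᵖ⟧ _ (operator {k} T i P) φ) (*-congˡ (⟦operator⟧ {k = k} T i P φ))

        ⟦step-2⟧ : ∀ i P φ → ⟦ step i 2 P ⟧ φ ≈
          recip! (2 ℕ.* q) * ⟦ P ⟧ (operatorᵗ {k = k} T i (operatorᵗ {k = k} T i φ))
        ⟦step-2⟧ i P φ = trans (⟦·ᵖ⟧ _ (operator {k} T i (operator {k} T i P)) φ)
          (*-congˡ (trans (⟦operator⟧ {k = k} T i (operator {k} T i P) φ) (⟦operator⟧ {k = k} T i P _)))

      -- Zero parts act as the identity because 0! = 1. What is left is one part 2, with coefficient
      -- 1/(2q)!, or two parts 1, with 1/q! each.
      Tr₂-expansion : Tr {k} T 2 ≈ fromℕ (q ℕ.^ (n ∸ 1)) *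
        ( ∑ₗ (allFin n) (λ i → recip! (2 ℕ.* q) * closedWalkSum (2 ℕ.* q) (operatorᵗ² {k = k} T i i))
        + ∑< n (λ i j → recip! (1 ℕ.* q) * (recip! (1 ℕ.* q) * closedWalkSum (2 ℕ.* q) (operatorᵗ² {k = k} T j i))))
      Tr₂-expansion = *-congˡ (trans
        (compositions-2 n step steps constantTerm
          (λ {P} {Q} P≋Q → trans (constantTerm≈⟦⟧ε P) (trans (P≋Q ε) (sym (constantTerm≈⟦⟧ε Q)))) M)
        (+-cong
          (∑ₗ-cong (allFin n) λ i → trans (constantTerm≈⟦⟧ε (step i 2 M)) (trans (⟦step-2⟧ i M ε) (*-congˡ (⟦tr⟧ {n} (2 ℕ.* q) (operatorᵗ² {k = k} T i i)))))
          (∑<-cong n λ i j _ → trans (constantTerm≈⟦⟧ε (step i 1 (step j 1 M))) (trans (⟦step-1⟧ i (step j 1 M) ε)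
            (*-congˡ (trans (⟦step-1⟧ j M _) (*-congˡ (⟦tr⟧ {n} (2 ℕ.* q) (operatorᵗ² {k = k} T j i)))))))))
        where M = tr (generic ^ᵐ (2 ℕ.* q))


    -- The contributions of one index and of a pair of indices

    loops : ∀ {n} → ℕ → Fin n → Monomial n
    loops p i = List.replicate p (i , i)

    -- (r + q)(r + q - 1)⋯(r + 1), the number of ways to delete q loops one after another from a
    -- word of q + r equal loops.
    fallingFactorial : ℕ → ℕ → ℕ
    fallingFactorial ℕ.zero    r = 1
    fallingFactorial (ℕ.suc q) r = fallingFactorial q (ℕ.suc r) ℕ.* ℕ.suc r

    fallingFactorial-! : ∀ q r → fallingFactorial q r ℕ.* r ! ≡ (q ℕ.+ r) !
    fallingFactorial-! ℕ.zero    r = ℕ.*-identityˡ _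
    fallingFactorial-! (ℕ.suc q) r = ≡.trans (ℕ.*-assoc (fallingFactorial q (ℕ.suc r)) (ℕ.suc r) (r !))
      (≡.trans (fallingFactorial-! q (ℕ.suc r)) (≡.cong _! (ℕ.+-suc q r)))

    module _ {n : ℕ} where

      replicate-unique : ∀ {p} (γ : Vec (Fin n) p) i → (∀ {x} → x ∈ Vec.toList γ → x ≡ i) →
        γ ≡ Vec.replicate p i
      replicate-unique []      i h = ≡.refl
      replicate-unique (x ∷ γ) i h = ≡.cong₂ _∷_ (h (here ≡.refl)) (replicate-unique γ i (h ∘ there))

      ∈-replicate : ∀ {p p′} → p ≡ ℕ.suc p′ → ∀ (i : Fin n) → i ∈ Vec.toList (Vec.replicate p i)
      ∈-replicate ≡.refl i = here ≡.refl

      ∈-loops : ∀ p {i : Fin n} {arc} → arc ∈ loops p i → arc ≡ (i , i)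
      ∈-loops (ℕ.suc p) (here e)   = e
      ∈-loops (ℕ.suc p) (there a∈) = ∈-loops p a∈

      arcs-tail : ∀ {p i} (γ : Vec (Fin n) p) {arc} → arc ∈ arcs i γ → proj₁ arc ≡ i
      arcs-tail γ a∈ with _ , _ , ≡.refl ← ∈-map⁻ _ a∈ = ≡.refl

      arcs-replicate : ∀ p {i : Fin n} → arcs i (Vec.replicate p i) ≡ loops p i
      arcs-replicate ℕ.zero    = ≡.refl
      arcs-replicate (ℕ.suc p) = ≡.cong (_ ∷_) (arcs-replicate p)

      -- A walk from a to i with a ≢ i is not empty, and its first arc leaves a, so φ vanishes on
      -- it.
      ∑ₗ-walks-elsewhere : ∀ p {a i : Fin n} (φ : Functional n) → (∀ {w arc} → arc ∈ w → proj₁ arc ≢ i → φ w ≈ 0#) → a ≢ i →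
        ∑ₗ (walks p a i) φ ≈ 0#
      ∑ₗ-walks-elsewhere p {a} {i} φ h a≢i = ∑ₗ-zero (walks p a i) (λ {w} → go w)
        where
        go : ∀ w → w ∈ walks p a i → φ w ≈ 0#
        go []            w∈ = contradiction (≡.sym (List.∷-injectiveˡ (walk-tails-heads p w∈))) a≢i
        go ((b , c) ∷ w) w∈ = h {(b , c) ∷ w} (here ≡.refl)
          λ b≡i → a≢i (≡.trans (≡.sym (List.∷-injectiveˡ (walk-tails-heads p w∈))) b≡i)

      -- A walk that steps away from i is killed by its next arc, so only the walk that stays at i
      -- counts.
      ∑ₗ-walks-loops : ∀ p {i : Fin n} (φ : Functional n) → (∀ {w arc} → arc ∈ w → proj₁ arc ≢ i → φ w ≈ 0#) →
        ∑ₗ (walks p i i) φ ≈ φ (loops p i)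
      ∑ₗ-walks-loops ℕ.zero {i} φ h with i ≟ i
      ... | yes _  = +-identityʳ _
      ... | no i≢i = contradiction ≡.refl i≢i
      ∑ₗ-walks-loops (ℕ.suc p) {i} φ h = begin
        ∑ₗ (walks (ℕ.suc p) i i) φ
          ≈⟨ ∑ₗ-walks p i i φ ⟩
        ∑ₗ (allFin n) (λ l → ∑ₗ (walks p l i) (φ ∘ ((i , l) ∷_)))
          ≈⟨ ∑ₗ-allFin-single i _ (λ l → ∑ₗ-walks-elsewhere p _ (h ∘ there)) ⟩
        ∑ₗ (walks p i i) (φ ∘ ((i , i) ∷_))
          ≈⟨ ∑ₗ-walks-loops p _ (h ∘ there) ⟩
        φ (loops (ℕ.suc p) i) ∎

      -- The length is positive because the empty word would otherwise be counted once at every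
      -- vertex, not only at i.
      ∑ₗ-closed-walks-loops : ∀ {p p′} → p ≡ ℕ.suc p′ → ∀ {i : Fin n} (φ : Functional n) →
        (∀ {w arc} → arc ∈ w → proj₁ arc ≢ i → φ w ≈ 0#) →
        closedWalkSum p φ ≈ φ (loops p i)
      ∑ₗ-closed-walks-loops {p} {p′} ≡.refl {i} φ h = trans
        (∑ₗ-allFin-single i _ λ a a≢i → trans (∑ₗ-walks p′ a a φ)
          (∑ₗ-zero (allFin n) λ {l} _ → ∑ₗ-zero (walks p′ l a) λ _ → h (here ≡.refl) a≢i))
        (∑ₗ-walks-loops p φ h)

      ∑ₗ-∂-word-loops : ∀ p (i : Fin n) (φ : Functional n) →
        ∑ₗ (∂-word (i , i) (loops (ℕ.suc p) i)) φ ≈ fromℕ (ℕ.suc p) * φ (loops p i)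
      ∑ₗ-∂-word-loops p i φ rewrite dec-true (i ≟ i) ≡.refl = begin
        φ (loops p i) + ∑ₗ (map ((i , i) ∷_) (∂-word (i , i) (loops p i))) φ
          ≈⟨ +-congˡ (trans (∑ₗ-map _ (∂-word (i , i) (loops p i)) φ) (rest p)) ⟩
        φ (loops p i) + fromℕ p * φ (loops p i)
          ≈⟨ +-congʳ (*-identityˡ _) ⟨
        1# * φ (loops p i) + fromℕ p * φ (loops p i)
          ≈⟨ distribʳ _ _ _ ⟨
        fromℕ (ℕ.suc p) * φ (loops p i) ∎
        where
        rest : ∀ p → ∑ₗ (∂-word (i , i) (loops p i)) (φ ∘ ((i , i) ∷_)) ≈ fromℕ p * φ (loops p i)
        rest ℕ.zero    = sym (zeroˡ _)
        rest (ℕ.suc p) = ∑ₗ-∂-word-loops p i (φ ∘ ((i , i) ∷_))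

      ∑ₗ-∂-words-loops : ∀ q r (i : Fin n) (φ : Functional n) →
        ∑ₗ (∂-words i (Vec.replicate q i) (loops (q ℕ.+ r) i)) φ ≈
        fromℕ (fallingFactorial q r) * φ (loops r i)
      ∑ₗ-∂-words-loops ℕ.zero    r i φ = trans (+-identityʳ _)
        (sym (trans (*-congʳ (+-identityʳ 1#)) (*-identityˡ _)))
      ∑ₗ-∂-words-loops (ℕ.suc q) r i φ = begin
        ∑ₗ (∂-words i (Vec.replicate (ℕ.suc q) i) (loops (ℕ.suc q ℕ.+ r) i)) φ
          ≈⟨ ∑ₗ-concatMap _ (∂-words i (Vec.replicate q i) (loops (ℕ.suc q ℕ.+ r) i)) φ ⟩
        ∑ₗ (∂-words i (Vec.replicate q i) (loops (ℕ.suc q ℕ.+ r) i)) ψ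
          -- The head of the vector is deleted last, from the r + 1 loops that its tail leaves over.
          ≡⟨ ≡.cong (λ s → ∑ₗ (∂-words i (Vec.replicate q i) (loops s i)) ψ) (≡.sym (ℕ.+-suc q r)) ⟩
        ∑ₗ (∂-words i (Vec.replicate q i) (loops (q ℕ.+ ℕ.suc r) i)) ψ
          ≈⟨ ∑ₗ-∂-words-loops q (ℕ.suc r) i ψ ⟩
        fromℕ (fallingFactorial q (ℕ.suc r)) * ∑ₗ (∂-word (i , i) (loops (ℕ.suc r) i)) φ
          ≈⟨ *-congˡ (∑ₗ-∂-word-loops r i φ) ⟩
        fromℕ (fallingFactorial q (ℕ.suc r)) * (fromℕ (ℕ.suc r) * φ (loops r i))
          ≈⟨ *-assoc _ _ _ ⟨
        fromℕ (fallingFactorial q (ℕ.suc r)) * fromℕ (ℕ.suc r) * φ (loops r i)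
          ≈⟨ *-congʳ (×1-homo-* (fallingFactorial q (ℕ.suc r)) (ℕ.suc r)) ⟨
        fromℕ (fallingFactorial (ℕ.suc q) r) * φ (loops r i) ∎
        where
        ψ : Functional n
        ψ w = ∑ₗ (∂-word (i , i) w) φ

      -- A loop does not move, so the walk never leaves its start.
      walk-of-loops : ∀ p {a b : Fin n} {w} → w ∈ walks p a b → (∀ {arc} → arc ∈ w → proj₁ arc ≡ proj₂ arc) →
        ∀ {arc} → arc ∈ w → proj₁ arc ≡ a
      walk-of-loops ℕ.zero {a} {b} w∈ h a∈ with a ≟ b | w∈
      walk-of-loops ℕ.zero w∈ h () | yes _ | here ≡.refl
      walk-of-loops (ℕ.suc p) {a} {b} {w} w∈ h a∈ =
        go (∈-concatMap⁻ (λ l → map ((a , l) ∷_) (walks p l b)) {xs = allFin n} w∈) h a∈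
        where
        go : ∀ {w} → Any (λ l → w ∈ map ((a , l) ∷_) (walks p l b)) (allFin n) →
          (∀ {arc} → arc ∈ w → proj₁ arc ≡ proj₂ arc) → ∀ {arc} → arc ∈ w → proj₁ arc ≡ a
        go s h a∈ with l , w∈′ ← satisfied s with _ , v∈ , ≡.refl ← ∈-map⁻ _ w∈′ with a∈
        ... | here ≡.refl = ≡.refl
        ... | there a∈′ = ≡.trans (walk-of-loops p v∈ (h ∘ there) a∈′) (≡.sym (h (here ≡.refl)))

    module _ {k n : ℕ} (T : Tensor k n) where

      private
        q = k ∸ 1

      -- `ε` kills every leftover letter, so only those γ and δ contribute whose arcs together are
      -- exactly the letters of w. The vanishing has to be checked for these alone.
      operatorᵗ²-zero : ∀ i j w →
        (∀ γ δ → w ↭ arcs i γ ++ (arcs j δ ++ []) → T i γ ≈ 0# ⊎ T j δ ≈ 0#) →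
        operatorᵗ² {k = k} T i j w ≈ 0#
      operatorᵗ²-zero i j w h = ∑ₗ-zero (tuples n q) λ {γ} _ →
        trans (∑ₗ-distribˡ-* (∂-words i γ w) _ _) (∑ₗ-zero (∂-words i γ w) λ {w′} w′∈ →
        trans (∑ₗ-distribˡ-* (tuples n q) _ _) (∑ₗ-zero (tuples n q) λ {δ} _ →
        trans (*-congˡ (∑ₗ-distribˡ-* (∂-words j δ w′) _ _))
        (trans (∑ₗ-distribˡ-* (∂-words j δ w′) _ _) (∑ₗ-zero (∂-words j δ w′) (term γ δ w′ w′∈ _)))))
        where
        term : ∀ γ δ w′ → w′ ∈ ∂-words i γ w → ∀ w″ → w″ ∈ ∂-words j δ w′ →
          T i γ * (T j δ * ε w″) ≈ 0#
        term γ δ w′ w′∈ (_ ∷ _) w″∈ = trans (*-congˡ (zeroʳ _)) (zeroʳ _)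
        term γ δ w′ w′∈ []      w″∈
          with h γ δ (↭-trans (∂-words-↭ i γ w′∈) (++⁺ˡ (arcs i γ) (∂-words-↭ j δ w″∈)))
        ... | inj₁ z = trans (*-congʳ z) (zeroˡ _)
        ... | inj₂ z = trans (*-congˡ (trans (*-congʳ z) (zeroˡ _))) (zeroʳ _)

      -- Deleting the arcs of γ from loops at i is possible only if every entry of γ is i.
      operatorᵗ-loops : ∀ r i (φ : Functional n) → operatorᵗ {k = k} T i φ (loops (q ℕ.+ r) i) ≈
        T i (Vec.replicate q i) * (fromℕ (fallingFactorial q r) * φ (loops r i))
      operatorᵗ-loops r i φ = trans
        (∑ₗ-tuples-single (Vec.replicate q i) _ λ δ δ≢ → trans
          (*-congˡ (∑ₗ-zero (∂-words i δ (loops (q ℕ.+ r) i)) λ w∈ → contradiction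
            (replicate-unique δ i λ x∈ → ≡.cong proj₂ (∈-loops (q ℕ.+ r)
              (∈-resp-↭ (↭-sym (∂-words-↭ i δ w∈)) (∈-++⁺ˡ (∈-map⁺ (i ,_) x∈))))) δ≢))
          (zeroʳ _))
        (*-congˡ (∑ₗ-∂-words-loops q r i φ))

      -- Only the word of 2q loops at i survives. The two operators delete q loops each, in (2q)!
      -- ways altogether, and this cancels the coefficient 1/(2q)!.
      diagonal-term : ∀ {q′} → q ≡ ℕ.suc q′ → ∀ i →
        recip! (2 ℕ.* q) * closedWalkSum (2 ℕ.* q) (operatorᵗ² {k = k} T i i)
        ≈ T i (Vec.replicate q i) * T i (Vec.replicate q i)
      diagonal-term {q′} q≡ i = begin
        r * closedWalkSum (2 ℕ.* q) Φ
          ≈⟨ *-congˡ (∑ₗ-closed-walks-loops (≡.cong (2 ℕ.*_) q≡) Φ off-loops) ⟩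
        r * Φ (loops (q ℕ.+ (q ℕ.+ 0)) i)
          ≈⟨ *-congˡ (operatorᵗ-loops (q ℕ.+ 0) i (operatorᵗ {k = k} T i ε)) ⟩
        r * (t * (fromℕ a * operatorᵗ {k = k} T i ε (loops (q ℕ.+ 0) i)))
          ≈⟨ *-congˡ (*-congˡ (*-congˡ (operatorᵗ-loops 0 i ε))) ⟩
        r * (t * (fromℕ a * (t * (fromℕ b * 1#))))
          ≈⟨ *-congˡ (*-congˡ (*-congˡ (*-congˡ (*-identityʳ _)))) ⟩
        r * (t * (fromℕ a * (t * fromℕ b)))
          ≈⟨ *-congˡ (*-congˡ (x∙yz≈y∙xz _ _ _)) ⟩
        r * (t * (t * (fromℕ a * fromℕ b)))
          ≈⟨ *-congˡ (*-congˡ (*-congˡ (×1-homo-* a b))) ⟨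
        r * (t * (t * fromℕ (a ℕ.* b)))
          ≡⟨ ≡.cong (λ s → r * (t * (t * fromℕ s))) factorials ⟩
        r * (t * (t * fromℕ ((2 ℕ.* q) !)))
          ≈⟨ *-congˡ (*-assoc _ _ _) ⟨
        r * (t * t * fromℕ ((2 ℕ.* q) !))
          ≈⟨ x∙yz≈y∙xz _ _ _ ⟩
        t * t * (r * fromℕ ((2 ℕ.* q) !))
          ≈⟨ *-congˡ (recip!-inverse (2 ℕ.* q)) ⟩
        t * t * 1#
          ≈⟨ *-identityʳ _ ⟩
        t * t ∎
        where
        r = recip! (2 ℕ.* q)
        t = T i (Vec.replicate q i)
        a = fallingFactorial q (q ℕ.+ 0)
        b = fallingFactorial q 0
        Φ = operatorᵗ² {k = k} T i i
        factorials : a ℕ.* b ≡ (2 ℕ.* q) !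
        factorials = ≡.trans (≡.cong (a ℕ.*_)
          (≡.trans (≡.sym (ℕ.*-identityʳ _)) (fallingFactorial-! q 0)))
          (fallingFactorial-! q (q ℕ.+ 0))
        off-loops : ∀ {w arc} → arc ∈ w → proj₁ arc ≢ i → Φ w ≈ 0#
        off-loops {w} a∈ ≢i = operatorᵗ²-zero i i w λ γ δ w↭ →
          contradiction (tail γ δ (∈-resp-↭ w↭ a∈)) ≢i
          where
          tail : ∀ γ δ {arc} → arc ∈ arcs i γ ++ (arcs i δ ++ []) → proj₁ arc ≡ i
          tail γ δ a∈ with ∈-++⁻ (arcs i γ) a∈
          ... | inj₁ a∈ = arcs-tail γ a∈
          ... | inj₂ a∈ with ∈-++⁻ (arcs i δ) a∈
          ...   | inj₁ a∈ = arcs-tail δ a∈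

      -- The tails, hence also the heads, of a contributing closed walk lie in {i, j}.
      off-diagonal-term : ∀ {q′} → q ≡ ℕ.suc q′ →
        (∀ i j γ → (∀ {x} → x ∈ Vec.toList γ → x ≡ i ⊎ x ≡ j) → γ ≢ Vec.replicate q i → T i γ ≈ 0#) →
        ∀ p i j → i ≢ j → closedWalkSum p (operatorᵗ² {k = k} T j i) ≈ 0#
      off-diagonal-term {q′} q≡ T-zero p i j i≢j = ∑ₗ-zero (allFin n) λ {a} _ →
        ∑ₗ-zero (walks p a a) λ {w} w∈ → operatorᵗ²-zero j i w (go w∈)
        where
        module _ {a : Fin n} {w : Monomial n} (w∈ : w ∈ walks p a a) (γ δ : Vec (Fin n) q) (w↭ : w ↭ arcs j γ ++ (arcs i δ ++ [])) where

          arc-cases : ∀ {arc} → arc ∈ w → arc ∈ arcs j γ ⊎ arc ∈ arcs i δ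
          arc-cases a∈ with ∈-++⁻ (arcs j γ) (∈-resp-↭ w↭ a∈)
          ... | inj₁ a∈ = inj₁ a∈
          ... | inj₂ a∈ with ∈-++⁻ (arcs i δ) a∈
          ...   | inj₁ a∈ = inj₂ a∈

          γ-arc : ∀ {x} → x ∈ Vec.toList γ → (j , x) ∈ w
          γ-arc x∈ = ∈-resp-↭ (↭-sym w↭) (∈-++⁺ˡ (∈-map⁺ (j ,_) x∈))

          δ-arc : ∀ {x} → x ∈ Vec.toList δ → (i , x) ∈ w
          δ-arc x∈ = ∈-resp-↭ (↭-sym w↭) (∈-++⁺ʳ (arcs j γ) (∈-++⁺ˡ (∈-map⁺ (i ,_) x∈)))

          head : ∀ {b x} → (b , x) ∈ w → x ≡ j ⊎ x ≡ i
          head a∈ with _ , a∈′ , ≡.refl ← ∈-map⁻ proj₁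
            (∈-resp-↭ (↭-sym (closed-walk-↭ p w∈)) (∈-map⁺ proj₂ a∈)) with arc-cases a∈′
          ... | inj₁ a∈ = inj₁ (arcs-tail γ a∈)
          ... | inj₂ a∈ = inj₂ (arcs-tail δ a∈)

          loop : γ ≡ Vec.replicate q j → δ ≡ Vec.replicate q i →
            ∀ {arc} → arc ∈ w → proj₁ arc ≡ proj₂ arc
          loop ≡.refl ≡.refl {arc} a∈ with arc-cases a∈
          ... | inj₁ a∈ with ≡.refl ← ∈-loops q (≡.subst (arc ∈_) (arcs-replicate q) a∈) = ≡.refl
          ... | inj₂ a∈ with ≡.refl ← ∈-loops q (≡.subst (arc ∈_) (arcs-replicate q) a∈) = ≡.refl

          go : T j γ ≈ 0# ⊎ T i δ ≈ 0#
          go with Vec.≡-dec _≟_ γ (Vec.replicate q j) | Vec.≡-dec _≟_ δ (Vec.replicate q i)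
          ... | no γ≢ | _     = inj₁ (T-zero j i γ (head ∘ γ-arc) γ≢)
          ... | yes _ | no δ≢ = inj₂ (T-zero i j δ (⊎-swap ∘ head ∘ δ-arc) δ≢)
          -- All arcs are now loops, so the closed walk stays at its start a; yet it contains a loop
          -- at i and a loop at j.
          ... | yes γ≡ | yes δ≡ = contradiction (≡.trans
            (tail (δ-arc (≡.subst (λ δ → i ∈ Vec.toList δ) (≡.sym δ≡) (∈-replicate q≡ i)))) (≡.sym
            (tail (γ-arc (≡.subst (λ γ → j ∈ Vec.toList γ) (≡.sym γ≡) (∈-replicate q≡ j)))))) i≢j
            where
            tail : ∀ {arc} → arc ∈ w → proj₁ arc ≡ a
            tail = walk-of-loops p w∈ (loop γ≡ δ≡)

    -- Pairs of indices for k = 2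

    module _ {n : ℕ} (T : Tensor 2 n) where

      ∑ₗ-closed-walks-2 : ∀ (φ : Functional n) → closedWalkSum 2 φ ≈
        ∑ₗ (allFin n) λ a → ∑ₗ (allFin n) λ l → φ ((a , l) ∷ (l , a) ∷ [])
      ∑ₗ-closed-walks-2 φ = ∑ₗ-cong (allFin n) λ a → trans (∑ₗ-walks 1 a a φ)
        (∑ₗ-cong (allFin n) λ l → trans (∑ₗ-walks 0 l a _) (trans
          (∑ₗ-allFin-single a _ (closing a l)) (closed a l)))
        where
        closing : ∀ a l b → b ≢ a → ∑ₗ (walks 0 b a) (λ w → φ ((a , l) ∷ (l , b) ∷ w)) ≈ 0#
        closing a l b b≢a with b ≟ a
        ... | yes b≡a = contradiction b≡a b≢a
        ... | no _    = refl
        closed : ∀ a l → ∑ₗ (walks 0 a a) (λ w → φ ((a , l) ∷ (l , a) ∷ w)) ≈ φ ((a , l) ∷ (l , a) ∷ [])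
        closed a l with a ≟ a
        ... | yes _  = +-identityʳ _
        ... | no a≢a = contradiction ≡.refl a≢a

      private
        -- The hypothesis on w leaves j as the only head of an arc that leaves i, so a single tensor
        -- entry is selected.
        operator-at : ∀ {i j} → i ≢ j → ∀ (φ : Functional n) {w} → (∀ {x w′} → w ↭ (i , x) ∷ w′ → x ≡ j) →
          operatorᵗ {k = 2} T i φ w ≈ T i (j ∷ []) * ∑ₗ (∂-word (i , j) w) φ
        operator-at {i} {j} i≢j φ {w} unique = trans
          (∑ₗ-tuples-single (j ∷ []) _ λ { (x ∷ []) ≢ → trans
            (*-congˡ (∑ₗ-zero (∂-words i (x ∷ []) w) λ w∈ → contradiction
              (≡.cong (_∷ []) (unique (∂-words-↭ i (x ∷ []) w∈))) ≢))
            (zeroʳ _) })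
          (*-congˡ (trans (∑ₗ-++ (∂-word (i , j) w) [] φ) (+-identityʳ _)))

        2-cycle-arc : ∀ {i j x : Fin n} {w} → i ≢ j → (i , j) ∷ (j , i) ∷ [] ↭ (i , x) ∷ w → x ≡ j
        2-cycle-arc i≢j p with ∈-resp-↭ (↭-sym p) (here ≡.refl)
        ... | here ≡.refl         = ≡.refl
        ... | there (here ≡.refl) = contradiction ≡.refl i≢j

        2-cycle-arc′ : ∀ {i j x : Fin n} {w} → i ≢ j → (j , i) ∷ (i , j) ∷ [] ↭ (i , x) ∷ w → x ≡ j
        2-cycle-arc′ i≢j p with ∈-resp-↭ (↭-sym p) (here ≡.refl)
        ... | here ≡.refl         = contradiction ≡.refl i≢j
        ... | there (here ≡.refl) = ≡.refl

        1-cycle-arc : ∀ {i j x : Fin n} {w} → (i , j) ∷ [] ↭ (i , x) ∷ w → x ≡ j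
        1-cycle-arc p with ∈-resp-↭ (↭-sym p) (here ≡.refl)
        ... | here ≡.refl = ≡.refl

      -- One arc must leave i and one must leave j, so the closed walk is i j i or j i j. Each of
      -- the two gives the same product.
      off-diagonal-term-2 : ∀ i j → i ≢ j →
        closedWalkSum 2 (operatorᵗ² {k = 2} T j i) ≈
        T j (i ∷ []) * T i (j ∷ []) + T j (i ∷ []) * T i (j ∷ [])
      off-diagonal-term-2 i j i≢j = begin
        closedWalkSum 2 Φ
          ≈⟨ ∑ₗ-closed-walks-2 Φ ⟩
        ∑ₗ (allFin n) (λ a → ∑ₗ (allFin n) λ l → Φ (word a l))
          ≈⟨ ∑ₗ-allFin-double i j _ i≢j (λ a a≢i a≢j → ∑ₗ-zero (allFin n) λ {l} _ → Φ-zero a l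
               λ { (inj₁ (≡.refl , _)) → a≢i ≡.refl ; (inj₂ (≡.refl , _)) → a≢j ≡.refl }) ⟩
        ∑ₗ (allFin n) (λ l → Φ (word i l)) + ∑ₗ (allFin n) (λ l → Φ (word j l))
          ≈⟨ +-cong
               (∑ₗ-allFin-single j _ λ l l≢j → Φ-zero i l
                 λ { (inj₁ (_ , ≡.refl)) → l≢j ≡.refl ; (inj₂ (≡.refl , _)) → i≢j ≡.refl })
               (∑ₗ-allFin-single i _ λ l l≢i → Φ-zero j l
                 λ { (inj₁ (≡.refl , _)) → i≢j ≡.refl ; (inj₂ (_ , ≡.refl)) → l≢i ≡.refl }) ⟩
        Φ (word i j) + Φ (word j i)
          ≈⟨ +-cong value-ij value-ji ⟩
        T j (i ∷ []) * T i (j ∷ []) + T j (i ∷ []) * T i (j ∷ []) ∎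
        where
        Φ = operatorᵗ² {k = 2} T j i
        j≢i = i≢j ∘ ≡.sym
        word : Fin n → Fin n → Monomial n
        word a l = (a , l) ∷ (l , a) ∷ []

        Φ-zero : ∀ a l → ¬ ((a ≡ i × l ≡ j) ⊎ (a ≡ j × l ≡ i)) → Φ (word a l) ≈ 0#
        Φ-zero a l h = operatorᵗ²-zero {2} T j i (word a l) λ { (x ∷ []) (y ∷ []) p → contradiction
          (ends (∈-resp-↭ (↭-sym p) (here ≡.refl)) (∈-resp-↭ (↭-sym p) (there (here ≡.refl)))) h }
          where
          ends : ∀ {x y} → (j , x) ∈ word a l → (i , y) ∈ word a l → (a ≡ i × l ≡ j) ⊎ (a ≡ j × l ≡ i)
          ends (here ≡.refl)         (here ≡.refl)         = contradiction ≡.refl i≢j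
          ends (here ≡.refl)         (there (here ≡.refl)) = inj₂ (≡.refl , ≡.refl)
          ends (there (here ≡.refl)) (here ≡.refl)         = inj₁ (≡.refl , ≡.refl)
          ends (there (here ≡.refl)) (there (here ≡.refl)) = contradiction ≡.refl i≢j

        last-arc : operatorᵗ {k = 2} T i ε ((i , j) ∷ []) ≈ T i (j ∷ [])
        last-arc = trans (operator-at i≢j ε 1-cycle-arc) (trans (*-congˡ deleted) (*-identityʳ _))
          where
          deleted : ∑ₗ (∂-word (i , j) ((i , j) ∷ [])) ε ≈ 1#
          deleted rewrite dec-true (i ≟ i) ≡.refl | dec-true (j ≟ j) ≡.refl = +-identityʳ _

        value-ij : Φ (word i j) ≈ T j (i ∷ []) * T i (j ∷ [])
        value-ij = trans (operator-at j≢i _ (2-cycle-arc′ j≢i)) (*-congˡ (trans deleted last-arc))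
          where
          deleted : ∑ₗ (∂-word (j , i) (word i j)) (operatorᵗ {k = 2} T i ε) ≈ operatorᵗ {k = 2} T i ε ((i , j) ∷ [])
          deleted rewrite dec-false (j ≟ i) j≢i | dec-true (i ≟ i) ≡.refl | dec-true (j ≟ j) ≡.refl = +-identityʳ _

        value-ji : Φ (word j i) ≈ T j (i ∷ []) * T i (j ∷ [])
        value-ji = trans (operator-at j≢i _ (2-cycle-arc j≢i)) (*-congˡ (trans deleted last-arc))
          where
          deleted : ∑ₗ (∂-word (j , i) (word j i)) (operatorᵗ {k = 2} T i ε) ≈ operatorᵗ {k = 2} T i ε ((i , j) ∷ [])
          deleted rewrite dec-false (j ≟ i) j≢i | dec-true (i ≟ i) ≡.refl | dec-true (j ≟ j) ≡.refl = +-identityʳ _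

-- Counting incidences in natural numbers

module Counting where

  open import Data.Bool.Base using (if_then_else_)
  open import Data.Fin.Base using (Fin; zero; suc; _↑ˡ_; _↑ʳ_)
  open import Data.Fin.Properties using (_≟_; suc-injective; any?)
  open import Data.Fin.Subset using (Subset; inside; outside; _∈_; _∩_; _∪_; ∣_∣)
  open import Data.Fin.Subset.Properties using (_∈?_; x∈p∩q⁺)
  import Data.List.Base as List
  open import Data.Nat.Base using (ℕ; _+_; _*_; _≤_; z≤n; s≤s; _∸_)
  open import Data.Nat.Properties as ℕ
    using (+-*-semiring; +-identityʳ; +-assoc; +-comm; +-suc; +-mono-≤; +-monoʳ-≤; m≤n+m; m≤m+n; ≤-trans; ≤-refl; ≤-reflexive; ≰⇒>; _≤?_; module ≤-Reasoning; *-mono-≤; m∸n+n≡m; +-cancelʳ-≡)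
  open import Data.Nat.Solver using (module +-*-Solver)
  open import Data.Product.Base using (∃; _×_; _,_; proj₁; proj₂)
  open import Data.Vec.Base using ([]; _∷_; here; there)
  open import Data.Vec.Functional using (removeAt)
  open import Function.Base using (_∘_)
  open import Function.Definitions using (Injective)
  open import Level using (Level)
  open import Relation.Binary.PropositionalEquality
    using (_≡_; _≢_; refl; sym; trans; cong; cong₂; module ≡-Reasoning; subst)
  open import Relation.Nullary using (¬_; Dec; yes; no; does; contradiction)
  open import Relation.Nullary.Decidable using (dec-true; dec-false)
  open import Relation.Unary using (Decidable)

  open import Algebra.Properties.Semiring.Sum +-*-semiring public
    using (sum; sum-cong-≗; sum-replicate-zero; ∑-distrib-+; ∑-comm; sum-remove; *-distribˡ-sum; *-distribʳ-sum)

  private variable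
    ℓ ℓ′ : Level
    A : Set ℓ
    B : Set ℓ′

  𝟙 : Dec A → ℕ
  𝟙 P? = if does P? then 1 else 0

  𝟙-true : (P? : Dec A) → A → 𝟙 P? ≡ 1
  𝟙-true P? p = cong (if_then 1 else 0) (dec-true P? p)

  𝟙-false : (P? : Dec A) → ¬ A → 𝟙 P? ≡ 0
  𝟙-false P? ¬p = cong (if_then 1 else 0) (dec-false P? ¬p)

  𝟙-cong : (P? : Dec A) (Q? : Dec B) → (A → B) → (B → A) → 𝟙 P? ≡ 𝟙 Q?
  𝟙-cong (yes p) Q? f g = sym (𝟙-true Q? (f p))
  𝟙-cong (no ¬p) Q? f g = sym (𝟙-false Q? (¬p ∘ g))

  sum-0 : ∀ {n} (f : Fin n → ℕ) → (∀ i → f i ≡ 0) → sum f ≡ 0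
  sum-0 {n} f h = trans (sum-cong-≗ h) (sum-replicate-zero n)

  sum-1 : ∀ n → sum {n} (λ _ → 1) ≡ n
  sum-1 ℕ.zero    = refl
  sum-1 (ℕ.suc n) = cong ℕ.suc (sum-1 n)

  sum-mono-≤ : ∀ {n} {f g : Fin n → ℕ} → (∀ i → f i ≤ g i) → sum f ≤ sum g
  sum-mono-≤ {ℕ.zero}  h = z≤n
  sum-mono-≤ {ℕ.suc n} h = +-mono-≤ (h zero) (sum-mono-≤ (h ∘ suc))

  sum-single : ∀ {n} (i : Fin n) (f : Fin n → ℕ) → (∀ j → j ≢ i → f j ≡ 0) → sum f ≡ f i
  sum-single zero    f h = trans (cong (f zero +_) (sum-0 (f ∘ suc) λ j → h (suc j) λ ())) (+-identityʳ _)
  sum-single (suc i) f h = trans (cong (_+ sum (f ∘ suc)) (h zero λ ()))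
    (sum-single i (f ∘ suc) λ j j≢i → h (suc j) (j≢i ∘ suc-injective))

  term≤sum : ∀ {n} (f : Fin n → ℕ) i → f i ≤ sum f
  term≤sum f zero    = m≤m+n _ _
  term≤sum f (suc i) = ≤-trans (term≤sum (f ∘ suc) i) (m≤n+m _ _)

  two-terms≤sum : ∀ {n} (f : Fin n → ℕ) {i j} → i ≢ j → f i + f j ≤ sum f
  two-terms≤sum f {zero}  {zero}  i≢j = contradiction refl i≢j
  two-terms≤sum f {zero}  {suc j} i≢j = +-monoʳ-≤ (f zero) (term≤sum (f ∘ suc) j)
  two-terms≤sum f {suc i} {zero}  i≢j = ≤-trans (≤-reflexive (+-comm (f (suc i)) _))
    (+-monoʳ-≤ (f zero) (term≤sum (f ∘ suc) i))
  two-terms≤sum f {suc i} {suc j} i≢j = ≤-trans (two-terms≤sum (f ∘ suc) (i≢j ∘ cong suc)) (m≤n+m _ _)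

  sum-↑ : ∀ m {n} (f : Fin (m + n) → ℕ) → sum f ≡ sum (f ∘ (_↑ˡ n)) + sum (f ∘ (m ↑ʳ_))
  sum-↑ ℕ.zero    f = refl
  sum-↑ (ℕ.suc m) f = trans (cong (f zero +_) (sum-↑ m (f ∘ suc))) (sym (+-assoc (f zero) _ _))

  -- Double counting of the pairs (i , v) with w i ≡ v, weighted by h v.
  sum-image : ∀ {m n} (w : Fin m → Fin n) (h : Fin n → ℕ) →
    sum (λ v → sum (λ i → 𝟙 (w i ≟ v)) * h v) ≡ sum (h ∘ w)
  sum-image w h = begin
    sum (λ v → sum (λ i → 𝟙 (w i ≟ v)) * h v)
      ≡⟨ sum-cong-≗ (λ v → *-distribʳ-sum (h v) (λ i → 𝟙 (w i ≟ v))) ⟩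
    sum (λ v → sum (λ i → 𝟙 (w i ≟ v) * h v))
      ≡⟨ ∑-comm (λ v i → 𝟙 (w i ≟ v) * h v) ⟩
    sum (λ i → sum (λ v → 𝟙 (w i ≟ v) * h v))
      ≡⟨ sum-cong-≗ (λ i → trans
           (sum-single (w i) _ λ v v≢ → cong (_* h v) (𝟙-false (w i ≟ v) (v≢ ∘ sym)))
           (trans (cong (_* h (w i)) (𝟙-true (w i ≟ w i) refl)) (+-identityʳ _))) ⟩
    sum (h ∘ w) ∎
    where open ≡-Reasoning

  image≤1 : ∀ {m n} (w : Fin m → Fin n) → Injective _≡_ _≡_ w → ∀ v → sum (λ i → 𝟙 (w i ≟ v)) ≤ 1
  image≤1 {ℕ.zero}  w inj v = z≤n
  image≤1 {ℕ.suc m} w inj v with w zero ≟ v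
  ... | no _     = image≤1 (w ∘ suc) (suc-injective ∘ inj) v
  ... | yes refl = ≤-reflexive (cong ℕ.suc (sum-0 _ λ i →
    𝟙-false (w (suc i) ≟ w zero) λ e → contradiction (inj e) λ ()))

  image≥1 : ∀ {m n} (w : Fin m → Fin n) i → 1 ≤ sum (λ j → 𝟙 (w j ≟ w i))
  image≥1 w i = ≤-trans (≤-reflexive (sym (𝟙-true (w i ≟ w i) refl))) (term≤sum (λ j → 𝟙 (w j ≟ w i)) i)

  image≥1⁻¹ : ∀ {m n} (w : Fin m → Fin n) v → 1 ≤ sum (λ j → 𝟙 (w j ≟ v)) → ∃ λ i → w i ≡ v
  image≥1⁻¹ {ℕ.suc m} w v 1≤ with w zero ≟ v
  ... | yes e = zero , e
  ... | no _ with i , e ← image≥1⁻¹ (w ∘ suc) v 1≤ = suc i , e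

  sum-∘-≤ : ∀ {m n} (w : Fin m → Fin n) → Injective _≡_ _≡_ w → ∀ h → sum (h ∘ w) ≤ sum h
  sum-∘-≤ w inj h = begin
    sum (h ∘ w)                                    ≡⟨ sum-image w h ⟨
    sum (λ v → sum (λ i → 𝟙 (w i ≟ v)) * h v)      ≤⟨ sum-mono-≤ (λ v → bound (image≤1 w inj v) (h v)) ⟩
    sum h                                          ∎
    where
    open ≤-Reasoning
    bound : ∀ {c} → c ≤ 1 → ∀ x → c * x ≤ x
    bound {0} _ x = z≤n
    bound {1} _ x = ≤-reflexive (+-identityʳ x)
    bound {ℕ.suc (ℕ.suc _)} (s≤s ())

  length-filter : ∀ {p} {P : A → Set p} (P? : Decidable P) {n} (g : Fin n → A) →
    List.length (List.filter P? (List.tabulate g)) ≡ sum λ i → 𝟙 (P? (g i))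
  length-filter P? {ℕ.zero}  g = refl
  length-filter P? {ℕ.suc n} g with P? (g zero)
  ... | yes _ = cong ℕ.suc (length-filter P? (g ∘ suc))
  ... | no _  = length-filter P? (g ∘ suc)

  ∣∣≡sum : ∀ {n} (S : Subset n) → ∣ S ∣ ≡ sum λ v → 𝟙 (v ∈? S)
  ∣∣≡sum []            = refl
  ∣∣≡sum (inside ∷ S)  = cong ℕ.suc (∣∣≡sum S)
  ∣∣≡sum (outside ∷ S) = ∣∣≡sum S

  degree≡sum : ∀ H v → degree H v ≡ sum λ e → 𝟙 (v ∈? edge H e)
  degree≡sum H v = length-filter (λ e → v ∈? edge H e) (λ e → e)

  handshake : ∀ H → sum (degree H) ≡ sum λ e → ∣ edge H e ∣
  handshake H = begin
    sum (degree H)                              ≡⟨ sum-cong-≗ (degree≡sum H) ⟩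
    sum (λ v → sum λ e → 𝟙 (v ∈? edge H e))     ≡⟨ ∑-comm (λ v e → 𝟙 (v ∈? edge H e)) ⟩
    sum (λ e → sum λ v → 𝟙 (v ∈? edge H e))     ≡⟨ sum-cong-≗ (λ e → sym (∣∣≡sum (edge H e))) ⟩
    sum (λ e → ∣ edge H e ∣)                    ∎
    where open ≡-Reasoning

  sum-const : ∀ n x → sum {n} (λ _ → x) ≡ n * x
  sum-const ℕ.zero    x = refl
  sum-const (ℕ.suc n) x = cong (x +_) (sum-const n x)

  degree-≥1 : ∀ H {v e} → v ∈ edge H e → 1 ≤ degree H v
  degree-≥1 H {v} {e} v∈e = begin
    1                             ≡⟨ 𝟙-true (v ∈? edge H e) v∈e ⟨
    𝟙 (v ∈? edge H e)             ≤⟨ term≤sum (λ e → 𝟙 (v ∈? edge H e)) e ⟩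
    sum (λ e → 𝟙 (v ∈? edge H e)) ≡⟨ degree≡sum H v ⟨
    degree H v                    ∎
    where open ≤-Reasoning

  degree-≥2 : ∀ H {v e f} → e ≢ f → v ∈ edge H e → v ∈ edge H f → 2 ≤ degree H v
  degree-≥2 H {v} {e} {f} e≢f v∈e v∈f = begin
    2                                     ≡⟨ cong₂ _+_ (𝟙-true (v ∈? edge H e) v∈e) (𝟙-true (v ∈? edge H f) v∈f) ⟨
    𝟙 (v ∈? edge H e) + 𝟙 (v ∈? edge H f) ≤⟨ two-terms≤sum (λ e → 𝟙 (v ∈? edge H e)) e≢f ⟩
    sum (λ e → 𝟙 (v ∈? edge H e))         ≡⟨ degree≡sum H v ⟨
    degree H v                            ∎
    where open ≤-Reasoning

  ∣∪∣+∣∩∣ : ∀ {n} (p q : Subset n) → ∣ p ∪ q ∣ + ∣ p ∩ q ∣ ≡ ∣ p ∣ + ∣ q ∣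
  ∣∪∣+∣∩∣ []            []            = refl
  ∣∪∣+∣∩∣ (outside ∷ p) (outside ∷ q) = ∣∪∣+∣∩∣ p q
  ∣∪∣+∣∩∣ (outside ∷ p) (inside ∷ q)  = trans (cong ℕ.suc (∣∪∣+∣∩∣ p q)) (sym (+-suc ∣ p ∣ ∣ q ∣))
  ∣∪∣+∣∩∣ (inside ∷ p)  (outside ∷ q) = cong ℕ.suc (∣∪∣+∣∩∣ p q)
  ∣∪∣+∣∩∣ (inside ∷ p)  (inside ∷ q)  = cong ℕ.suc (trans (+-suc ∣ p ∪ q ∣ _)
    (trans (cong ℕ.suc (∣∪∣+∣∩∣ p q)) (sym (+-suc ∣ p ∣ ∣ q ∣))))

  -- The remaining set is returned with its size bound so that extraction can be repeated to obtain
  -- several distinct elements.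
  extract : ∀ {n j} (p : Subset n) → ℕ.suc j ≤ ∣ p ∣ →
    ∃ λ x → x ∈ p × ∃ λ (q : Subset n) → j ≤ ∣ q ∣ × (∀ {y} → y ∈ q → y ∈ p × y ≢ x)
  extract (inside ∷ p)  (s≤s j≤) = zero , here , outside ∷ p , j≤ , λ { (there y∈) → there y∈ , λ () }
  extract (outside ∷ p) j≤ with x , x∈ , q , j≤q , h ← extract p j≤ =
    suc x , there x∈ , outside ∷ q , j≤q ,
    λ { (there y∈) → there (proj₁ (h y∈)) , proj₂ (h y∈) ∘ suc-injective }

  two-elements : ∀ {n} (p : Subset n) → 2 ≤ ∣ p ∣ → ∃ λ x → ∃ λ y → x ∈ p × y ∈ p × x ≢ y
  two-elements p 2≤ with x , x∈ , q , 1≤ , h ← extract p 2≤ with y , y∈ , _ ← extract q 1≤ =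
    x , y , x∈ , proj₁ (h y∈) , proj₂ (h y∈) ∘ sym

  ∣∣≤1 : ∀ {n} (p : Subset n) → (∀ {x y} → x ∈ p → y ∈ p → x ≡ y) → ∣ p ∣ ≤ 1
  ∣∣≤1 p h with ∣ p ∣ ≤? 1
  ... | yes ≤1 = ≤1
  ... | no ≰1 with _ , _ , x∈ , y∈ , x≢y ← two-elements p (≰⇒> ≰1) = contradiction (h x∈ y∈) x≢y

  ∣∣≥2 : ∀ {n} (p : Subset n) {x y} → x ≢ y → x ∈ p → y ∈ p → 2 ≤ ∣ p ∣
  ∣∣≥2 p {x} {y} x≢y x∈ y∈ = begin
    2                             ≡⟨ cong₂ _+_ (𝟙-true (x ∈? p) x∈) (𝟙-true (y ∈? p) y∈) ⟨
    𝟙 (x ∈? p) + 𝟙 (y ∈? p)       ≤⟨ two-terms≤sum (λ v → 𝟙 (v ∈? p)) x≢y ⟩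
    sum (λ v → 𝟙 (v ∈? p))        ≡⟨ ∣∣≡sum p ⟨
    ∣ p ∣                         ∎
    where open ≤-Reasoning

  linear-≡ : ∀ {H} → IsLinear H → ∀ {e f u v} → u ≢ v →
    u ∈ edge H e → u ∈ edge H f → v ∈ edge H e → v ∈ edge H f → e ≡ f
  linear-≡ {H} lin {e} {f} u≢v ue uf ve vf with e ≟ f
  ... | yes e≡f = e≡f
  ... | no e≢f with ≤-trans (∣∣≥2 (edge H e ∩ edge H f) u≢v (x∈p∩q⁺ (ue , uf)) (x∈p∩q⁺ (ve , vf))) (lin e f e≢f)
  ... | s≤s ()

  open +-*-Solver using (solve; _:+_; _:*_; _:=_; con)

  -- Bounds on sums of squares with a prescribed sum

  sumSquares : ∀ {n} → (Fin n → ℕ) → ℕ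
  sumSquares f = sum λ v → f v * f v

  sumSquares≤sum² : ∀ {n} (f : Fin n → ℕ) → sumSquares f ≤ sum f * sum f
  sumSquares≤sum² {ℕ.zero}  f = z≤n
  sumSquares≤sum² {ℕ.suc n} f = begin
    a * a + sumSquares (f ∘ suc)    ≤⟨ ℕ.+-monoʳ-≤ (a * a) (sumSquares≤sum² (f ∘ suc)) ⟩
    a * a + s * s                   ≤⟨ m≤m+n _ (2 * (a * s)) ⟩
    a * a + s * s + 2 * (a * s)     ≡⟨ solve 2 (λ a s → a :* a :+ s :* s :+ con 2 :* (a :* s) := (a :+ s) :* (a :+ s)) refl a s ⟩
    (a + s) * (a + s)               ∎
    where
    open ≤-Reasoning
    a = f zero
    s = sum (f ∘ suc)

  positive-term : ∀ {n} (f : Fin n → ℕ) → 1 ≤ sum f → ∃ λ u → 1 ≤ f u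
  positive-term {ℕ.suc n} f 1≤ with f zero in eq
  ... | ℕ.suc _ = zero , ≤-trans (s≤s z≤n) (≤-reflexive (sym eq))
  ... | 0 with u , 1≤fu ← positive-term (f ∘ suc) 1≤ = suc u , 1≤fu

  -- With mark the indicator of the image of w, the decomposition f = excess + mark
  -- reduces bounds on sumSquares f to bounds on sumSquares excess.
  module Excess {n g : ℕ} (w : Fin g → Fin n) (w-inj : Injective _≡_ _≡_ w)
                (f : Fin n → ℕ) (1≤f : ∀ i → 1 ≤ f (w i)) (p : ℕ) (sum≡ : sum f ≡ p + g) where

    mark : Fin n → ℕ
    mark v = sum λ i → 𝟙 (w i ≟ v)

    excess : Fin n → ℕ
    excess v = f v ∸ mark v

    mark≤ : ∀ v → mark v ≤ f v
    mark≤ v with mark v in eq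
    ... | 0 = z≤n
    ... | ℕ.suc c with i , refl ← image≥1⁻¹ w v (≤-trans (s≤s z≤n) (≤-reflexive (sym eq))) =
      ≤-trans (≤-trans (≤-reflexive (sym eq)) (image≤1 w w-inj (w i))) (1≤f i)

    f≡ : ∀ v → f v ≡ excess v + mark v
    f≡ v = sym (m∸n+n≡m (mark≤ v))

    sum-mark : sum mark ≡ g
    sum-mark = trans (sum-cong-≗ λ v → sym (ℕ.*-identityʳ (mark v)))
      (trans (sum-image w (λ _ → 1)) (sum-1 g))

    sum-excess : sum excess ≡ p
    sum-excess = +-cancelʳ-≡ g _ p (begin
      sum excess + g                 ≡⟨ cong (sum excess +_) sum-mark ⟨
      sum excess + sum mark          ≡⟨ ∑-distrib-+ excess mark ⟨
      sum (λ v → excess v + mark v)  ≡⟨ sum-cong-≗ f≡ ⟨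
      sum f                          ≡⟨ sum≡ ⟩
      p + g                          ∎)
      where open ≡-Reasoning

    -- Put y = `excess v` and c = `mark v`, which is 0 or 1. For c = 1 this is an equality; for c =
    -- 0 the term 2y is given away, at no cost when the excess lies on the image of w.
    square≤ : ∀ v → f v * f v ≤ excess v * excess v + (2 * excess v + mark v)
    square≤ v = ≤-trans (≤-reflexive (cong (λ x → x * x) (f≡ v))) (bound (excess v) (mark v) (image≤1 w w-inj v))
      where
      bound : ∀ y c → c ≤ 1 → (y + c) * (y + c) ≤ y * y + (2 * y + c)
      bound y 0 _ = ≤-trans (≤-reflexive (cong (λ x → x * x) (+-identityʳ y))) (m≤m+n (y * y) _)
      bound y 1 _ = ≤-reflexive (solve 1 (λ y → (y :+ con 1) :* (y :+ con 1) := y :* y :+ (con 2 :* y :+ con 1)) refl y)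
      bound y (ℕ.suc (ℕ.suc _)) (s≤s ())

    sumSquares≤ : sumSquares f ≤ sumSquares excess + (2 * p + g)
    sumSquares≤ = begin
      sumSquares f
        ≤⟨ sum-mono-≤ square≤ ⟩
      sum (λ v → excess v * excess v + (2 * excess v + mark v))
        ≡⟨ ∑-distrib-+ (λ v → excess v * excess v) (λ v → 2 * excess v + mark v) ⟩
      sumSquares excess + sum (λ v → 2 * excess v + mark v)
        ≡⟨ cong (sumSquares excess +_) (∑-distrib-+ (λ v → 2 * excess v) mark) ⟩
      sumSquares excess + (sum (λ v → 2 * excess v) + sum mark)
        ≡⟨ cong (sumSquares excess +_) (cong₂ _+_ (trans (sym (*-distribˡ-sum 2 excess)) (cong (2 *_) sum-excess)) sum-mark) ⟩
      sumSquares excess + (2 * p + g) ∎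
      where
      open ≤-Reasoning

    largest-bound : sumSquares f ≤ p * p + (2 * p + g)
    largest-bound = ≤-trans sumSquares≤ (ℕ.+-monoˡ-≤ (2 * p + g)
      (subst (λ s → sumSquares excess ≤ s * s) sum-excess (sumSquares≤sum² excess)))

    private
      -- With all the excess at v, the bound f v ≤ p forces v to be unmarked. Excess and mark then
      -- have disjoint supports, and the squares have no mixed terms.
      concentrated : (∀ v → f v ≤ p) → ∀ v → excess v ≡ p → sumSquares f ≤ p * p + g
      concentrated f≤p v ≡p = begin
        sumSquares f                          ≡⟨ sum-cong-≗ square ⟩
        sum (λ u → excess u * excess u + mark u)    ≡⟨ ∑-distrib-+ (λ u → excess u * excess u) mark ⟩
        sumSquares excess + sum mark          ≤⟨ +-mono-≤ (sumSquares≤sum² excess) (≤-reflexive sum-mark) ⟩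
        sum excess * sum excess + g           ≡⟨ cong (λ s → s * s + g) sum-excess ⟩
        p * p + g                             ∎
        where
        open ≤-Reasoning
        mark-v : mark v ≡ 0
        mark-v = ℕ.n≤0⇒n≡0 (ℕ.+-cancelˡ-≤ p _ _ (begin
          p + mark v          ≡⟨ cong (_+ mark v) ≡p ⟨
          excess v + mark v   ≡⟨ f≡ v ⟨
          f v                 ≤⟨ f≤p v ⟩
          p                   ≡⟨ +-identityʳ p ⟨
          p + 0               ∎))
        elsewhere : ∀ u → u ≢ v → excess u ≡ 0
        elsewhere u u≢v = ℕ.n≤0⇒n≡0 (ℕ.+-cancelʳ-≤ p _ _ (begin
          excess u + p        ≡⟨ cong (excess u +_) ≡p ⟨
          excess u + excess v ≤⟨ two-terms≤sum excess u≢v ⟩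
          sum excess          ≡⟨ sum-excess ⟩
          p                   ∎))
        idempotent : ∀ c → c ≤ 1 → c * c ≡ c
        idempotent 0 _ = refl
        idempotent 1 _ = refl
        idempotent (ℕ.suc (ℕ.suc _)) (s≤s ())
        square : ∀ u → f u * f u ≡ excess u * excess u + mark u
        square u with u ≟ v
        ... | yes refl = trans (cong (λ x → x * x) (f≡ v)) (trans
          (cong (λ c → (excess v + c) * (excess v + c)) mark-v) (trans
          (cong (λ x → x * x) (+-identityʳ (excess v)))
          (trans (sym (+-identityʳ _)) (cong (excess v * excess v +_) (sym mark-v)))))
        ... | no u≢v = trans (cong (λ x → x * x) (f≡ u)) (trans
          (cong (λ y → (y + mark u) * (y + mark u)) (elsewhere u u≢v)) (trans
          (idempotent (mark u) (image≤1 w w-inj u))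
          (cong (λ y → y * y + mark u) (sym (elsewhere u u≢v)))))

      -- The excess splits into a positive part a at one vertex and a positive rest b. Among such
      -- splittings of p, a² + b² is largest when one part is 1.
      spread : 2 ≤ p → (∀ v → excess v ≢ p) → sumSquares f ≤ p * p + (2 + g)
      spread 2≤p ≢p with u , 1≤a ← positive-term excess (≤-trans (s≤s z≤n) (≤-trans 2≤p (≤-reflexive (sym sum-excess)))) = begin
        sumSquares f                       ≤⟨ sumSquares≤ ⟩
        sumSquares excess + (2 * p + g)    ≤⟨ ℕ.+-monoˡ-≤ (2 * p + g) split ⟩
        (a * a + b * b) + (2 * p + g)      ≡⟨ cong (λ s → (a * a + b * b) + (2 * s + g)) (sym a+b≡p) ⟩
        (a * a + b * b) + (2 * (a + b) + g)  ≤⟨ arithmetic a b 1≤a 1≤b ⟩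
        (a + b) * (a + b) + (2 + g)        ≡⟨ cong (λ s → s * s + (2 + g)) a+b≡p ⟩
        p * p + (2 + g)                    ∎
        where
        open ≤-Reasoning
        a = excess u
        rest : ∃ λ b → a + b ≡ p × sumSquares excess ≤ a * a + b * b
        rest = go excess u sum-excess
          where
          go : ∀ {n s} (y : Fin n → ℕ) u → sum y ≡ s → ∃ λ b → y u + b ≡ s × sumSquares y ≤ y u * y u + b * b
          go {ℕ.suc n} y u refl = sum (removeAt y u) , sym (sum-remove {i = u} y) ,
            ≤-trans (≤-reflexive (sum-remove {i = u} (λ v → y v * y v)))
              (ℕ.+-monoʳ-≤ (y u * y u) (sumSquares≤sum² (removeAt y u)))
        b = proj₁ rest
        a+b≡p = proj₁ (proj₂ rest)
        split = proj₂ (proj₂ rest)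
        1≤b : 1 ≤ b
        1≤b with b in eq
        ... | 0       = contradiction (trans (sym (+-identityʳ a)) (trans (cong (a +_) (sym eq)) a+b≡p)) (≢p u)
        ... | ℕ.suc _ = s≤s z≤n
        -- The slack is 2(a - 1)(b - 1), which reads 2 * (a * b) once the successors are stripped.
        arithmetic : ∀ a b → 1 ≤ a → 1 ≤ b → (a * a + b * b) + (2 * (a + b) + g) ≤ (a + b) * (a + b) + (2 + g)
        arithmetic (ℕ.suc a) (ℕ.suc b) _ _ = ≤-trans (m≤m+n _ (2 * (a * b))) (≤-reflexive
          (solve 3 (λ a b g →
            (((con 1 :+ a) :* (con 1 :+ a) :+ (con 1 :+ b) :* (con 1 :+ b)) :+ (con 2 :* ((con 1 :+ a) :+ (con 1 :+ b)) :+ g))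
              :+ con 2 :* (a :* b)
            := ((con 1 :+ a) :+ (con 1 :+ b)) :* ((con 1 :+ a) :+ (con 1 :+ b)) :+ (con 2 :+ g)) refl a b g))

    second-bound : 2 ≤ p → (∀ v → f v ≤ p) → sumSquares f ≤ p * p + (2 + g)
    second-bound 2≤p f≤p with any? (λ v → excess v ℕ.≟ p)
    ... | yes (v , ≡p) = ≤-trans (concentrated f≤p v ≡p) (ℕ.+-monoʳ-≤ (p * p) (m≤n+m g 2))
    ... | no ¬∃        = spread 2≤p λ v ≡p → ¬∃ (v , ≡p)

  -- The vertex w j contributes (p + 1)² = p² + 2p + 1, each other marked vertex at least 1.
  star-bound : ∀ {n g} (w : Fin g → Fin n) → Injective _≡_ _≡_ w → ∀ f j p →
    p + 1 ≤ f (w j) → (∀ i → 1 ≤ f (w i)) → p * p + (2 * p + g) ≤ sumSquares f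
  star-bound {n} {g} w w-inj f j p p+1≤ 1≤ = begin
    p * p + (2 * p + g)
      ≡⟨ ℕ.+-assoc (p * p) (2 * p) g ⟨
    (p * p + 2 * p) + g
      -- The bound is spread over the g indices, 1 at each and p² + 2p more at j, so that it can be
      -- compared term by term.
      ≡⟨ cong₂ _+_ (sym (trans (sum-single j _ λ i i≢j → cong (_* (p * p + 2 * p)) (𝟙-false (j ≟ i) (i≢j ∘ sym)))
           (trans (cong (_* (p * p + 2 * p)) (𝟙-true (j ≟ j) refl)) (+-identityʳ _)))) (sym (sum-1 g)) ⟩
    sum (λ i → 𝟙 (j ≟ i) * (p * p + 2 * p)) + sum {g} (λ _ → 1)
      ≡⟨ ∑-distrib-+ (λ i → 𝟙 (j ≟ i) * (p * p + 2 * p)) (λ _ → 1) ⟨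
    sum (λ i → 𝟙 (j ≟ i) * (p * p + 2 * p) + 1)
      ≤⟨ sum-mono-≤ term ⟩
    sum (λ i → f (w i) * f (w i))
      ≤⟨ sum-∘-≤ w w-inj (λ v → f v * f v) ⟩
    sumSquares f ∎
    where
    open ≤-Reasoning
    term : ∀ i → 𝟙 (j ≟ i) * (p * p + 2 * p) + 1 ≤ f (w i) * f (w i)
    term i with j ≟ i
    ... | yes refl = ≤-trans (≤-reflexive (solve 1 (λ p → (con 1 :* (p :* p :+ con 2 :* p)) :+ con 1 := (p :+ con 1) :* (p :+ con 1)) refl p))
      (*-mono-≤ p+1≤ p+1≤)
    ... | no _ = *-mono-≤ (1≤ i) (1≤ i)

-- The second moment in terms of the degrees

module MomentFormula where

  open Trace
  open Counting
  open import Data.Bool.Base using (true; false)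
  import Data.Bool.Properties as Bool
  open import Data.Empty using () renaming (⊥ to Empty)
  open import Data.Fin.Base using (Fin; zero; suc)
  open import Data.Fin.Properties using (_≟_; suc-injective)
  open import Data.Fin.Subset using (Subset; _∈_; _⊆_; _∪_; ⁅_⁆; ⊥; ∣_∣)
  open import Data.Fin.Subset.Properties
    using (x∈⁅x⁆; x∈⁅y⁆⇒x≡y; x∈p∪q⁺; x∈p∪q⁻; ∉⊥; ⊆-antisym; p⊂q⇒∣p∣<∣q∣; _∈?_)
  open import Data.List.Base as List using (List; []; _∷_; allFin)
  import Data.List.Membership.Propositional as List
  open import Data.List.Relation.Unary.Any using (here; there)
  open import Data.Nat.Base as ℕ using (ℕ; _∸_; s≤s; z≤n)
  import Data.Nat.Properties as ℕ
  open import Data.Product.Base using (∃; _×_; _,_; proj₁; proj₂)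
  open import Data.Sum.Base using (_⊎_; inj₁; inj₂; swap)
  open import Data.Vec.Base as Vec using (Vec; []; _∷_)
  import Data.Vec.Properties as Vec
  open import Data.Vec.Relation.Unary.All using (All; []; _∷_; all?)
  open import Function.Base using (_∘_)
  open import Relation.Binary.PropositionalEquality as ≡ using (_≡_; _≢_)
  open import Relation.Nullary using (¬_; Dec; yes; no; does; contradiction)
  open import Relation.Nullary.Decidable using (dec-true; dec-false; decidable-stable)

  degreeSquares : Hypergraph → ℕ
  degreeSquares H = sum λ v → degree H v ℕ.* degree H v

  -- The counterpart of `∑<` in ℕ, where adjacent pairs are counted before the result is embedded
  -- into the field.
  pairSum : ∀ {n} → (Fin n → Fin n → ℕ) → ℕ
  pairSum {ℕ.zero}  f = 0
  pairSum {ℕ.suc n} f = sum (f zero ∘ suc) ℕ.+ pairSum λ i j → f (suc i) (suc j)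

  pairSum-cong : ∀ {n} {f g : Fin n → Fin n → ℕ} → (∀ i j → f i j ≡ g i j) → pairSum f ≡ pairSum g
  pairSum-cong {ℕ.zero}  h = ≡.refl
  pairSum-cong {ℕ.suc n} h = ≡.cong₂ ℕ._+_ (sum-cong-≗ (h zero ∘ suc)) (pairSum-cong λ i j → h (suc i) (suc j))

  pairSum-0 : ∀ {n} (f : Fin n → Fin n → ℕ) → (∀ i j → i ≢ j → f i j ≡ 0) → pairSum f ≡ 0
  pairSum-0 {ℕ.zero}  f h = ≡.refl
  pairSum-0 {ℕ.suc n} f h = ≡.cong₂ ℕ._+_ (sum-0 _ λ j → h zero (suc j) λ ())
    (pairSum-0 _ λ i j i≢j → h (suc i) (suc j) (i≢j ∘ suc-injective))

  pairSum-comm : ∀ {n m} (f : Fin n → Fin n → Fin m → ℕ) →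
    pairSum (λ i j → sum (f i j)) ≡ sum λ e → pairSum λ i j → f i j e
  pairSum-comm {ℕ.zero} {m} f = ≡.sym (sum-0 {m} (λ _ → 0) λ _ → ≡.refl)
  pairSum-comm {ℕ.suc n} {m} f = ≡.trans
    (≡.cong₂ ℕ._+_ (∑-comm (f zero ∘ suc)) (pairSum-comm λ i j → f (suc i) (suc j)))
    (≡.sym (∑-distrib-+ {m} (λ e → sum λ j → f zero (suc j) e) (λ e → pairSum λ i j → f (suc i) (suc j) e)))

  -- Only one of (a , b) and (b , a) occurs among the pairs i < j. Symmetry of f makes the value f a
  -- b in either case.
  pairSum-single : ∀ {n} {a b : Fin n} (f : Fin n → Fin n → ℕ) → a ≢ b → (∀ i j → f i j ≡ f j i) →
    (∀ i j → i ≢ j → f i j ≢ 0 → (i ≡ a × j ≡ b) ⊎ (i ≡ b × j ≡ a)) → pairSum f ≡ f a b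
  pairSum-single {a = zero}  {zero}  f a≢b f-sym h = contradiction ≡.refl a≢b
  pairSum-single {a = zero}  {suc b} f a≢b f-sym h = ≡.trans
    (≡.cong₂ ℕ._+_
      (sum-single b _ λ j j≢b → decidable-stable (f zero (suc j) ℕ.≟ 0) λ f≢0 → j≢b (left (h zero (suc j) (λ ()) f≢0)))
      (pairSum-0 _ λ i j i≢j → decidable-stable (f (suc i) (suc j) ℕ.≟ 0) λ f≢0 → right (h (suc i) (suc j) (i≢j ∘ suc-injective) f≢0)))
    (ℕ.+-identityʳ _)
    where
    left : ∀ {j} → (zero ≡ zero × suc j ≡ suc b) ⊎ (zero ≡ suc b × suc j ≡ zero) → j ≡ b
    left (inj₁ (_ , ≡.refl)) = ≡.refl
    right : ∀ {i j} → (suc i ≡ zero × suc j ≡ suc b) ⊎ (suc i ≡ suc b × suc j ≡ zero) → Empty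
    right (inj₁ (() , _))
    right (inj₂ (_ , ()))
  pairSum-single {a = suc a} {zero}  f a≢b f-sym h = ≡.trans
    (pairSum-single {a = zero} {suc a} f (λ ()) f-sym λ i j i≢j f≢0 → swap (h i j i≢j f≢0))
    (f-sym zero (suc a))
  pairSum-single {a = suc a} {suc b} f a≢b f-sym h = ≡.cong₂ ℕ._+_
    (sum-0 _ λ j → decidable-stable (f zero (suc j) ℕ.≟ 0) λ f≢0 → right (h zero (suc j) (λ ()) f≢0))
    (pairSum-single (λ i j → f (suc i) (suc j)) (a≢b ∘ ≡.cong suc) (λ i j → f-sym (suc i) (suc j))
      λ i j i≢j f≢0 → lower (h (suc i) (suc j) (i≢j ∘ suc-injective) f≢0))
    where
    right : ∀ {j} → (zero ≡ suc a × j ≡ suc b) ⊎ (zero ≡ suc b × j ≡ suc a) → Empty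
    right (inj₁ (() , _))
    right (inj₂ (() , _))
    lower : ∀ {i j} → (suc i ≡ suc a × suc j ≡ suc b) ⊎ (suc i ≡ suc b × suc j ≡ suc a) →
      (i ≡ a × j ≡ b) ⊎ (i ≡ b × j ≡ a)
    lower (inj₁ (≡.refl , ≡.refl)) = inj₁ (≡.refl , ≡.refl)
    lower (inj₂ (≡.refl , ≡.refl)) = inj₂ (≡.refl , ≡.refl)

  module _ {n : ℕ} where

    -- The trailing `⊥` makes this the `support` of the vector (i , j) by definition.
    doubleton : Fin n → Fin n → Subset n
    doubleton i j = ⁅ i ⁆ ∪ (⁅ j ⁆ ∪ ⊥)

    ∈-doubleton⁻ : ∀ {i j x} → x ∈ doubleton i j → x ≡ i ⊎ x ≡ j
    ∈-doubleton⁻ {i} {j} x∈ with x∈p∪q⁻ ⁅ i ⁆ _ x∈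
    ... | inj₁ x∈ = inj₁ (x∈⁅y⁆⇒x≡y i x∈)
    ... | inj₂ x∈ with x∈p∪q⁻ ⁅ j ⁆ ⊥ x∈
    ...   | inj₁ x∈ = inj₂ (x∈⁅y⁆⇒x≡y j x∈)
    ...   | inj₂ x∈ = contradiction x∈ ∉⊥

    ∈-doubletonˡ : ∀ i j → i ∈ doubleton i j
    ∈-doubletonˡ i j = x∈p∪q⁺ (inj₁ (x∈⁅x⁆ i))

    ∈-doubletonʳ : ∀ i j → j ∈ doubleton i j
    ∈-doubletonʳ i j = x∈p∪q⁺ (inj₂ (x∈p∪q⁺ (inj₁ (x∈⁅x⁆ j))))

    doubleton⊆ : ∀ {i j} {S : Subset n} → i ∈ S → j ∈ S → doubleton i j ⊆ S
    doubleton⊆ i∈ j∈ x∈ with ∈-doubleton⁻ x∈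
    ... | inj₁ ≡.refl = i∈
    ... | inj₂ ≡.refl = j∈

    doubleton-comm : ∀ i j → doubleton i j ≡ doubleton j i
    doubleton-comm i j = ⊆-antisym (doubleton⊆ (∈-doubletonʳ j i) (∈-doubletonˡ j i))
                                   (doubleton⊆ (∈-doubletonʳ i j) (∈-doubletonˡ i j))

    -- If the inclusion were proper, S would have more than two elements.
    doubleton-unique : ∀ {S : Subset n} {i j} → ∣ S ∣ ≡ 2 → i ≢ j → i ∈ S → j ∈ S → doubleton i j ≡ S
    doubleton-unique {S} {i} {j} ∣S∣≡2 i≢j i∈ j∈ = ⊆-antisym sub (λ {x} → sup x)
      where
      sub = doubleton⊆ i∈ j∈
      sup : ∀ x → x ∈ S → x ∈ doubleton i j
      sup x x∈S with x ∈? doubleton i j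
      ... | yes x∈ = x∈
      ... | no x∉  = contradiction (ℕ.≤-trans (p⊂q⇒∣p∣<∣q∣ ((λ {y} → sub {y}) , x , x∈S , x∉)) (ℕ.≤-reflexive ∣S∣≡2))
        (ℕ.<⇒≱ (s≤s (∣∣≥2 (doubleton i j) i≢j (∈-doubletonˡ i j) (∈-doubletonʳ i j))))

    sized-two : ∀ (S : Subset n) → ∣ S ∣ ≡ 2 → ∃ λ a → ∃ λ b → a ≢ b × doubleton a b ≡ S
    sized-two S ∣S∣≡2 with a , b , a∈ , b∈ , a≢b ← two-elements S (ℕ.≤-reflexive (≡.sym ∣S∣≡2)) =
      a , b , a≢b , doubleton-unique ∣S∣≡2 a≢b a∈ b∈

    doubleton-injective : ∀ {i j a b : Fin n} → i ≢ j → doubleton i j ≡ doubleton a b →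
      (i ≡ a × j ≡ b) ⊎ (i ≡ b × j ≡ a)
    doubleton-injective {i} {j} {a} {b} i≢j e
      with ∈-doubleton⁻ (≡.subst (i ∈_) e (∈-doubletonˡ i j)) | ∈-doubleton⁻ (≡.subst (j ∈_) e (∈-doubletonʳ i j))
    ... | inj₁ i≡a | inj₂ j≡b = inj₁ (i≡a , j≡b)
    ... | inj₂ i≡b | inj₁ j≡a = inj₂ (i≡b , j≡a)
    ... | inj₁ ≡.refl | inj₁ ≡.refl = contradiction ≡.refl i≢j
    ... | inj₂ ≡.refl | inj₂ ≡.refl = contradiction ≡.refl i≢j

    _≟ₛ_ : (S T : Subset n) → Dec (S ≡ T)
    _≟ₛ_ = Vec.≡-dec Bool._≟_

    pairs-spanning : ∀ (S : Subset n) → ∣ S ∣ ≡ 2 → pairSum (λ i j → 𝟙 (doubleton i j ≟ₛ S)) ≡ 1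
    pairs-spanning S ∣S∣≡2 with a , b , a≢b , ≡.refl ← sized-two S ∣S∣≡2 = ≡.trans
      (pairSum-single _ a≢b
        (λ i j → ≡.cong (λ D → 𝟙 (D ≟ₛ S)) (doubleton-comm i j))
        λ i j i≢j ≢0 → doubleton-injective i≢j (decided i j ≢0))
      (𝟙-true (S ≟ₛ S) ≡.refl)
      where
      decided : ∀ i j → 𝟙 (doubleton i j ≟ₛ S) ≢ 0 → doubleton i j ≡ S
      decided i j ≢0 with doubleton i j ≟ₛ S
      ... | yes e = e
      ... | no _  = contradiction ≡.refl ≢0

  𝟙-any : ∀ {m p} {P : Fin m → Set p} (P? : ∀ e → Dec (P e)) (∃P? : Dec (∃ P)) →
    (∀ {e f} → P e → P f → e ≡ f) → 𝟙 ∃P? ≡ sum λ e → 𝟙 (P? e)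
  𝟙-any P? (yes (e , Pe)) unique = ≡.sym (≡.trans
    (sum-single e _ λ f f≢e → 𝟙-false (P? f) λ Pf → f≢e (unique Pf Pe)) (𝟙-true (P? e) Pe))
  𝟙-any P? (no ¬∃P) unique = ≡.sym (sum-0 _ λ e → 𝟙-false (P? e) λ Pe → ¬∃P (e , Pe))

  edge-injective : ∀ {k H} → 2 ℕ.≤ k → IsUniform k H → IsLinear H → ∀ {e f} → edge H e ≡ edge H f → e ≡ f
  edge-injective {k} {H} 2≤k uni lin {e} {f} eq
    with x , y , x∈ , y∈ , x≢y ← two-elements (edge H e) (ℕ.≤-trans 2≤k (ℕ.≤-reflexive (≡.sym (uni e)))) =
    linear-≡ {H} lin {e} {f} x≢y x∈ (≡.subst (x ∈_) eq x∈) y∈ (≡.subst (y ∈_) eq y∈)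

  module Moment {c ℓ₁ ℓ₂} (F : OrderedField c ℓ₁ ℓ₂) where

    open OrderedField F hiding (zero; sum)
    open Spectral F
    open Traces F
    open import Relation.Binary.Reasoning.Setoid setoid
    open import Algebra.Properties.Semiring.Mult semiring using (×-homo-+; ×1-homo-*)
    open import Algebra.Properties.CommutativeSemigroup *-commutativeSemigroup using () renaming (interchange to *-interchange)

    fromℕ-+ : ∀ a b → fromℕ (a ℕ.+ b) ≈ fromℕ a + fromℕ b
    fromℕ-+ a b = ×-homo-+ 1# a b

    fromℕ-sum : ∀ {n} (f : Fin n → ℕ) → ∑ₗ (allFin n) (fromℕ ∘ f) ≈ fromℕ (sum f)
    fromℕ-sum {ℕ.zero}  f = refl
    fromℕ-sum {ℕ.suc n} f = trans (∑ₗ-allFin n (fromℕ ∘ f))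
      (trans (+-congˡ (fromℕ-sum (f ∘ suc))) (sym (fromℕ-+ (f zero) _)))

    fromℕ-pairSum : ∀ {n} (f : Fin n → Fin n → ℕ) → ∑< n (λ i j → fromℕ (f i j)) ≈ fromℕ (pairSum f)
    fromℕ-pairSum {ℕ.zero}  f = refl
    fromℕ-pairSum {ℕ.suc n} f = trans
      (+-cong (fromℕ-sum (f zero ∘ suc)) (fromℕ-pairSum λ i j → f (suc i) (suc j)))
      (sym (fromℕ-+ (sum (f zero ∘ suc)) _))

    ∑<-distribˡ-* : ∀ n x f → x * ∑< n f ≈ ∑< n λ i j → x * f i j
    ∑<-distribˡ-* ℕ.zero    x f = zeroʳ x
    ∑<-distribˡ-* (ℕ.suc n) x f = trans (distribˡ x _ _)
      (+-cong (∑ₗ-distribˡ-* (allFin n) x _) (∑<-distribˡ-* n x _))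

    module _ (k : ℕ) (H : Hypergraph) (uni : IsUniform k H) where

      private n = order H

      ∈-support : ∀ {p x} (γ : Vec (Fin n) p) → x ∈ support k H γ → x List.∈ Vec.toList γ
      ∈-support []      x∈ = contradiction x∈ ∉⊥
      ∈-support (i ∷ γ) x∈ with x∈p∪q⁻ ⁅ i ⁆ _ x∈
      ... | inj₁ x∈ = here (x∈⁅y⁆⇒x≡y i x∈)
      ... | inj₂ x∈ = there (∈-support γ x∈)

      adjacency-zero : ∀ i γ → (∀ e → support k H (i ∷ γ) ≢ edge H e) → adjacencyTensor k H i γ ≈ 0#
      adjacency-zero i γ h rewrite dec-false (isEdge? k H (support k H (i ∷ γ))) (λ (e , eq) → h e eq) = refl

      -- The support of (i , ... , i) is a single vertex, hence no hyperedge when k ≥ 2, and the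
      -- adjacency part vanishes.
      diagonal-entry : 2 ℕ.≤ k → ∀ α i → Aα k H α i (Vec.replicate (k ∸ 1) i) ≈ α * fromℕ (degree H i)
      diagonal-entry 2≤k α i = begin
        α * degreeTensor k H i γ + (1# - α) * adjacencyTensor k H i γ
          ≈⟨ +-cong (*-congˡ degree-part) (trans (*-congˡ (adjacency-zero i γ not-edge)) (zeroʳ _)) ⟩
        α * fromℕ (degree H i) + 0#
          ≈⟨ +-identityʳ _ ⟩
        α * fromℕ (degree H i) ∎
        where
        γ = Vec.replicate (k ∸ 1) i
        all-same : ∀ p → All (i ≡_) (Vec.replicate p i)
        all-same ℕ.zero    = []
        all-same (ℕ.suc p) = ≡.refl ∷ all-same p
        degree-part : degreeTensor k H i γ ≈ fromℕ (degree H i)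
        degree-part rewrite dec-true (all? (i ≟_) γ) (all-same (k ∸ 1)) = refl
        ∈-replicate⁻ : ∀ p {x} → x List.∈ Vec.toList (Vec.replicate p i) → x ≡ i
        ∈-replicate⁻ (ℕ.suc p) (here e)   = e
        ∈-replicate⁻ (ℕ.suc p) (there x∈) = ∈-replicate⁻ p x∈
        not-edge : ∀ e → support k H (i ∷ γ) ≢ edge H e
        not-edge e eq with x , y , x∈ , y∈ , x≢y ← two-elements (edge H e) (ℕ.≤-trans 2≤k (ℕ.≤-reflexive (≡.sym (uni e)))) =
          x≢y (≡.trans (at x∈) (≡.sym (at y∈)))
          where
          at : ∀ {z} → z ∈ edge H e → z ≡ i
          at {z} z∈ = ∈-replicate⁻ (ℕ.suc (k ∸ 1)) (∈-support (i ∷ γ) (≡.subst (z ∈_) (≡.sym eq) z∈))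

      replicate-unique-All : ∀ {p i} (γ : Vec (Fin n) p) → All (i ≡_) γ → γ ≡ Vec.replicate p i
      replicate-unique-All []      []             = ≡.refl
      replicate-unique-All (j ∷ γ) (≡.refl ∷ all) = ≡.cong (j ∷_) (replicate-unique-All γ all)

      degree-off-diagonal : ∀ i γ → γ ≢ Vec.replicate (k ∸ 1) i → degreeTensor k H i γ ≈ 0#
      degree-off-diagonal i γ γ≢ rewrite dec-false (all? (i ≟_) γ) (γ≢ ∘ replicate-unique-All γ) = refl

      two-vertex-entry : 3 ℕ.≤ k → ∀ α i j γ → (∀ {x} → x List.∈ Vec.toList γ → x ≡ i ⊎ x ≡ j) →
        γ ≢ Vec.replicate (k ∸ 1) i → Aα k H α i γ ≈ 0#
      two-vertex-entry 3≤k α i j γ within γ≢ = begin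
        α * degreeTensor k H i γ + (1# - α) * adjacencyTensor k H i γ
          ≈⟨ +-cong (*-congˡ (degree-off-diagonal i γ γ≢)) (*-congˡ (adjacency-zero i γ not-edge)) ⟩
        α * 0# + (1# - α) * 0#
          ≈⟨ +-cong (zeroʳ _) (zeroʳ _) ⟩
        0# + 0#
          ≈⟨ +-identityˡ 0# ⟩
        0# ∎
        where
        not-edge : ∀ e → support k H (i ∷ γ) ≢ edge H e
        not-edge e eq
          with x , x∈ , S , 2≤S , S⊆ ← extract (edge H e) (ℕ.≤-trans 3≤k (ℕ.≤-reflexive (≡.sym (uni e))))
          with y , z , y∈ , z∈ , y≢z ← two-elements S 2≤S =
          pigeonhole (at x∈) (at (proj₁ (S⊆ y∈))) (at (proj₁ (S⊆ z∈)))
            (proj₂ (S⊆ y∈) ∘ ≡.sym) (proj₂ (S⊆ z∈) ∘ ≡.sym) y≢z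
          where
          at : ∀ {z} → z ∈ edge H e → z ≡ i ⊎ z ≡ j
          at {z} z∈ with ∈-support (i ∷ γ) (≡.subst (z ∈_) (≡.sym eq) z∈)
          ... | here z≡i = inj₁ z≡i
          ... | there z∈ = within z∈
          pigeonhole : ∀ {x y z} → x ≡ i ⊎ x ≡ j → y ≡ i ⊎ y ≡ j → z ≡ i ⊎ z ≡ j →
            x ≢ y → x ≢ z → ¬ (y ≢ z)
          pigeonhole (inj₁ ≡.refl) (inj₁ ≡.refl) _ x≢y _ _ = x≢y ≡.refl
          pigeonhole (inj₂ ≡.refl) (inj₂ ≡.refl) _ x≢y _ _ = x≢y ≡.refl
          pigeonhole (inj₁ ≡.refl) (inj₂ ≡.refl) (inj₁ ≡.refl) _ x≢z _ = x≢z ≡.refl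
          pigeonhole (inj₁ ≡.refl) (inj₂ ≡.refl) (inj₂ ≡.refl) _ _ y≢z = y≢z ≡.refl
          pigeonhole (inj₂ ≡.refl) (inj₁ ≡.refl) (inj₁ ≡.refl) _ _ y≢z = y≢z ≡.refl
          pigeonhole (inj₂ ≡.refl) (inj₁ ≡.refl) (inj₂ ≡.refl) _ x≢z _ = x≢z ≡.refl

      diagonal-sum : ∀ {q′} → k ∸ 1 ≡ ℕ.suc q′ → 2 ℕ.≤ k → ∀ α →
        ∑ₗ (allFin n) (λ i → recip! (2 ℕ.* (k ∸ 1)) * closedWalkSum (2 ℕ.* (k ∸ 1)) (operatorᵗ² {k = k} (Aα k H α) i i))
        ≈ α * α * fromℕ (degreeSquares H)
      diagonal-sum q≡ 2≤k α = begin
        _ ≈⟨ ∑ₗ-cong (allFin n) (diagonal-term {k = k} (Aα k H α) q≡) ⟩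
        ∑ₗ (allFin n) (λ i → t i * t i)
          ≈⟨ ∑ₗ-cong (allFin n) (λ i → trans (*-cong (diagonal-entry 2≤k α i) (diagonal-entry 2≤k α i))
               (*-interchange _ _ _ _)) ⟩
        ∑ₗ (allFin n) (λ i → α * α * (fromℕ (degree H i) * fromℕ (degree H i)))
          ≈⟨ ∑ₗ-distribˡ-* (allFin n) (α * α) _ ⟨
        α * α * ∑ₗ (allFin n) (λ i → fromℕ (degree H i) * fromℕ (degree H i))
          ≈⟨ *-congˡ (∑ₗ-cong (allFin n) λ i → sym (×1-homo-* (degree H i) (degree H i))) ⟩
        α * α * ∑ₗ (allFin n) (λ i → fromℕ (degree H i ℕ.* degree H i))
          ≈⟨ *-congˡ (fromℕ-sum λ i → degree H i ℕ.* degree H i) ⟩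
        α * α * fromℕ (degreeSquares H) ∎
        where
        t = λ i → Aα k H α i (Vec.replicate (k ∸ 1) i)

    module _ (H : Hypergraph) (uni : IsUniform 2 H) (lin : IsLinear H) where

      private n = order H

      adjacent? : (i j : Fin n) → Dec (∃ λ e → doubleton i j ≡ edge H e)
      adjacent? i j = isEdge? 2 H (doubleton i j)

      -- Double counting: an edge is spanned by exactly one pair, and linearity lets a pair span at
      -- most one edge.
      adjacent-pairs : pairSum (λ i j → 𝟙 (adjacent? i j)) ≡ size H
      adjacent-pairs = ≡.trans
        (pairSum-cong λ i j → 𝟙-any (λ e → doubleton i j ≟ₛ edge H e) (adjacent? i j)
          λ p q → edge-injective {H = H} ℕ.≤-refl uni lin (≡.trans (≡.sym p) q))
        (≡.trans (pairSum-comm λ i j e → 𝟙 (doubleton i j ≟ₛ edge H e))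
        (≡.trans (sum-cong-≗ λ e → pairs-spanning (edge H e) (uni e)) (sum-1 (size H))))

      off-diagonal-entry : ∀ α i j → i ≢ j → Aα 2 H α i (j ∷ []) ≈
        fromℕ (𝟙 (adjacent? i j)) * ((1# - α) * recip! 1)
      off-diagonal-entry α i j i≢j = begin
        α * degreeTensor 2 H i (j ∷ []) + (1# - α) * adjacencyTensor 2 H i (j ∷ [])
          ≈⟨ +-congʳ (trans (*-congˡ (degree-off-diagonal 2 H uni i (j ∷ []) λ { ≡.refl → i≢j ≡.refl })) (zeroʳ _)) ⟩
        0# + (1# - α) * adjacencyTensor 2 H i (j ∷ [])
          ≈⟨ +-identityˡ _ ⟩
        (1# - α) * adjacencyTensor 2 H i (j ∷ [])
          ≈⟨ adjacency-part ⟩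
        fromℕ (𝟙 (adjacent? i j)) * ((1# - α) * recip! 1) ∎
        where
        adjacency-part : (1# - α) * adjacencyTensor 2 H i (j ∷ []) ≈
          fromℕ (𝟙 (adjacent? i j)) * ((1# - α) * recip! 1)
        adjacency-part with does (adjacent? i j)
        ... | true  = sym (trans (*-congʳ (+-identityʳ 1#)) (*-identityˡ _))
        ... | false = trans (zeroʳ _) (sym (zeroˡ _))

      -- Each adjacent pair contributes the same amount twice. The factors `recip! 1` stay
      -- unevaluated, since what matters is that the result depends on α and the number of edges
      -- alone.
      off-diagonal-sum : ∀ α →
        ∑< n (λ i j → recip! 1 * (recip! 1 * closedWalkSum 2 (operatorᵗ² {k = 2} (Aα 2 H α) j i)))
        ≈ recip! 1 * recip! 1 * (((1# - α) * recip! 1) * ((1# - α) * recip! 1) * fromℕ (2 ℕ.* size H))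
      off-diagonal-sum α = begin
        _ ≈⟨ ∑<-cong n (λ i j i≢j → trans (sym (*-assoc _ _ _)) (*-congˡ (trans
               (off-diagonal-term-2 (Aα 2 H α) i j i≢j) (square i j i≢j)))) ⟩
        ∑< n (λ i j → r * r * (s * s * fromℕ (2 ℕ.* 𝟙 (adjacent? i j))))
          ≈⟨ ∑<-distribˡ-* n (r * r) _ ⟨
        r * r * ∑< n (λ i j → s * s * fromℕ (2 ℕ.* 𝟙 (adjacent? i j)))
          ≈⟨ *-congˡ (∑<-distribˡ-* n (s * s) _) ⟨
        r * r * (s * s * ∑< n (λ i j → fromℕ (2 ℕ.* 𝟙 (adjacent? i j))))
          ≈⟨ *-congˡ (*-congˡ (trans (∑<-cong n λ i j _ → ×1-homo-* 2 (𝟙 (adjacent? i j))) (sym (∑<-distribˡ-* n (fromℕ 2) _)))) ⟩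
        r * r * (s * s * (fromℕ 2 * ∑< n (λ i j → fromℕ (𝟙 (adjacent? i j)))))
          ≈⟨ *-congˡ (*-congˡ (*-congˡ (trans (fromℕ-pairSum (λ i j → 𝟙 (adjacent? i j))) (reflexive (≡.cong fromℕ adjacent-pairs))))) ⟩
        r * r * (s * s * (fromℕ 2 * fromℕ (size H)))
          ≈⟨ *-congˡ (*-congˡ (×1-homo-* 2 (size H))) ⟨
        r * r * (s * s * fromℕ (2 ℕ.* size H)) ∎
        where
        r = recip! 1
        s = (1# - α) * recip! 1
        T = Aα 2 H α
        square : ∀ i j → i ≢ j → T j (i ∷ []) * T i (j ∷ []) + T j (i ∷ []) * T i (j ∷ []) ≈
          s * s * fromℕ (2 ℕ.* 𝟙 (adjacent? i j))
        square i j i≢j = begin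
          T j (i ∷ []) * T i (j ∷ []) + T j (i ∷ []) * T i (j ∷ [])
            ≈⟨ +-cong product product ⟩
          s * s * fromℕ x + s * s * fromℕ x
            ≈⟨ distribˡ _ _ _ ⟨
          s * s * (fromℕ x + fromℕ x)
            ≈⟨ *-congˡ (+-congˡ (reflexive (≡.cong fromℕ (≡.sym (ℕ.+-identityʳ x))))) ⟩
          s * s * (fromℕ x + fromℕ (x ℕ.+ 0))
            ≈⟨ *-congˡ (fromℕ-+ x (x ℕ.+ 0)) ⟨
          s * s * fromℕ (2 ℕ.* x) ∎
          where
          x = 𝟙 (adjacent? i j)
          idempotent : ∀ {a} {A : Set a} (P? : Dec A) → 𝟙 P? ℕ.* 𝟙 P? ≡ 𝟙 P?
          idempotent (yes _) = ≡.refl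
          idempotent (no _)  = ≡.refl
          product : T j (i ∷ []) * T i (j ∷ []) ≈ s * s * fromℕ x
          product = begin
            T j (i ∷ []) * T i (j ∷ [])
              ≈⟨ *-cong (trans (off-diagonal-entry α j i (i≢j ∘ ≡.sym))
                   (*-congʳ (reflexive (≡.cong (λ D → fromℕ (𝟙 (isEdge? 2 H D))) (doubleton-comm j i)))))
                   (off-diagonal-entry α i j i≢j) ⟩
            fromℕ x * s * (fromℕ x * s)     ≈⟨ *-interchange _ _ _ _ ⟩
            fromℕ x * fromℕ x * (s * s)     ≈⟨ *-congʳ (×1-homo-* x x) ⟨
            fromℕ (x ℕ.* x) * (s * s)       ≡⟨ ≡.cong (λ y → fromℕ y * (s * s)) (idempotent (adjacent? i j)) ⟩
            fromℕ x * (s * s)               ≈⟨ *-comm _ _ ⟩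
            s * s * fromℕ x                 ∎

    -- R is quantified before H, so that all hypergraphs with the same k, α and m share it. It comes
    -- from walks back and forth along an edge if k = 2, and is 0 if k ≥ 3.
    secondMoment : ∀ k → 2 ℕ.≤ k → ∀ α m → ∃ λ R → ∀ H → IsUniform k H → IsLinear H → size H ≡ m →
      spectralMoment k α 2 H ≈ fromℕ ((k ∸ 1) ℕ.^ (order H ∸ 1)) * (α * α * fromℕ (degreeSquares H) + R)
    secondMoment 1 (s≤s ()) α m
    secondMoment 2 2≤k α m = _ , λ { H uni lin ≡.refl → trans (Tr₂-expansion {2} (Aα 2 H α))
      (*-congˡ (+-cong (diagonal-sum 2 H uni ≡.refl 2≤k α) (off-diagonal-sum H uni lin α))) }
    secondMoment k@(ℕ.suc (ℕ.suc (ℕ.suc k′))) 2≤k α m = 0# , λ H uni lin _ → trans (Tr₂-expansion {k} (Aα k H α))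
      (*-congˡ (+-cong (diagonal-sum k H uni ≡.refl 2≤k α) (trans
        (∑<-cong (order H) λ i j i≢j → trans
          (*-congˡ (trans (*-congˡ (off-diagonal-term {k} (Aα k H α) ≡.refl
            (λ i j γ → two-vertex-entry k H uni (s≤s (s≤s (s≤s z≤n))) α i j γ) (2 ℕ.* (k ∸ 1)) i j i≢j)) (zeroʳ _))) (zeroʳ _))
        (∑<-0 (order H)))))

-- Cycles, and the number of vertices of a unicyclic hypergraph

module Cycles where

  open Counting
  open import Data.Fin.Base using (Fin; zero; suc; toℕ; fromℕ; inject₁; opposite; fromℕ<)
  open import Data.Fin.Induction using (<-weakInduction; >-weakInduction)
  open import Data.Fin.Properties
    using (toℕ-fromℕ; toℕ-inject₁; toℕ-fromℕ<; toℕ-injective; inject₁ℕ<; opposite-involutive; _≟_; any?; injective⇒≤)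
  open import Data.Fin.Relation.Unary.Top using (view; ‵fromℕ; ‵inject₁)
  open import Data.Fin.Subset using (_∈_; Subset; _∩_; _∪_; ∣_∣; ⊥; ⊤)
  open import Data.Fin.Subset.Properties
    using (_∈?_; x∈p∩q⁺; x∈p∩q⁻; x∈p∪q⁺; x∈p∪q⁻; ∉⊥; ∣⊤∣≡n; ⊆-antisym; ⊆-max; ∪-identityˡ)
  open import Data.List.Base as List using (List; _∷_; [])
  open import Data.List.Membership.DecPropositional using () renaming (_∈?_ to member?)
  import Data.List.Membership.Propositional as List
  open import Data.List.Membership.Propositional.Properties using (∈-lookup)
  open import Data.List.Relation.Unary.Any using (here; there; index)
  open import Data.List.Relation.Unary.Any.Properties using (lookup-index)
  open import Data.Nat.Base using (ℕ; _≤_; s≤s; z≤n; _+_; _*_; _∸_)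
  open import Data.Nat.DivMod using (m<n⇒m%n≡m; n%n≡0; m%n<n; _%_)
  import Data.Nat.Properties as ℕ
  open import Data.Nat.Solver using (module +-*-Solver)
  open import Data.Product.Base using (∃; _,_; _×_; proj₁; proj₂)
  open import Data.Sum.Base using (_⊎_; inj₁; inj₂)
  open import Function.Base using (_∘_)
  open import Function.Bundles using (Equivalence)
  open import Function.Definitions using (Injective)
  open import Relation.Binary.Construct.Closure.ReflexiveTransitive using (Star; _◅_) renaming (ε to done)
  open import Relation.Binary.PropositionalEquality
    using (_≡_; _≢_; refl; sym; trans; cong; subst; module ≡-Reasoning)
  open import Relation.Nullary using (contradiction; ¬_; yes; no)
  open import Relation.Nullary.Decidable using (¬?)

  toℕ-next : ∀ {n} (i : Fin (ℕ.suc n)) → toℕ (next i) ≡ ℕ.suc (toℕ i) % ℕ.suc n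
  toℕ-next {n} i = toℕ-fromℕ< (m%n<n (ℕ.suc (toℕ i)) (ℕ.suc n))

  next-inject₁ : ∀ {n} (i : Fin n) → next (inject₁ i) ≡ suc i
  next-inject₁ {n} i = toℕ-injective (trans (toℕ-next (inject₁ i)) (trans
    (m<n⇒m%n≡m (s≤s (inject₁ℕ< i))) (cong ℕ.suc (toℕ-inject₁ i))))

  next-fromℕ : ∀ n → next (fromℕ n) ≡ zero
  next-fromℕ n = toℕ-injective (trans (toℕ-next (fromℕ n)) (trans
    (cong (λ x → ℕ.suc x % ℕ.suc n) (toℕ-fromℕ n)) (n%n≡0 (ℕ.suc n))))

  next-surjective : ∀ {n} (i : Fin n) → ∃ λ j → next j ≡ i
  next-surjective {ℕ.suc n} zero    = fromℕ n , next-fromℕ n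
  next-surjective {ℕ.suc n} (suc i) = inject₁ i , next-inject₁ i

  next-injective : ∀ {n} {i j : Fin n} → next i ≡ next j → i ≡ j
  next-injective {ℕ.suc n} {i} {j} e with view i | view j
  ... | ‵fromℕ     | ‵fromℕ     = refl
  ... | ‵fromℕ     | ‵inject₁ j with () ← trans (sym (next-fromℕ n)) (trans e (next-inject₁ j))
  ... | ‵inject₁ i | ‵fromℕ     with () ← trans (sym (next-inject₁ i)) (trans e (next-fromℕ n))
  ... | ‵inject₁ i | ‵inject₁ j with refl ← trans (sym (next-inject₁ i)) (trans e (next-inject₁ j)) = refl

  next≢ : ∀ {n} → 2 ≤ n → (i : Fin n) → next i ≢ i
  next≢ {ℕ.suc n} 2≤n i e with view i
  ... | ‵inject₁ i = contradiction (cong toℕ (trans (sym (next-inject₁ i)) e))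
    λ q → ℕ.1+n≢n (trans q (toℕ-inject₁ i))
  next≢ {ℕ.suc (ℕ.suc n)} 2≤n _ e | ‵fromℕ with () ← trans (sym (next-fromℕ (ℕ.suc n))) e
  next≢ {ℕ.suc ℕ.zero} (s≤s ()) _ e | ‵fromℕ

  -- From i the property climbs to the last index, wraps around to `zero`, and from there climbs to
  -- every index.
  next-closed⇒universal : ∀ {p n} {P : Fin n → Set p} → (∀ i → P i → P (next i)) → ∀ i → P i → ∀ j → P j
  next-closed⇒universal {n = ℕ.suc n} {P} step i Pi =
    <-weakInduction P (subst P (next-fromℕ n) (step _ top)) up
    where
    up : ∀ i → P (inject₁ i) → P (suc i)
    up i Pi = subst P (next-inject₁ i) (step _ Pi)
    top : P (fromℕ n)
    top = >-weakInduction (λ i → P i → P (fromℕ n)) (λ p → p) (λ i f → f ∘ up i) i Pi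

  opposite-inject₁ : ∀ {n} (i : Fin n) → opposite (inject₁ i) ≡ suc (opposite i)
  opposite-inject₁ zero    = refl
  opposite-inject₁ (suc i) = cong inject₁ (opposite-inject₁ i)

  opposite-fromℕ : ∀ n → opposite (fromℕ n) ≡ zero
  opposite-fromℕ ℕ.zero    = refl
  opposite-fromℕ (ℕ.suc n) = cong inject₁ (opposite-fromℕ n)

  opposite-injective : ∀ {n} {i j : Fin n} → opposite i ≡ opposite j → i ≡ j
  opposite-injective {i = i} {j} e =
    trans (sym (opposite-involutive i)) (trans (cong opposite e) (opposite-involutive j))

  snoc : ∀ {a} {A : Set a} {n} → (Fin n → A) → A → Fin (ℕ.suc n) → A
  snoc {n = ℕ.zero}  f x zero    = x
  snoc {n = ℕ.suc n} f x zero    = f zero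
  snoc {n = ℕ.suc n} f x (suc i) = snoc (f ∘ suc) x i

  snoc-inject₁ : ∀ {a} {A : Set a} {n} (f : Fin n → A) x i → snoc f x (inject₁ i) ≡ f i
  snoc-inject₁ f x zero    = refl
  snoc-inject₁ f x (suc i) = snoc-inject₁ (f ∘ suc) x i

  snoc-fromℕ : ∀ {a} {A : Set a} n (f : Fin n → A) x → snoc f x (fromℕ n) ≡ x
  snoc-fromℕ ℕ.zero    f x = refl
  snoc-fromℕ (ℕ.suc n) f x = snoc-fromℕ n (f ∘ suc) x

  module _ (H : Hypergraph) where

    private
      V = Fin (order H)
      E = Fin (size H)

    Covered : List E → V → Set
    Covered es v = ∃ λ e → e List.∈ es × v ∈ edge H e

    -- `within` and `covered` confine the path to the hyperedges es, so a hyperedge or vertex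
    -- outside them can be appended without repetition.
    record Path (es : List E) (a b : V) : Set where
      field
        length    : ℕ
        verts     : Fin (ℕ.suc length) → V
        edges     : Fin length → E
        verts-inj : Injective _≡_ _≡_ verts
        edges-inj : Injective _≡_ _≡_ edges
        start     : verts zero ≡ a
        end       : verts (fromℕ length) ≡ b
        left∈     : ∀ i → verts (inject₁ i) ∈ edge H (edges i)
        right∈    : ∀ i → verts (suc i) ∈ edge H (edges i)
        within    : ∀ i → edges i List.∈ es
        covered   : ∀ i → Covered es (verts i)

    open Path

    trivial : ∀ {es a} → Covered es a → Path es a a
    trivial {es} {a} a∈ = record
      { length = 0 ; verts = λ _ → a ; edges = λ ()
      ; verts-inj = λ { {zero} {zero} _ → refl } ; edges-inj = λ { {()} }
      ; start = refl ; end = refl ; left∈ = λ () ; right∈ = λ () ; within = λ ()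
      ; covered = λ _ → a∈ }

    reversed : ∀ {es a b} → Path es a b → Path es b a
    reversed p = record
      { length = length p ; verts = verts p ∘ opposite ; edges = edges p ∘ opposite
      ; verts-inj = opposite-injective ∘ verts-inj p
      ; edges-inj = opposite-injective ∘ edges-inj p
      ; start = end p
      ; end = trans (cong (verts p) (opposite-fromℕ (length p))) (start p)
      ; left∈ = λ i → subst (λ j → verts p j ∈ edge H (edges p (opposite i)))
          (sym (opposite-inject₁ i)) (right∈ p (opposite i))
      ; right∈ = λ i → left∈ p (opposite i)
      ; within = within p ∘ opposite
      ; covered = covered p ∘ opposite }

    weaken : ∀ {e es a b} → Path es a b → Path (e ∷ es) a b
    weaken p = record
      { length = length p ; verts = verts p ; edges = edges p
      ; verts-inj = verts-inj p ; edges-inj = edges-inj p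
      ; start = start p ; end = end p ; left∈ = left∈ p ; right∈ = right∈ p
      ; within = there ∘ within p
      ; covered = λ i → proj₁ (covered p i) , there (proj₁ (proj₂ (covered p i))) , proj₂ (proj₂ (covered p i)) }

    extend : ∀ {es v e a b} → (p : Path es a b) → (∀ i → verts p i ≢ v) → (∀ i → edges p i ≢ e) →
      e List.∈ es → v ∈ edge H e → a ∈ edge H e → Path es v b
    extend {es} {v} {e} p v∉ e∉ e∈es v∈e a∈e = record
      { length = ℕ.suc (length p)
      ; verts = vs ; edges = fs
      ; verts-inj = λ { {zero} {zero} _ → refl
                      ; {zero} {suc j} eq → contradiction (sym eq) (v∉ j)
                      ; {suc i} {zero} eq → contradiction eq (v∉ i)
                      ; {suc i} {suc j} eq → cong suc (verts-inj p eq) }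
      ; edges-inj = λ { {zero} {zero} _ → refl
                      ; {zero} {suc j} eq → contradiction (sym eq) (e∉ j)
                      ; {suc i} {zero} eq → contradiction eq (e∉ i)
                      ; {suc i} {suc j} eq → cong suc (edges-inj p eq) }
      ; start = refl ; end = end p
      ; left∈ = λ { zero → v∈e ; (suc i) → left∈ p i }
      ; right∈ = λ { zero → subst (_∈ edge H e) (sym (start p)) a∈e ; (suc i) → right∈ p i }
      ; within = λ { zero → e∈es ; (suc i) → within p i }
      ; covered = λ { zero → e , e∈es , v∈e ; (suc i) → covered p i } }
      where
      vs : Fin (ℕ.suc (ℕ.suc (length p))) → V
      vs zero    = v
      vs (suc i) = verts p i
      fs : Fin (ℕ.suc (length p)) → E
      fs zero    = e
      fs (suc i) = edges p i

    positive-length : ∀ {es a b} → a ≢ b → (p : Path es a b) → 1 ≤ length p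
    positive-length a≢b p with length p in eq
    ... | ℕ.suc _ = s≤s z≤n
    ... | 0 = contradiction (trans (sym (start p)) (trans (cong (verts p) (collapse eq)) (end p))) a≢b
      where
      collapse : ∀ {n} → n ≡ 0 → zero ≡ fromℕ n
      collapse refl = refl

    -- A hyperedge outside es that contains both ends closes the path: it is appended as the last
    -- hyperedge and leads from b back to a.
    module Closing {es a b e} (p : Path es a b) (a≢b : a ≢ b) (e∉es : ¬ e List.∈ es)
                   (a∈e : a ∈ edge H e) (b∈e : b ∈ edge H e) where

      private
        n = length p
        fs : Fin (ℕ.suc n) → E
        fs = snoc (edges p) e

        fs-inject₁ : ∀ i → fs (inject₁ i) ≡ edges p i
        fs-inject₁ = snoc-inject₁ (edges p) e

        fs-top : fs (fromℕ n) ≡ e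
        fs-top = snoc-fromℕ n (edges p) e

        ≢e : ∀ i → fs (inject₁ i) ≢ e
        ≢e i eq = e∉es (subst (List._∈ es) (trans (sym (fs-inject₁ i)) eq) (within p i))

        fs-inj : Injective _≡_ _≡_ fs
        fs-inj {i} {j} eq with view i | view j
        ... | ‵fromℕ     | ‵fromℕ     = refl
        ... | ‵fromℕ     | ‵inject₁ j = contradiction (trans (sym eq) fs-top) (≢e j)
        ... | ‵inject₁ i | ‵fromℕ     = contradiction (trans eq fs-top) (≢e i)
        ... | ‵inject₁ i | ‵inject₁ j = cong inject₁ (edges-inj p
          (trans (sym (fs-inject₁ i)) (trans eq (fs-inject₁ j))))

        fs∈ : ∀ i → verts p i ∈ edge H (fs i)
        fs∈ i with view i
        ... | ‵fromℕ     = subst (λ f → verts p (fromℕ n) ∈ edge H f) (sym fs-top)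
                             (subst (_∈ edge H e) (sym (end p)) b∈e)
        ... | ‵inject₁ i = subst (λ f → verts p (inject₁ i) ∈ edge H f) (sym (fs-inject₁ i)) (left∈ p i)

        fs-next∈ : ∀ i → verts p (next i) ∈ edge H (fs i)
        fs-next∈ i with view i
        ... | ‵fromℕ     = subst (λ j → verts p j ∈ edge H (fs (fromℕ n))) (sym (next-fromℕ n))
          (subst (λ f → verts p zero ∈ edge H f) (sym fs-top) (subst (_∈ edge H e) (sym (start p)) a∈e))
        ... | ‵inject₁ i = subst (λ j → verts p j ∈ edge H (fs (inject₁ i))) (sym (next-inject₁ i))
          (subst (λ f → verts p (suc i) ∈ edge H f) (sym (fs-inject₁ i)) (right∈ p i))

      cycle : Cycle H
      cycle = record
        { len = ℕ.suc n ; 2≤len = s≤s (positive-length a≢b p)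
        ; vert = verts p ; hedge = fs
        ; vert-inj = verts-inj p ; hedge-inj = fs-inj
        ; vert∈ = fs∈ ; vert-next∈ = fs-next∈ }

      cycle-within : ∀ i → hedge cycle i List.∈ e ∷ es
      cycle-within i with view i
      ... | ‵fromℕ     = here fs-top
      ... | ‵inject₁ i = there (subst (List._∈ es) (sym (fs-inject₁ i)) (within p i))

      uses-b : Uses cycle b e
      uses-b = fromℕ n , fs-top , inj₁ (end p)

      -- This tells apart two cycles that pass the same closing hyperedge between different pairs of
      -- vertices.
      uses-e⁻ : ∀ {v} → Uses cycle v e → v ≡ a ⊎ v ≡ b
      uses-e⁻ (i , fi≡e , v≡) with view i
      ... | ‵inject₁ i = contradiction fi≡e (≢e i)
      uses-e⁻ (i , fi≡e , inj₁ v≡) | ‵fromℕ = inj₂ (trans (sym v≡) (end p))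
      uses-e⁻ (i , fi≡e , inj₂ v≡) | ‵fromℕ =
        inj₁ (trans (sym v≡) (trans (cong (verts p) (next-fromℕ n)) (start p)))

  -- The witnesses are the preceding and the following hyperedge of the cycle; a length of at least
  -- 2 makes both differ from the i-th.
  other-edges : ∀ {H} (C : Cycle H) i →
    (∃ λ j → hedge C j ≢ hedge C i × vert C i ∈ edge H (hedge C j)) ×
    (∃ λ j → hedge C j ≢ hedge C i × vert C (next i) ∈ edge H (hedge C j))
  other-edges {H} C i with j , refl ← next-surjective i =
    (j , (λ eq → next≢ (2≤len C) j (sym (hedge-inj C eq))) , vert-next∈ C j) ,
    (next (next j) , (λ eq → next≢ (2≤len C) (next j) (hedge-inj C eq)) , vert∈ C (next (next j)))

  ∈-tail : ∀ {a} {A : Set a} {x y : A} {xs} → x List.∈ y ∷ xs → x ≢ y → x List.∈ xs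
  ∈-tail (here x≡y) x≢y = contradiction x≡y x≢y
  ∈-tail (there x∈) _   = x∈

  module _ (H : Hypergraph) (k : ℕ) (uni : IsUniform k H) (2≤k : 2 ≤ k) where

    private
      V = Fin (order H)
      E = Fin (size H)
      q = k ∸ 1

      k≡ : k ≡ ℕ.suc q
      k≡ = sym (ℕ.m+[n∸m]≡n (ℕ.≤-trans (s≤s z≤n) 2≤k))

    ⋃ : List E → Subset (order H)
    ⋃ []       = ⊥
    ⋃ (e ∷ es) = ⋃ es ∪ edge H e

    ∈⋃⁻ : ∀ es {v} → v ∈ ⋃ es → Covered H es v
    ∈⋃⁻ []       v∈ = contradiction v∈ ∉⊥
    ∈⋃⁻ (e ∷ es) v∈ with x∈p∪q⁻ (⋃ es) (edge H e) v∈
    ... | inj₂ v∈e = e , here refl , v∈e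
    ... | inj₁ v∈ with f , f∈ , v∈f ← ∈⋃⁻ es v∈ = f , there f∈ , v∈f

    ∈⋃⁺ : ∀ {es v} → Covered H es v → v ∈ ⋃ es
    ∈⋃⁺ (e , here refl , v∈) = x∈p∪q⁺ (inj₂ v∈)
    ∈⋃⁺ (e , there e∈ , v∈)  = x∈p∪q⁺ (inj₁ (∈⋃⁺ (e , e∈ , v∈)))

    data Chain : List E → Set where
      [_]    : ∀ e → Chain (e ∷ [])
      attach : ∀ {e es} → ¬ e List.∈ es → (∃ λ v → v ∈ edge H e × Covered H es v) →
               Chain es → Chain (e ∷ es)

    path-across : ∀ {e es} → ¬ e List.∈ es → ∀ {a b} → a ∈ edge H e → b ∈ edge H e → Path H (e ∷ es) a b
    path-across {e} {es} e∉ {a} {b} a∈ b∈ with a ≟ b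
    ... | yes refl = trivial H (e , here refl , a∈)
    ... | no a≢b   = extend H (trivial H (e , here refl , b∈)) (λ _ b≡a → a≢b (sym b≡a)) (λ ()) (here refl) a∈ b∈

    path-from-new : ∀ {e es} → ¬ e List.∈ es → ∀ {a b c} → a ∈ edge H e → c ∈ edge H e →
      ¬ Covered H es a → Path H es c b → Path H (e ∷ es) a b
    path-from-new e∉ a∈ c∈ a∉ p = extend H (weaken H p)
      (λ i eq → a∉ (subst (Covered H _) eq (Path.covered p i)))
      (λ i eq → e∉ (subst (List._∈ _) eq (Path.within p i)))
      (here refl) a∈ c∈

    in-new : ∀ {e es v} → Covered H (e ∷ es) v → ¬ v ∈ ⋃ es → v ∈ edge H e
    in-new (_ , here refl , v∈) v∉ = v∈
    in-new (f , there f∈ , v∈)  v∉ = contradiction (∈⋃⁺ (f , f∈ , v∈)) v∉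

    -- An end not met by the older hyperedges lies in e and is joined to them through the common
    -- vertex c; two such ends are joined by e directly.
    chain-path : ∀ {es} → Chain es → ∀ {a b} → Covered H es a → Covered H es b → Path H es a b
    chain-path [ e ] (_ , here refl , a∈) (_ , here refl , b∈) = path-across (λ ()) a∈ b∈
    chain-path (attach {e} {es} e∉ (c , c∈e , c∈es) ch) {a} {b} a∈ b∈ with a ∈? ⋃ es | b ∈? ⋃ es
    ... | yes a∈es | yes b∈es = weaken H (chain-path ch (∈⋃⁻ es a∈es) (∈⋃⁻ es b∈es))
    ... | no a∉    | yes b∈es = path-from-new e∉ (in-new a∈ a∉) c∈e (a∉ ∘ ∈⋃⁺) (chain-path ch c∈es (∈⋃⁻ es b∈es))
    ... | yes a∈es | no b∉    = reversed H (path-from-new e∉ (in-new b∈ b∉) c∈e (b∉ ∘ ∈⋃⁺) (chain-path ch c∈es (∈⋃⁻ es a∈es)))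
    ... | no a∉    | no b∉    = path-across e∉ (in-new a∈ a∉) (in-new b∈ b∉)

    CycleIn : List E → Cycle H → Set
    CycleIn es C = ∀ i → hedge C i List.∈ es

    -- What an excess r of the cyclomatic count |es| (k - 1) + 1 - |⋃ es| entails.
    Cyclomatic : ℕ → List E → Set
    Cyclomatic 0                 es = ∀ C → ¬ CycleIn es C
    Cyclomatic 1                 es = ∃ (CycleIn es)
    Cyclomatic (ℕ.suc (ℕ.suc _)) es = ∃ λ C → ∃ λ D → ¬ SameCycle {H} C D

    -- A cycle through e passes two distinct vertices of e, and each of them lies in another
    -- hyperedge of the cycle, hence in the union of es.
    acyclic-attach : ∀ {e es} → Cyclomatic 0 es → ∣ ⋃ es ∩ edge H e ∣ ≤ 1 → Cyclomatic 0 (e ∷ es)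
    acyclic-attach {e} {es} acyclic ≤1 C C-in with any? (λ i → hedge C i ≟ e)
    ... | no e-unused = acyclic C λ i → ∈-tail (C-in i) λ eq → e-unused (i , eq)
    ... | yes (i , refl) with (j , j≢ , vi∈) , (l , l≢ , vni∈) ← other-edges C i =
      ℕ.<⇒≱ (∣∣≥2 (⋃ es ∩ edge H (hedge C i)) (λ eq → next≢ (2≤len C) i (sym (vert-inj C eq)))
        (x∈p∩q⁺ (∈⋃⁺ (hedge C j , ∈-tail (C-in j) j≢ , vi∈) , vert∈ C i))
        (x∈p∩q⁺ (∈⋃⁺ (hedge C l , ∈-tail (C-in l) l≢ , vni∈) , vert-next∈ C i))) ≤1

    module _ {e : E} {es : List E} (e∉ : ¬ e List.∈ es) (ch : Chain es) where

      private
        both : ∀ {x} → x ∈ ⋃ es ∩ edge H e → Covered H es x × x ∈ edge H e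
        both x∈ = ∈⋃⁻ es (proj₁ (x∈p∩q⁻ (⋃ es) (edge H e) x∈)) , proj₂ (x∈p∩q⁻ (⋃ es) (edge H e) x∈)

        module Close {x y} (x∈ : x ∈ ⋃ es ∩ edge H e) (y∈ : y ∈ ⋃ es ∩ edge H e) (x≢y : x ≢ y) =
          Closing H (chain-path ch (proj₁ (both x∈)) (proj₁ (both y∈))) x≢y e∉ (proj₂ (both x∈)) (proj₂ (both y∈))

      cycle-through : 2 ≤ ∣ ⋃ es ∩ edge H e ∣ →
        ∃ λ C → CycleIn (e ∷ es) C × ∃ λ v → Uses {H} C v e
      cycle-through 2≤ with x , y , x∈ , y∈ , x≢y ← two-elements _ 2≤ =
        Close.cycle x∈ y∈ x≢y , Close.cycle-within x∈ y∈ x≢y , y , Close.uses-b x∈ y∈ x≢y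

      -- Three meeting points x, y, z give cycles through e that pass e between x, y and x, z.
      two-cycles : 3 ≤ ∣ ⋃ es ∩ edge H e ∣ → ∃ λ C → ∃ λ D → ¬ SameCycle {H} C D
      two-cycles 3≤ with x , x∈ , S , 2≤S , S⊆ ← extract _ 3≤ with y , z , y∈ , z∈ , y≢z ← two-elements S 2≤S =
        Close.cycle x∈ (proj₁ (S⊆ y∈)) x≢y , Close.cycle x∈ (proj₁ (S⊆ z∈)) x≢z , λ same →
          excluded (Close.uses-e⁻ x∈ (proj₁ (S⊆ y∈)) x≢y
            (Equivalence.from (same z e) (Close.uses-b x∈ (proj₁ (S⊆ z∈)) x≢z)))
        where
        x≢y = proj₂ (S⊆ y∈) ∘ sym
        x≢z = proj₂ (S⊆ z∈) ∘ sym
        excluded : ¬ (z ≡ x ⊎ z ≡ y)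
        excluded (inj₁ z≡x) = x≢z (sym z≡x)
        excluded (inj₂ z≡y) = y≢z (sym z≡y)

      -- One meeting vertex creates no cycle, and each further one raises the excess. If es already
      -- has a cycle, that cycle avoids e, so a new cycle through e differs from it.
      cyclomatic-attach : ∀ r s → ∣ ⋃ es ∩ edge H e ∣ ≡ ℕ.suc s → Cyclomatic r es → Cyclomatic (r + s) (e ∷ es)
      cyclomatic-attach 0 0 meet≡ st = acyclic-attach st (ℕ.≤-reflexive meet≡)
      cyclomatic-attach 0 1 meet≡ st with C , C-in , _ ← cycle-through (ℕ.≤-reflexive (sym meet≡)) = C , C-in
      cyclomatic-attach 0 (ℕ.suc (ℕ.suc s)) meet≡ st = two-cycles (ℕ.≤-trans (s≤s (s≤s (s≤s z≤n))) (ℕ.≤-reflexive (sym meet≡)))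
      cyclomatic-attach 1 0 meet≡ (C , C-in) = C , there ∘ C-in
      cyclomatic-attach 1 (ℕ.suc s) meet≡ (C , C-in)
        with D , _ , v , uses ← cycle-through (ℕ.≤-trans (s≤s (s≤s z≤n)) (ℕ.≤-reflexive (sym meet≡))) =
        C , D , λ same → avoids (Equivalence.from (same v e) uses)
        where
        avoids : ∀ {v} → ¬ Uses {H} C v e
        avoids (i , refl , _) = e∉ (C-in i)
      cyclomatic-attach (ℕ.suc (ℕ.suc r)) s meet≡ st = st

    -- By inclusion and exclusion, a hyperedge that meets the union in s + 1 vertices adds q - s
    -- vertices; the deficit s is added to r.
    chain-count : ∀ {es} → Chain es → ∃ λ r → ∣ ⋃ es ∣ + r ≡ List.length es * q + 1 × Cyclomatic r es
    chain-count [ e ] = 0 , count , λ C C-in → next≢ (2≤len C) (first C) (hedge-inj C (trans (only (C-in _)) (sym (only (C-in (first C))))))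
      where
      first : (C : Cycle H) → Fin (len C)
      first C = fromℕ< (ℕ.≤-trans (s≤s z≤n) (2≤len C))
      only : ∀ {f} → f List.∈ e ∷ [] → f ≡ e
      only (here f≡e) = f≡e
      open ≡-Reasoning
      count : ∣ ⊥ ∪ edge H e ∣ + 0 ≡ 1 * q + 1
      count = begin
        ∣ ⊥ ∪ edge H e ∣ + 0   ≡⟨ ℕ.+-identityʳ _ ⟩
        ∣ ⊥ ∪ edge H e ∣       ≡⟨ cong ∣_∣ (∪-identityˡ (edge H e)) ⟩
        ∣ edge H e ∣           ≡⟨ trans (uni e) k≡ ⟩
        ℕ.suc q                ≡⟨ ℕ.+-comm 1 q ⟩
        q + 1                  ≡⟨ cong (_+ 1) (ℕ.*-identityˡ q) ⟨
        1 * q + 1              ∎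
    chain-count (attach {e} {es} e∉ (v , v∈e , v∈es) ch)
      with r , count , st ← chain-count ch
      with ∣ ⋃ es ∩ edge H e ∣ in meet
    ... | 0 = contradiction (ℕ.≤-trans (subst (1 ≤_) (sym (∣∣≡sum (⋃ es ∩ edge H e)))
        (ℕ.≤-trans (ℕ.≤-reflexive (sym (𝟙-true (v ∈? (⋃ es ∩ edge H e)) (x∈p∩q⁺ (∈⋃⁺ v∈es , v∈e)))))
          (term≤sum (λ v → 𝟙 (v ∈? (⋃ es ∩ edge H e))) v))) (ℕ.≤-reflexive meet)) λ ()
    ... | ℕ.suc s = r + s , ℕ.suc-injective (begin
        ℕ.suc (∣ ⋃ es ∪ edge H e ∣ + (r + s))   ≡⟨ rearrange ∣ ⋃ es ∪ edge H e ∣ r s ⟩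
        (∣ ⋃ es ∪ edge H e ∣ + ℕ.suc s) + r     ≡⟨ cong (λ t → (∣ ⋃ es ∪ edge H e ∣ + t) + r) (sym meet) ⟩
        (∣ ⋃ es ∪ edge H e ∣ + ∣ ⋃ es ∩ edge H e ∣) + r ≡⟨ cong (_+ r) (∣∪∣+∣∩∣ (⋃ es) (edge H e)) ⟩
        (∣ ⋃ es ∣ + ∣ edge H e ∣) + r           ≡⟨ cong (λ t → (∣ ⋃ es ∣ + t) + r) (trans (uni e) k≡) ⟩
        (∣ ⋃ es ∣ + ℕ.suc q) + r                ≡⟨ rearrange′ ∣ ⋃ es ∣ q r ⟩
        ℕ.suc (q + (∣ ⋃ es ∣ + r))              ≡⟨ cong (λ t → ℕ.suc (q + t)) count ⟩
        ℕ.suc (q + (List.length es * q + 1))    ≡⟨ cong ℕ.suc (sym (ℕ.+-assoc q _ 1)) ⟩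
        ℕ.suc (q + List.length es * q + 1)      ∎) , cyclomatic-attach e∉ ch r s meet st
      where
      open ≡-Reasoning
      open +-*-Solver using (solve; _:+_; _:=_; con)
      rearrange : ∀ u r s → ℕ.suc (u + (r + s)) ≡ (u + ℕ.suc s) + r
      rearrange = solve 3 (λ u r s → con 1 :+ (u :+ (r :+ s)) := (u :+ (con 1 :+ s)) :+ r) refl
      rearrange′ : ∀ u q r → (u + ℕ.suc q) + r ≡ ℕ.suc (q + (u + r))
      rearrange′ = solve 3 (λ u q r → (u :+ (con 1 :+ q)) :+ r := con 1 :+ (q :+ (u :+ r))) refl

    lookup-injective : ∀ {es} → Chain es → ∀ {i j} → List.lookup es i ≡ List.lookup es j → i ≡ j
    lookup-injective [ e ] {zero} {zero} _ = refl
    lookup-injective (attach e∉ _ ch) {zero}  {zero}  eq = refl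
    lookup-injective (attach e∉ _ ch) {zero}  {suc j} eq = contradiction (subst (List._∈ _) (sym eq) (∈-lookup j)) e∉
    lookup-injective (attach e∉ _ ch) {suc i} {zero}  eq = contradiction (subst (List._∈ _) eq (∈-lookup i)) e∉
    lookup-injective (attach e∉ _ ch) {suc i} {suc j} eq = cong suc (lookup-injective ch eq)

    chain-length≤ : ∀ {es} → Chain es → List.length es ≤ size H
    chain-length≤ ch = injective⇒≤ (lookup-injective ch)

    complete-length≥ : ∀ {es} → (∀ e → e List.∈ es) → size H ≤ List.length es
    complete-length≥ {es} all = injective⇒≤ {f = λ e → index (all e)} λ {e} {f} eq →
      trans (lookup-index (all e)) (trans (cong (List.lookup es) eq) (sym (lookup-index (all f))))

    -- Along a walk from a covered vertex towards e, the first hyperedge outside es still meets the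
    -- covered vertices; if the walk has none, e itself does.
    frontier : ∀ {es u v e} → Covered H es u → Star (Adjacent H) u v → v ∈ edge H e → ¬ e List.∈ es →
      ∃ λ f → ¬ f List.∈ es × ∃ λ w → w ∈ edge H f × Covered H es w
    frontier {e = e} u∈ done v∈e e∉ = e , e∉ , _ , v∈e , u∈
    frontier {es} u∈ ((f , u∈f , w∈f) ◅ s) v∈e e∉ with member? _≟_ f es
    ... | yes f∈ = frontier (f , f∈ , w∈f) s v∈e e∉
    ... | no f∉  = f , f∉ , _ , u∈f , u∈

    inhabitant : ∀ e → ∃ λ v → v ∈ edge H e
    inhabitant e with v , v∈ , _ ← extract (edge H e) (ℕ.≤-trans (s≤s z≤n) (ℕ.≤-trans 2≤k (ℕ.≤-reflexive (sym (uni e))))) = v , v∈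

    -- `fuel` bounds the number of missing hyperedges. With none left, one more would make a chain
    -- of distinct hyperedges longer than `size H`.
    grow : IsConnected H → ∀ fuel {es u} → Covered H es u → size H ≤ fuel + List.length es → Chain es →
      ∃ λ es′ → Chain es′ × (∀ e → e List.∈ es′)
    grow conn fuel {es} {u} u∈ bound ch with any? (λ e → ¬? (member? _≟_ e es))
    ... | no ¬∃ = es , ch , λ e → member e
      where
      member : ∀ e → e List.∈ es
      member e with member? _≟_ e es
      ... | yes e∈ = e∈
      ... | no e∉  = contradiction (e , e∉) ¬∃
    ... | yes (e , e∉) with v , v∈e ← inhabitant e
        with f , f∉ , meets ← frontier u∈ (conn u v) v∈e e∉
        with fuel
    ... | 0          = contradiction (chain-length≤ (attach f∉ meets ch)) (ℕ.<⇒≱ (s≤s bound))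
    ... | ℕ.suc fuel = grow conn fuel (proj₁ u∈ , there (proj₁ (proj₂ u∈)) , proj₂ (proj₂ u∈))
                         (ℕ.≤-trans bound (ℕ.≤-reflexive (sym (ℕ.+-suc fuel _)))) (attach f∉ meets ch)

    connected-covered : IsConnected H → Cycle H → ∀ v → ∃ λ e → v ∈ edge H e
    connected-covered conn C v with i ← fromℕ< (ℕ.≤-trans (s≤s z≤n) (2≤len C)) with conn v (vert C i)
    ... | done            = hedge C i , vert∈ C i
    ... | (e , v∈ , _) ◅ _ = e , v∈

    -- A chain through all hyperedges covers all vertices. Excess 0 contradicts the existence of a
    -- cycle and excess 2 or more its uniqueness; excess 1 cancels the + 1 in the count.
    unicyclic-order : IsUnicyclic H → order H ≡ size H * q
    unicyclic-order (conn , C , unique)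
      with i ← fromℕ< (ℕ.≤-trans (s≤s z≤n) (2≤len C))
      with es , ch , all ← grow conn (size H) (hedge C i , here refl , vert∈ C i) (ℕ.m≤m+n _ _) [ hedge C i ]
      with chain-count ch
    ... | 0 , _ , acyclic = contradiction (λ i → all (hedge C i)) (acyclic C)
    ... | ℕ.suc (ℕ.suc r) , _ , D , D′ , different = contradiction
      (λ v e → record
        { to = Equivalence.to (unique D′ v e) ∘ Equivalence.from (unique D v e)
        ; from = Equivalence.to (unique D v e) ∘ Equivalence.from (unique D′ v e)
        ; to-cong = λ { refl → refl } ; from-cong = λ { refl → refl } }) different
    ... | 1 , count , _ = begin
      order H               ≡⟨ ∣⊤∣≡n (order H) ⟨
      ∣ ⊤ {order H} ∣       ≡⟨ cong ∣_∣ (⊆-antisym (⊆-max (⋃ es)) λ {v} _ → ∈⋃⁺ (covered v)) ⟨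
      ∣ ⋃ es ∣              ≡⟨ ℕ.+-cancelʳ-≡ 1 _ _ count ⟩
      List.length es * q    ≡⟨ cong (_* q) (ℕ.≤-antisym (chain-length≤ ch) (complete-length≥ all)) ⟩
      size H * q            ∎
      where
      open ≡-Reasoning
      covered : ∀ v → Covered H es v
      covered v with e , v∈e ← connected-covered conn C v = e , all e , v∈e

-- Hypercycles with pendant hyperedges are linear and unicyclic

module Members where

  open Counting
  open Cycles
  open import Data.Bool.Base using (if_then_else_)
  open import Data.Fin.Base using (Fin; zero; suc; _↑ˡ_; _↑ʳ_; splitAt; combine; fromℕ<)
  open import Data.Fin.Patterns using (0F; 1F; 2F)
  open import Data.Fin.Properties
    using (_≟_; splitAt⁻¹-↑ˡ; splitAt⁻¹-↑ʳ; combine-surjective; injective⇒≤; ↑ˡ-injective; splitAt-↑ˡ; splitAt-↑ʳ)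
  open import Data.Fin.Subset using (Subset; inside; outside; _∈_; ∣_∣; ⊤; ⊥; _∩_; ⁅_⁆)
  open import Data.Fin.Subset.Properties
    using (∈⊤; ∉⊥; ∣⊤∣≡n; ∣⊥∣≡0; x∈p∩q⁻; _∈?_; x∈⁅x⁆; x∈⁅y⁆⇒x≡y; x∈p∪q⁺; x∈p∪q⁻; ∣⁅x⁆∣≡1)
  open import Data.Nat.Base using (ℕ; _+_; _*_; _≤_; s≤s; z≤n; _∸_)
  open import Data.Nat.Properties as ℕ using (+-identityʳ)
  open import Data.Product.Base using (∃; _,_; _×_; proj₁; proj₂)
  open import Data.Sum.Base using (inj₁; inj₂; _⊎_)
  open import Data.Vec.Base as Vec using ([]; _∷_; _++_; here; there; concat; tabulate)
  open import Function.Base using (_∘_)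
  open import Function.Bundles using (mk⇔)
  open import Function.Definitions using (Injective)
  open import Relation.Binary.Construct.Closure.ReflexiveTransitive
    using (Star; _◅_; _◅◅_; gmap; reverse) renaming (ε to done)
  open import Relation.Binary.PropositionalEquality
    using (_≡_; refl; sym; trans; cong; cong₂; _≢_; subst; module ≡-Reasoning)
  open import Relation.Nullary using (yes; no; does; contradiction; ¬_)
  open import Relation.Nullary.Decidable using (dec-true)

  data SplitView m n : Fin (m + n) → Set where
    left  : ∀ i → SplitView m n (i ↑ˡ n)
    right : ∀ j → SplitView m n (m ↑ʳ j)

  splitView : ∀ m n i → SplitView m n i
  splitView m n i with splitAt m i in eq
  ... | inj₁ j with refl ← splitAt⁻¹-↑ˡ {m} eq = left j
  ... | inj₂ j with refl ← splitAt⁻¹-↑ʳ {m} eq = right j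

  ∈-++ˡ⁺ : ∀ {m n} {p : Subset m} (r : Subset n) {i} → i ∈ p → i ↑ˡ n ∈ p ++ r
  ∈-++ˡ⁺ r here       = here
  ∈-++ˡ⁺ r (there i∈) = there (∈-++ˡ⁺ r i∈)

  ∈-++ˡ⁻ : ∀ {m n} (p : Subset m) (r : Subset n) {i} → i ↑ˡ n ∈ p ++ r → i ∈ p
  ∈-++ˡ⁻ (x ∷ p) r {zero}  here       = here
  ∈-++ˡ⁻ (x ∷ p) r {suc i} (there i∈) = there (∈-++ˡ⁻ p r i∈)

  ∈-++ʳ⁺ : ∀ {m n} (p : Subset m) {r : Subset n} {j} → j ∈ r → m ↑ʳ j ∈ p ++ r
  ∈-++ʳ⁺ []      j∈ = j∈
  ∈-++ʳ⁺ (x ∷ p) j∈ = there (∈-++ʳ⁺ p j∈)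

  ∈-++ʳ⁻ : ∀ {m n} (p : Subset m) {r : Subset n} {j} → m ↑ʳ j ∈ p ++ r → j ∈ r
  ∈-++ʳ⁻ []      j∈         = j∈
  ∈-++ʳ⁻ (x ∷ p) (there j∈) = ∈-++ʳ⁻ p j∈

  ∣++∣ : ∀ {m n} (p : Subset m) (r : Subset n) → ∣ p ++ r ∣ ≡ ∣ p ∣ + ∣ r ∣
  ∣++∣ []            r = refl
  ∣++∣ (inside ∷ p)  r = cong ℕ.suc (∣++∣ p r)
  ∣++∣ (outside ∷ p) r = ∣++∣ p r

  ∈-concat⁻ : ∀ {p q} (S : Fin p → Subset q) i {r} → combine i r ∈ concat (tabulate S) → r ∈ S i
  ∈-concat⁻ S zero    x∈ = ∈-++ˡ⁻ (S zero) _ x∈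
  ∈-concat⁻ S (suc i) x∈ = ∈-concat⁻ (λ j → S (suc j)) i (∈-++ʳ⁻ (S zero) x∈)

  ∈-concat⁺ : ∀ {p q} (S : Fin p → Subset q) i {r} → r ∈ S i → combine i r ∈ concat (tabulate S)
  ∈-concat⁺ S zero    r∈ = ∈-++ˡ⁺ _ r∈
  ∈-concat⁺ S (suc i) r∈ = ∈-++ʳ⁺ (S zero) (∈-concat⁺ (λ j → S (suc j)) i r∈)

  block-unique : ∀ {p} q {i j : Fin p} x → x ∈ block q i → x ∈ block q j → i ≡ j
  block-unique {p} q x x∈i x∈j with l , r , refl ← combine-surjective {p} {q} x =
    trans (sym (owner x∈i)) (owner x∈j)
    where
    owner : ∀ {i} → combine l r ∈ block q i → l ≡ i
    owner {i} x∈ with i ≟ l | ∈-concat⁻ (λ j → if does (i ≟ j) then ⊤ {q} else ⊥) l x∈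
    ... | yes i≡l | _  = sym i≡l
    ... | no _    | r∈ = contradiction r∈ ∉⊥

  block-total : ∀ {p} q (x : Fin (p * q)) → ∃ λ i → x ∈ block q i
  block-total {p} q x with i , r , refl ← combine-surjective {p} {q} x =
    i , ∈-concat⁺ (λ j → if does (i ≟ j) then ⊤ {q} else ⊥) i (full i r)
    where
    full : ∀ i r → r ∈ (if does (i ≟ i) then ⊤ {q} else ⊥)
    full i r rewrite dec-true (i ≟ i) refl = ∈⊤

  ∣block∣ : ∀ {p} q (i : Fin p) → ∣ block q i ∣ ≡ q
  ∣block∣ {ℕ.suc p} q zero = trans (∣++∣ (⊤ {q}) _) (trans (cong₂ _+_ (∣⊤∣≡n q) (empty p)) (+-identityʳ q))
    where
    empty : ∀ p → ∣ concat (tabulate {n = p} λ _ → ⊥ {q}) ∣ ≡ 0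
    empty ℕ.zero    = refl
    empty (ℕ.suc p) = trans (∣++∣ (⊥ {q}) _) (cong₂ _+_ (∣⊥∣≡0 q) (empty p))
  ∣block∣ {ℕ.suc p} q (suc i) = trans (∣++∣ (⊥ {q}) _) (cong₂ _+_ (∣⊥∣≡0 q) (∣block∣ q i))

  -- Otherwise i and `next i` would be closed under `next` and exhaust all indices, of which there
  -- are at least three.
  next²≢ : ∀ {n} → 3 ≤ n → (i : Fin n) → next (next i) ≢ i
  next²≢ {ℕ.suc (ℕ.suc (ℕ.suc n))} 3≤n i e = pigeonhole (all 0F) (all 1F) (all 2F)
    where
    all : ∀ j → j ≡ i ⊎ j ≡ next i
    all = next-closed⇒universal {P = λ j → j ≡ i ⊎ j ≡ next i}
      (λ { _ (inj₁ refl) → inj₂ refl ; _ (inj₂ refl) → inj₁ e }) i (inj₁ refl)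
    pigeonhole : 0F ≡ i ⊎ 0F ≡ next i → 1F ≡ i ⊎ 1F ≡ next i → ¬ (2F ≡ i ⊎ 2F ≡ next i)
    pigeonhole (inj₁ a) (inj₁ b) c with () ← trans a (sym b)
    pigeonhole (inj₂ a) (inj₂ b) c with () ← trans a (sym b)
    pigeonhole (inj₁ a) (inj₂ b) (inj₁ c) with () ← trans a (sym c)
    pigeonhole (inj₁ a) (inj₂ b) (inj₂ c) with () ← trans b (sym c)
    pigeonhole (inj₂ a) (inj₁ b) (inj₁ c) with () ← trans b (sym c)
    pigeonhole (inj₂ a) (inj₁ b) (inj₂ c) with () ← trans a (sym c)
  next²≢ {1} (s≤s ())
  next²≢ {2} (s≤s (s≤s ()))

  -- Local data that force a unique cycle; unlike the uniqueness of the cycle, they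
  -- are plainly inherited when pendant hyperedges are added to a joint.
  record Frame (k g : ℕ) (H : Hypergraph) : Set where
    field
      uniform         : IsUniform k H
      connected       : IsConnected H
      joints          : Fin g → Fin (order H)
      core            : Fin g → Fin (size H)
      joints-inj      : Injective _≡_ _≡_ joints
      core-inj        : Injective _≡_ _≡_ core
      joint∈          : ∀ i → joints i ∈ edge H (core i)
      joint-next∈     : ∀ i → joints (next i) ∈ edge H (core i)
      branching       : ∀ {v e f} → e ≢ f → v ∈ edge H e → v ∈ edge H f → ∃ λ i → v ≡ joints i
      adjacent-joints : ∀ {e i j} → i ≢ j → joints i ∈ edge H e → joints j ∈ edge H e →
                        ∃ λ l → e ≡ core l × ((i ≡ l × j ≡ next l) ⊎ (j ≡ l × i ≡ next l))

  module _ {k g H} (frame : Frame k g H) (3≤g : 3 ≤ g) where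

    open Frame frame

    -- Two common vertices of distinct hyperedges are joints, and the only hyperedge through two
    -- joints is a core hyperedge. Which one is determined, as g ≥ 3 excludes the reversed
    -- orientation.
    frame-linear : IsLinear H
    frame-linear e f e≢f = ∣∣≤1 (edge H e ∩ edge H f) λ {x} {y} x∈ y∈ →
      coincide (proj₁ (x∈p∩q⁻ (edge H e) (edge H f) x∈)) (proj₂ (x∈p∩q⁻ (edge H e) (edge H f) x∈))
               (proj₁ (x∈p∩q⁻ (edge H e) (edge H f) y∈)) (proj₂ (x∈p∩q⁻ (edge H e) (edge H f) y∈))
      where
      coincide : ∀ {x y} → x ∈ edge H e → x ∈ edge H f → y ∈ edge H e → y ∈ edge H f → x ≡ y
      coincide xe xf ye yf with i , refl ← branching e≢f xe xf | j , refl ← branching e≢f ye yf with i ≟ j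
      ... | yes refl = refl
      ... | no i≢j with adjacent-joints i≢j xe ye | adjacent-joints i≢j xf yf
      ... | l , refl , inj₁ (refl , refl) | l′ , refl , inj₁ (refl , _) = contradiction refl e≢f
      ... | l , refl , inj₂ (refl , refl) | l′ , refl , inj₂ (refl , _) = contradiction refl e≢f
      ... | l , refl , inj₁ (refl , refl) | l′ , refl , inj₂ (refl , eq) = contradiction (sym eq) (next²≢ 3≤g l)
      ... | l , refl , inj₂ (refl , refl) | l′ , refl , inj₁ (refl , eq) = contradiction (sym eq) (next²≢ 3≤g l)

    coreCycle : Cycle H
    coreCycle = record
      { len = g ; 2≤len = ℕ.≤-trans (s≤s (s≤s z≤n)) 3≤g
      ; vert = joints ; hedge = core ; vert-inj = joints-inj ; hedge-inj = core-inj
      ; vert∈ = joint∈ ; vert-next∈ = joint-next∈ }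

    module _ (D : Cycle H) where

      private
        SameEnds : Fin (len D) → Fin g → Set
        SameEnds i l = (vert D i ≡ joints l × vert D (next i) ≡ joints (next l)) ⊎
                       (vert D (next i) ≡ joints l × vert D i ≡ joints (next l))

        -- A vertex of a cycle lies in two of its hyperedges, so it is a joint by `branching`; a
        -- hyperedge with two joints belongs to the core.
        along : ∀ i → ∃ λ l → hedge D i ≡ core l × SameEnds i l
        along i with (j , j≢ , vi∈) , (m , m≢ , vni∈) ← other-edges D i
          with a , va≡ ← branching (j≢ ∘ sym) (vert∈ D i) vi∈ | b , vb≡ ← branching (m≢ ∘ sym) (vert-next∈ D i) vni∈
          with adjacent-joints {hedge D i} {a} {b}
            (λ { refl → next≢ (2≤len D) i (vert-inj D (trans vb≡ (sym va≡))) })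
            (subst (_∈ edge H (hedge D i)) va≡ (vert∈ D i)) (subst (_∈ edge H (hedge D i)) vb≡ (vert-next∈ D i))
        ... | l , e≡ , inj₁ (refl , refl) = l , e≡ , inj₁ (va≡ , vb≡)
        ... | l , e≡ , inj₂ (refl , refl) = l , e≡ , inj₂ (vb≡ , va≡)

        UsedEdge : Fin g → Set
        UsedEdge l = ∃ λ i → hedge D i ≡ core l

        -- The hyperedge at position j is a core hyperedge with the joint `next l` as an end, hence
        -- the core hyperedge at l or at `next l`; the former is already used at i.
        continue : ∀ {l} j i → j ≢ i → hedge D i ≡ core l →
          vert D j ≡ joints (next l) ⊎ vert D (next j) ≡ joints (next l) → UsedEdge (next l)
        continue {l} j i j≢i i≡ v≡ with along j
        ... | m , j≡ , ends = j , trans j≡ (cong core (sym (next≡ ends v≡)))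
          where
          not-back : next l ≢ next m
          not-back eq = j≢i (hedge-inj D (trans j≡ (trans (cong core (sym (next-injective eq))) (sym i≡))))
          next≡ : SameEnds j m → vert D j ≡ joints (next l) ⊎ vert D (next j) ≡ joints (next l) → next l ≡ m
          next≡ (inj₁ (a , b)) (inj₁ c) = joints-inj (trans (sym c) a)
          next≡ (inj₁ (a , b)) (inj₂ c) = contradiction (joints-inj (trans (sym c) b)) not-back
          next≡ (inj₂ (a , b)) (inj₁ c) = contradiction (joints-inj (trans (sym c) b)) not-back
          next≡ (inj₂ (a , b)) (inj₂ c) = joints-inj (trans (sym c) a)

        used-next : ∀ l → UsedEdge l → UsedEdge (next l)
        used-next l (i , i≡) with along i
        ... | m , i≡′ , ends with refl ← core-inj (trans (sym i≡) i≡′) with ends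
        ... | inj₁ (_ , vn≡) = continue (next i) i (next≢ (2≤len D) i) i≡ (inj₁ vn≡)
        -- D runs against the direction of the core here, so the continuation is found at the
        -- preceding position.
        ... | inj₂ (_ , v≡) with j , refl ← next-surjective i =
          continue j (next j) (next≢ (2≤len D) j ∘ sym) i≡ (inj₂ v≡)

      all-used : ∀ l → ∃ λ i → hedge D i ≡ core l
      all-used l with m , i≡ , _ ← along (fromℕ< (ℕ.≤-trans (s≤s z≤n) (2≤len D))) =
        next-closed⇒universal {P = UsedEdge} used-next m (_ , i≡) l

      core-unique : SameCycle coreCycle D
      core-unique v e = mk⇔ to from
        where
        to : Uses coreCycle v e → Uses D v e
        to (l , refl , v≡) with i , i≡ ← all-used l with m , i≡′ , ends ← along i
          with refl ← core-inj (trans (sym i≡) i≡′) = i , i≡ , which ends v≡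
          where
          which : SameEnds i l → joints l ≡ v ⊎ joints (next l) ≡ v → vert D i ≡ v ⊎ vert D (next i) ≡ v
          which (inj₁ (a , b)) (inj₁ refl) = inj₁ a
          which (inj₁ (a , b)) (inj₂ refl) = inj₂ b
          which (inj₂ (a , b)) (inj₁ refl) = inj₂ a
          which (inj₂ (a , b)) (inj₂ refl) = inj₁ b
        from : Uses D v e → Uses coreCycle v e
        from (i , refl , v≡) with l , i≡ , ends ← along i = l , sym i≡ , which ends v≡
          where
          which : SameEnds i l → vert D i ≡ v ⊎ vert D (next i) ≡ v → joints l ≡ v ⊎ joints (next l) ≡ v
          which (inj₁ (a , b)) (inj₁ refl) = inj₁ (sym a)
          which (inj₁ (a , b)) (inj₂ refl) = inj₂ (sym b)
          which (inj₂ (a , b)) (inj₁ refl) = inj₂ (sym b)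
          which (inj₂ (a , b)) (inj₂ refl) = inj₁ (sym a)

      girth≤ : g ≤ len D
      girth≤ = injective⇒≤ {f = proj₁ ∘ all-used} λ {l} {m} eq →
        core-inj (trans (sym (proj₂ (all-used l))) (trans (cong (hedge D) eq) (proj₂ (all-used m))))

    frame-linearUnicyclic : ∀ {m} → size H ≡ m → LinearUnicyclicOfGirth k m g H
    frame-linearUnicyclic size≡ = record
      { uniform = uniform ; linear = frame-linear
      ; unicyclic = connected , coreCycle , core-unique ; size≡m = size≡ } ,
      (coreCycle , refl) , girth≤

  adjacent-sym : ∀ {H u v} → Adjacent H u v → Adjacent H v u
  adjacent-sym (e , u∈ , v∈) = e , v∈ , u∈

  module _ {g : ℕ} where

    ∈-cycleEdge⁻ : ∀ {i e : Fin g} → i ∈ edge (cycleGraph g) e → i ≡ e ⊎ i ≡ next e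
    ∈-cycleEdge⁻ {i} {e} i∈ with x∈p∪q⁻ ⁅ e ⁆ ⁅ next e ⁆ i∈
    ... | inj₁ i∈ = inj₁ (x∈⁅y⁆⇒x≡y e i∈)
    ... | inj₂ i∈ = inj₂ (x∈⁅y⁆⇒x≡y (next e) i∈)

    ∣cycleEdge∣ : 2 ≤ g → ∀ e → ∣ edge (cycleGraph g) e ∣ ≡ 2
    ∣cycleEdge∣ 2≤g e = ℕ.≤-antisym
      (ℕ.≤-trans (ℕ.m≤m+n _ _) (ℕ.≤-reflexive (trans (∣∪∣+∣∩∣ ⁅ e ⁆ ⁅ next e ⁆)
        (cong₂ _+_ (∣⁅x⁆∣≡1 e) (∣⁅x⁆∣≡1 (next e))))))
      (∣∣≥2 (edge (cycleGraph g) e) (next≢ 2≤g e ∘ sym)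
        (x∈p∪q⁺ (inj₁ (x∈⁅x⁆ e))) (x∈p∪q⁺ (inj₂ (x∈⁅x⁆ (next e)))))

  hypercycle-frame : ∀ k g → 2 ≤ k → 2 ≤ g → Frame k g (hypercycle k g)
  hypercycle-frame k g 2≤k 2≤g = record
    { uniform = λ e → trans (∣++∣ (edge (cycleGraph g) e) _)
        (trans (cong₂ _+_ (∣cycleEdge∣ 2≤g e) (∣block∣ q e)) (ℕ.m+[n∸m]≡n 2≤k))
    ; connected = conn
    ; joints = joint k g
    ; core = λ i → i
    ; joints-inj = λ {i} {j} → ↑ˡ-injective (g * q) i j
    ; core-inj = λ eq → eq
    ; joint∈ = joint-here
    ; joint-next∈ = joint-next
    ; branching = λ {v} → branch v
    ; adjacent-joints = λ {e} i≢j i∈ j∈ →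
        e , refl , ends i≢j (∈-cycleEdge⁻ (∈-++ˡ⁻ _ (block q e) i∈)) (∈-cycleEdge⁻ (∈-++ˡ⁻ _ (block q e) j∈))
    }
    where
    q = k ∸ 2
    H = hypercycle k g

    joint-here : ∀ i → joint k g i ∈ edge H i
    joint-here i = ∈-++ˡ⁺ (block q i) (x∈p∪q⁺ (inj₁ (x∈⁅x⁆ i)))

    joint-next : ∀ i → joint k g (next i) ∈ edge H i
    joint-next i = ∈-++ˡ⁺ (block q i) (x∈p∪q⁺ (inj₂ (x∈⁅x⁆ (next i))))

    branch : ∀ v {e f} → e ≢ f → v ∈ edge H e → v ∈ edge H f → ∃ λ i → v ≡ joint k g i
    branch v {e} {f} e≢f v∈e v∈f with splitView g (g * q) v
    ... | left i  = i , refl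
    ... | right x = contradiction (block-unique q x (∈-++ʳ⁻ (edge (cycleGraph g) e) v∈e)
                                                    (∈-++ʳ⁻ (edge (cycleGraph g) f) v∈f)) e≢f

    ends : ∀ {i j e} → i ≢ j → i ≡ e ⊎ i ≡ next e → j ≡ e ⊎ j ≡ next e →
      (i ≡ e × j ≡ next e) ⊎ (j ≡ e × i ≡ next e)
    ends i≢j (inj₁ a) (inj₁ b) = contradiction (trans a (sym b)) i≢j
    ends i≢j (inj₁ a) (inj₂ b) = inj₁ (a , b)
    ends i≢j (inj₂ a) (inj₁ b) = inj₂ (b , a)
    ends i≢j (inj₂ a) (inj₂ b) = contradiction (trans a (sym b)) i≢j

    around : ∀ i j → Star (Adjacent H) (joint k g i) (joint k g j)
    around i = next-closed⇒universal {P = λ j → Star (Adjacent H) (joint k g i) (joint k g j)}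
      (λ j path → path ◅◅ (j , joint-here j , joint-next j) ◅ done) i done

    to-joint : ∀ v → ∃ λ i → Star (Adjacent H) v (joint k g i)
    to-joint v with splitView g (g * q) v
    ... | left i  = i , done
    ... | right x with i , x∈ ← block-total q x =
      i , (i , ∈-++ʳ⁺ (edge (cycleGraph g) i) x∈ , joint-here i) ◅ done

    conn : IsConnected H
    conn u v with i , u→i ← to-joint u | j , v→j ← to-joint v =
      u→i ◅◅ around i j ◅◅ reverse (adjacent-sym {H}) v→j

  module _ (k p : ℕ) (H : Hypergraph) (v : Fin (order H)) where

    private
      q = k ∸ 1
      H′ = addPendants k p H v
      m = size H
      n = order H


    edge-old : ∀ e → edge H′ (e ↑ˡ p) ≡ edge H e Vec.++ ⊥
    edge-old e rewrite splitAt-↑ˡ m e p = refl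

    edge-new : ∀ f → edge H′ (m ↑ʳ f) ≡ ⁅ v ⁆ Vec.++ block q f
    edge-new f rewrite splitAt-↑ʳ m p f = refl

    old∈old⁺ : ∀ {u e} → u ∈ edge H e → oldVertex k p H v u ∈ edge H′ (e ↑ˡ p)
    old∈old⁺ {u} {e} u∈ = subst (_ ∈_) (sym (edge-old e)) (∈-++ˡ⁺ ⊥ u∈)

    old∈old⁻ : ∀ {u e} → oldVertex k p H v u ∈ edge H′ (e ↑ˡ p) → u ∈ edge H e
    old∈old⁻ {u} {e} u∈ = ∈-++ˡ⁻ (edge H e) ⊥ (subst (_ ∈_) (edge-old e) u∈)

    new∉old : ∀ {x e} → ¬ n ↑ʳ x ∈ edge H′ (e ↑ˡ p)
    new∉old {x} {e} x∈ = ∉⊥ (∈-++ʳ⁻ (edge H e) (subst (_ ∈_) (edge-old e) x∈))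

    root∈new : ∀ f → oldVertex k p H v v ∈ edge H′ (m ↑ʳ f)
    root∈new f = subst (_ ∈_) (sym (edge-new f)) (∈-++ˡ⁺ (block q f) (x∈⁅x⁆ v))

    old∈new⁻ : ∀ {u f} → oldVertex k p H v u ∈ edge H′ (m ↑ʳ f) → u ≡ v
    old∈new⁻ {u} {f} u∈ = x∈⁅y⁆⇒x≡y v (∈-++ˡ⁻ ⁅ v ⁆ (block q f) (subst (_ ∈_) (edge-new f) u∈))

    new∈new⁺ : ∀ {x f} → x ∈ block q f → n ↑ʳ x ∈ edge H′ (m ↑ʳ f)
    new∈new⁺ {x} {f} x∈ = subst (_ ∈_) (sym (edge-new f)) (∈-++ʳ⁺ ⁅ v ⁆ x∈)

    new∈new⁻ : ∀ {x f} → n ↑ʳ x ∈ edge H′ (m ↑ʳ f) → x ∈ block q f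
    new∈new⁻ {x} {f} x∈ = ∈-++ʳ⁻ ⁅ v ⁆ (subst (_ ∈_) (edge-new f) x∈)

    degree-addPendants : ∀ u → degree H′ (oldVertex k p H v u) ≡ degree H u + p * 𝟙 (u ≟ v)
    degree-addPendants u = begin
      degree H′ u′
        ≡⟨ degree≡sum H′ u′ ⟩
      sum (λ e → 𝟙 (u′ ∈? edge H′ e))
        ≡⟨ sum-↑ m (λ e → 𝟙 (u′ ∈? edge H′ e)) ⟩
      sum (λ e → 𝟙 (u′ ∈? edge H′ (e ↑ˡ p))) + sum (λ f → 𝟙 (u′ ∈? edge H′ (m ↑ʳ f)))
        ≡⟨ cong₂ _+_
             (sum-cong-≗ λ e → 𝟙-cong (u′ ∈? edge H′ (e ↑ˡ p)) (u ∈? edge H e) old∈old⁻ old∈old⁺)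
             (sum-cong-≗ λ f → 𝟙-cong (u′ ∈? edge H′ (m ↑ʳ f)) (u ≟ v) (old∈new⁻ {u} {f}) λ { refl → root∈new f }) ⟩
      sum (λ e → 𝟙 (u ∈? edge H e)) + sum {p} (λ _ → 𝟙 (u ≟ v))
        ≡⟨ cong₂ _+_ (sym (degree≡sum H u)) (sum-const p (𝟙 (u ≟ v))) ⟩
      degree H u + p * 𝟙 (u ≟ v) ∎
      where
      open ≡-Reasoning
      u′ = oldVertex k p H v u

    -- The only vertex that gains hyperedges is the root, which is a joint already, so `branching`
    -- persists. A pendant hyperedge has only one old vertex and cannot contain two joints.
    addPendants-frame : ∀ {g} → 1 ≤ k → (frame : Frame k g H) → (∃ λ j → v ≡ Frame.joints frame j) →
      Frame k g H′
    addPendants-frame {g} 1≤k frame (j₀ , v≡) = record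
      { uniform = uniform′
      ; connected = conn
      ; joints = oldVertex k p H v ∘ joints
      ; core = (_↑ˡ p) ∘ core
      ; joints-inj = λ {i} {j} eq → joints-inj (↑ˡ-injective (p * q) (joints i) (joints j) eq)
      ; core-inj = λ {i} {j} eq → core-inj (↑ˡ-injective p (core i) (core j) eq)
      ; joint∈ = λ i → old∈old⁺ (joint∈ i)
      ; joint-next∈ = λ i → old∈old⁺ (joint-next∈ i)
      ; branching = λ {w} {e} {f} → branch w e f
      ; adjacent-joints = λ {e} → adjacent e
      }
      where
      open Frame frame

      uniform′ : IsUniform k H′
      uniform′ e with splitView m p e
      ... | left e = trans (cong ∣_∣ (edge-old e)) (trans (∣++∣ (edge H e) ⊥)
        (trans (cong₂ _+_ (uniform e) (∣⊥∣≡0 (p * q))) (ℕ.+-identityʳ k)))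
      ... | right f = trans (cong ∣_∣ (edge-new f)) (trans (∣++∣ ⁅ v ⁆ (block q f))
        (trans (cong₂ _+_ (∣⁅x⁆∣≡1 v) (∣block∣ q f)) (ℕ.m+[n∸m]≡n 1≤k)))

      to-old : ∀ w → ∃ λ u → Star (Adjacent H′) w (oldVertex k p H v u)
      to-old w with splitView n (p * q) w
      ... | left u  = u , done
      ... | right x with f , x∈ ← block-total q x =
        v , (m ↑ʳ f , new∈new⁺ x∈ , root∈new f) ◅ done

      conn : IsConnected H′
      conn w z with u , w→u ← to-old w | u′ , z→u′ ← to-old z =
        w→u ◅◅ gmap (oldVertex k p H v) (λ (e , u∈ , v∈) → e ↑ˡ p , old∈old⁺ u∈ , old∈old⁺ v∈) (connected u u′)
          ◅◅ reverse (adjacent-sym {H′}) z→u′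

      branch : ∀ w e f → e ≢ f → w ∈ edge H′ e → w ∈ edge H′ f → ∃ λ i → w ≡ oldVertex k p H v (joints i)
      branch w e f e≢f w∈e w∈f with splitView n (p * q) w | splitView m p e | splitView m p f
      ... | left u  | left e  | left f with i , refl ← branching (e≢f ∘ cong (_↑ˡ p)) (old∈old⁻ w∈e) (old∈old⁻ w∈f) = i , refl
      ... | left u  | right e | _       with refl ← old∈new⁻ {u} {e} w∈e = j₀ , cong (oldVertex k p H v) v≡
      ... | left u  | left e  | right f with refl ← old∈new⁻ {u} {f} w∈f = j₀ , cong (oldVertex k p H v) v≡
      ... | right x | left e  | _       = contradiction w∈e new∉old
      ... | right x | right e | left f  = contradiction w∈f new∉old
      ... | right x | right e | right f =
        contradiction (cong (m ↑ʳ_) (block-unique q x (new∈new⁻ w∈e) (new∈new⁻ w∈f))) e≢f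

      adjacent : ∀ e {i j} → i ≢ j → oldVertex k p H v (joints i) ∈ edge H′ e →
        oldVertex k p H v (joints j) ∈ edge H′ e →
        ∃ λ l → e ≡ core l ↑ˡ p × ((i ≡ l × j ≡ next l) ⊎ (j ≡ l × i ≡ next l))
      adjacent e i≢j i∈ j∈ with splitView m p e
      ... | left e with l , refl , ends ← adjacent-joints i≢j (old∈old⁻ i∈) (old∈old⁻ j∈) = l , refl , ends
      ... | right f = contradiction (joints-inj (trans (old∈new⁻ {f = f} i∈) (sym (old∈new⁻ {f = f} j∈)))) i≢j

  hypercycle⊙star-frame : ∀ k g p j → 2 ≤ k → 2 ≤ g → Frame k g (hypercycle⊙star k g p j)
  hypercycle⊙star-frame k g p j 2≤k 2≤g = addPendants-frame k p (hypercycle k g) (joint k g j)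
    (ℕ.≤-trans (s≤s z≤n) 2≤k) (hypercycle-frame k g 2≤k 2≤g) (j , refl)

  C₃-pendants-frame : ∀ k n₁ n₂ n₃ → 2 ≤ k → Frame k 3 (C₃-pendants k n₁ n₂ n₃)
  C₃-pendants-frame k n₁ n₂ n₃ 2≤k =
    addPendants-frame k n₃ _ _ 1≤k (addPendants-frame k n₂ _ _ 1≤k
      (addPendants-frame k n₁ _ _ 1≤k (hypercycle-frame k 3 2≤k (s≤s (s≤s z≤n)))
        (0F , refl)) (1F , refl)) (2F , refl)
    where
    1≤k = ℕ.≤-trans (s≤s z≤n) 2≤k

  frame-joint-degree : ∀ {k g H} (frame : Frame k g H) → 2 ≤ g → ∀ i → 2 ≤ degree H (Frame.joints frame i)
  frame-joint-degree {H = H} frame 2≤g i with j , refl ← next-surjective i =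
    degree-≥2 H (next≢ 2≤g j ∘ core-inj) (joint∈ (next j)) (joint-next∈ j)
    where open Frame frame

  star-degree : ∀ k g p j → 2 ≤ k → 2 ≤ g →
    p + 2 ≤ degree (hypercycle⊙star k g p j) (oldVertex k p (hypercycle k g) (joint k g j) (joint k g j))
  star-degree k g p j 2≤k 2≤g = begin
    p + 2                                  ≤⟨ ℕ.+-monoʳ-≤ p (frame-joint-degree (hypercycle-frame k g 2≤k 2≤g) 2≤g j) ⟩
    p + degree H (joint k g j)             ≡⟨ ℕ.+-comm p _ ⟩
    degree H (joint k g j) + p             ≡⟨ cong (degree H (joint k g j) +_) (trans (cong (p *_) (𝟙-true (joint k g j ≟ joint k g j) refl)) (ℕ.*-identityʳ p)) ⟨
    degree H (joint k g j) + p * 𝟙 (joint k g j ≟ joint k g j) ≡⟨ degree-addPendants k p H (joint k g j) (joint k g j) ⟨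
    degree (hypercycle⊙star k g p j) _     ∎
    where
    open ℕ.≤-Reasoning
    H = hypercycle k g

  triangle-degree : ∀ k i → degree (hypercycle k 3) (joint k 3 i) ≡ 2
  triangle-degree k i = trans (degree≡sum (hypercycle k 3) (joint k 3 i)) (trans
    (sum-cong-≗ λ e → 𝟙-cong (joint k 3 i ∈? edge (hypercycle k 3) e) (i ∈? edge (cycleGraph 3) e)
      (∈-++ˡ⁻ _ (block (k ∸ 2) e)) (∈-++ˡ⁺ (block (k ∸ 2) e)))
    (two i))
    where
    two : ∀ i → sum (λ e → 𝟙 (i ∈? edge (cycleGraph 3) e)) ≡ 2
    two 0F = refl
    two 1F = refl
    two 2F = refl

-- Isomorphism from labels, and the triangle with a star at one joint

module Isomorphism where

  open Counting
  open Cycles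
  open MomentFormula
  open import Data.Fin.Base using (Fin; zero; suc; fromℕ<)
  open import Data.Fin.Patterns using (0F; 1F; 2F)
  open import Data.Fin.Permutation
    using (Permutation; transpose; insert; insert-punchIn; id; _∘ₚ_; _⟨$⟩ʳ_; _⟨$⟩ˡ_; inverseˡ; inverseʳ)
  open import Data.Fin.Properties using (_≟_; suc-injective; any?)
  open import Data.Fin.Subset using (_∈_; ∣_∣)
  open import Data.Fin.Subset.Properties using (_∈?_)
  open import Data.Nat.Base using (ℕ; _+_; _*_; _≤_; _∸_; s≤s; z≤n; s≤s⁻¹)
  import Data.Nat.Properties as ℕ
  open import Data.Nat.Solver using (module +-*-Solver)
  open import Data.Product.Base using (Σ; ∃; _,_; proj₁; proj₂; _×_)
  open import Data.Sum.Base using (_⊎_; inj₁; inj₂; map₂) renaming (map to ⊎-map)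
  open import Data.Sum.Properties using (inj₂-injective) renaming (≡-dec to ⊎-≡-dec)
  open import Data.Vec.Functional using (removeAt; Vector; []; _∷_)
  open import Function.Base using (_∘_)
  open import Function.Bundles using (_⇔_; mk⇔; Equivalence)
  open import Function.Definitions using (Injective)
  open import Relation.Binary.Definitions using (DecidableEquality)
  open import Relation.Binary.PropositionalEquality
    using (_≡_; _≢_; refl; sym; trans; cong; subst; module ≡-Reasoning; cong₂)
  open import Relation.Nullary using (yes; no; contradiction; ¬_; Dec)
  open import Relation.Nullary.Decidable using (dec-true; dec-false; ¬?)

  permutation-injective : ∀ {m n} (π : Permutation m n) {i j} → π ⟨$⟩ʳ i ≡ π ⟨$⟩ʳ j → i ≡ j
  permutation-injective π e = trans (sym (inverseˡ π)) (trans (cong (π ⟨$⟩ˡ_) e) (inverseˡ π))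

  transpose-at : ∀ {n} (i j : Fin n) → transpose i j ⟨$⟩ʳ i ≡ j
  transpose-at i j rewrite dec-true (i ≟ i) refl = refl

  transpose-elsewhere : ∀ {n} (i j k : Fin n) → k ≢ i → k ≢ j → transpose i j ⟨$⟩ʳ k ≡ k
  transpose-elsewhere i j k k≢i k≢j rewrite dec-false (k ≟ i) k≢i | dec-false (k ≟ j) k≢j = refl

  -- A transposition corrects the value at the first index; by injectivity it fixes the values
  -- already arranged.
  extend-injections : ∀ {s m n} → m ≡ n → (f : Fin s → Fin m) (f′ : Fin s → Fin n) →
    Injective _≡_ _≡_ f → Injective _≡_ _≡_ f′ → Σ (Permutation m n) λ σ → ∀ i → σ ⟨$⟩ʳ f i ≡ f′ i
  extend-injections {ℕ.zero}  refl f f′ inj inj′ = id , λ ()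
  extend-injections {ℕ.suc s} refl f f′ inj inj′
    with σ , maps ← extend-injections refl (f ∘ suc) (f′ ∘ suc) (suc-injective ∘ inj) (suc-injective ∘ inj′) =
    σ ∘ₚ transpose (σ ⟨$⟩ʳ f zero) (f′ zero) ,
    λ { zero → transpose-at (σ ⟨$⟩ʳ f zero) (f′ zero)
      ; (suc i) → trans (transpose-elsewhere (σ ⟨$⟩ʳ f zero) (f′ zero) (σ ⟨$⟩ʳ f (suc i))
          (λ e → contradiction (inj (permutation-injective σ e)) λ ())
          (λ e → contradiction (inj′ (trans (sym (maps i)) e)) λ ()))
          (maps i) }

  module _ {l} {L : Set l} (_≟ₗ_ : DecidableEquality L) where

    labelCount : ∀ {n} → (Fin n → L) → L → ℕ
    labelCount ℓ x = sum λ i → 𝟙 (ℓ i ≟ₗ x)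

    label-occurs : ∀ {n} (ℓ : Fin n → L) x → 1 ≤ labelCount ℓ x → ∃ λ i → ℓ i ≡ x
    label-occurs ℓ x 1≤ with i , 1≤i ← positive-term (λ i → 𝟙 (ℓ i ≟ₗ x)) 1≤ with ℓ i ≟ₗ x | 1≤i
    ... | yes e | _ = i , e

    labelCount-≥1 : ∀ {n} (ℓ : Fin n → L) i → 1 ≤ labelCount ℓ (ℓ i)
    labelCount-≥1 ℓ i = ℕ.≤-trans (ℕ.≤-reflexive (sym (𝟙-true (ℓ i ≟ₗ ℓ i) refl)))
      (term≤sum (λ j → 𝟙 (ℓ j ≟ₗ ℓ i)) i)

    -- The first element is matched with any element of the same label. Removing both leaves
    -- families with equal label counts.
    labelled-bijection : ∀ {m n} (ℓ : Fin m → L) (ℓ′ : Fin n → L) →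
      (∀ x → labelCount ℓ x ≡ labelCount ℓ′ x) →
      Σ (Permutation m n) λ π → ∀ i → ℓ′ (π ⟨$⟩ʳ i) ≡ ℓ i
    labelled-bijection {ℕ.zero} {ℕ.zero}  ℓ ℓ′ h = id , λ ()
    labelled-bijection {ℕ.zero} {ℕ.suc n} ℓ ℓ′ h with () ← subst (1 ≤_) (sym (h (ℓ′ zero))) (labelCount-≥1 ℓ′ zero)
    labelled-bijection {ℕ.suc m} {n} ℓ ℓ′ h
      with j , ℓ′j≡ ← label-occurs ℓ′ (ℓ zero) (subst (1 ≤_) (h (ℓ zero)) (labelCount-≥1 ℓ zero))
      with n
    ... | ℕ.suc n with π , maps ← labelled-bijection (ℓ ∘ suc) (removeAt ℓ′ j) (λ x →
        ℕ.+-cancelˡ-≡ (𝟙 (ℓ zero ≟ₗ x)) _ _ (trans (h x) (trans (sum-remove {i = j} (λ i → 𝟙 (ℓ′ i ≟ₗ x)))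
          (cong (λ y → 𝟙 (y ≟ₗ x) + labelCount (removeAt ℓ′ j) x) ℓ′j≡)))) =
      insert zero j π , λ { zero → ℓ′j≡ ; (suc i) → trans (cong ℓ′ (insert-punchIn zero j π i)) (maps i) }

  -- All vertices but the marked ones lie in a single hyperedge, their `owner`. Unmarked vertices
  -- with the same owner are interchangeable, so a vertex matters only through its label.
  record Core (s : ℕ) (H : Hypergraph) : Set where
    field
      marked     : Fin s → Fin (order H)
      marked-inj : Injective _≡_ _≡_ marked
      owner      : Fin (order H) → Fin (size H)
      owner∈     : ∀ v → v ∈ edge H (owner v)
      private-to : ∀ {v} → (∀ i → marked i ≢ v) → ∀ {e} → v ∈ edge H e → e ≡ owner v

    Label : Set
    Label = Fin s ⊎ Fin (size H)

    _≟ₗ_ : DecidableEquality Label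
    _≟ₗ_ = ⊎-≡-dec _≟_ _≟_

    label : Fin (order H) → Label
    label v with any? (λ i → marked i ≟ v)
    ... | yes (i , _) = inj₁ i
    ... | no _        = inj₂ (owner v)

    LabelIn : Label → Fin (size H) → Set
    LabelIn (inj₁ i) e = marked i ∈ edge H e
    LabelIn (inj₂ f) e = e ≡ f

    label-in : ∀ v e → v ∈ edge H e ⇔ LabelIn (label v) e
    label-in v e with any? (λ i → marked i ≟ v)
    ... | yes (i , refl) = mk⇔ (λ v∈ → v∈) (λ v∈ → v∈)
    ... | no unmarked    = mk⇔ (private-to λ i eq → unmarked (i , eq)) λ { refl → owner∈ v }

    marked-count : ∀ i → labelCount _≟ₗ_ label (inj₁ i) ≡ 1
    marked-count i = trans (sum-single (marked i) (λ v → 𝟙 (label v ≟ₗ inj₁ i)) λ v v≢ → 𝟙-false (label v ≟ₗ inj₁ i) (other v v≢))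
      (𝟙-true (label (marked i) ≟ₗ inj₁ i) self)
      where
      other : ∀ v → v ≢ marked i → label v ≢ inj₁ i
      other v v≢ eq with any? (λ j → marked j ≟ v) | eq
      ... | yes (j , refl) | refl = v≢ refl
      self : label (marked i) ≡ inj₁ i
      self with any? (λ j → marked j ≟ marked i)
      ... | yes (j , e) = cong inj₁ (marked-inj e)
      ... | no none     = contradiction (i , refl) none

    -- In a uniform hypergraph this determines the number of unmarked vertices of a hyperedge from
    -- its marked ones.
    edge-count : ∀ e → ∣ edge H e ∣ ≡
      labelCount _≟ₗ_ label (inj₂ e) + sum λ i → 𝟙 (marked i ∈? edge H e)
    edge-count e = begin
      ∣ edge H e ∣
        ≡⟨ ∣∣≡sum (edge H e) ⟩
      sum (λ v → 𝟙 (v ∈? edge H e))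
        ≡⟨ sum-cong-≗ split ⟩
      sum (λ v → 𝟙 (label v ≟ₗ inj₂ e) + sum (λ i → 𝟙 (marked i ≟ v)) * 𝟙 (v ∈? edge H e))
        ≡⟨ ∑-distrib-+ (λ v → 𝟙 (label v ≟ₗ inj₂ e)) (λ v → sum (λ i → 𝟙 (marked i ≟ v)) * 𝟙 (v ∈? edge H e)) ⟩
      labelCount _≟ₗ_ label (inj₂ e) + sum (λ v → sum (λ i → 𝟙 (marked i ≟ v)) * 𝟙 (v ∈? edge H e))
        ≡⟨ cong (labelCount _≟ₗ_ label (inj₂ e) +_) (sum-image marked (λ v → 𝟙 (v ∈? edge H e))) ⟩
      labelCount _≟ₗ_ label (inj₂ e) + sum (λ i → 𝟙 (marked i ∈? edge H e)) ∎
      where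
      open ≡-Reasoning
      split : ∀ v → 𝟙 (v ∈? edge H e) ≡ 𝟙 (label v ≟ₗ inj₂ e) + sum (λ i → 𝟙 (marked i ≟ v)) * 𝟙 (v ∈? edge H e)
      split v with any? (λ i → marked i ≟ v)
      ... | yes (i , refl) = sym (trans (cong (_* 𝟙 (v ∈? edge H e))
        (ℕ.≤-antisym (image≤1 marked marked-inj v) (image≥1 marked i))) (ℕ.+-identityʳ _))
      ... | no unmarked = trans
        (𝟙-cong (v ∈? edge H e) (inj₂ {A = Fin s} (owner v) ≟ₗ inj₂ e)
          (λ v∈ → cong inj₂ (sym (private-to (λ i eq → unmarked (i , eq)) v∈)))
          (λ eq → subst (λ f → v ∈ edge H f) (inj₂-injective eq) (owner∈ v)))
        (sym (trans (cong (𝟙 (inj₂ {A = Fin s} (owner v) ≟ₗ inj₂ e) +_)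
          (cong (_* 𝟙 (v ∈? edge H e)) (sum-0 _ λ i → 𝟙-false (marked i ≟ v) λ eq → unmarked (i , eq))))
          (ℕ.+-identityʳ _)))

  -- If σ respects the marked vertices, uniformity makes corresponding hyperedges own equally many
  -- unmarked vertices, so a label-preserving bijection of the vertices exists.
  core-isomorphism : ∀ {k s G H} → IsUniform k G → IsUniform k H → (C : Core s G) (D : Core s H) →
    (σ : Permutation (size G) (size H)) →
    (∀ i e → Core.marked C i ∈ edge G e ⇔ Core.marked D i ∈ edge H (σ ⟨$⟩ʳ e)) → G ≅ H
  core-isomorphism {k} {s} {G} {H} uniG uniH C D σ marks = record
    { onVertices = proj₁ bijection ; onEdges = σ
    ; incidence = λ v e → mk⇔
        (λ v∈ → Equivalence.from (D.label-in _ _) (subst (λ x → D.LabelIn x (σ ⟨$⟩ʳ e)) (sym (proj₂ bijection v))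
          (transfer⁺ (C.label v) e (Equivalence.to (C.label-in v e) v∈))))
        (λ v∈ → Equivalence.from (C.label-in v e) (transfer⁻ (C.label v) e
          (subst (λ x → D.LabelIn x (σ ⟨$⟩ʳ e)) (proj₂ bijection v) (Equivalence.to (D.label-in _ _) v∈)))) }
    where
    module C = Core C
    module D = Core D

    relabel : C.Label → D.Label
    relabel = map₂ (σ ⟨$⟩ʳ_)

    relabel-injective : ∀ {x y} → relabel x ≡ relabel y → x ≡ y
    relabel-injective {inj₁ i} {inj₁ j} refl = refl
    relabel-injective {inj₂ e} {inj₂ f} eq   = cong inj₂ (permutation-injective σ (inj₂-injective eq))

    transfer⁺ : ∀ x e → C.LabelIn x e → D.LabelIn (relabel x) (σ ⟨$⟩ʳ e)
    transfer⁺ (inj₁ i) e i∈   = Equivalence.to (marks i e) i∈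
    transfer⁺ (inj₂ f) e refl = refl

    transfer⁻ : ∀ x e → D.LabelIn (relabel x) (σ ⟨$⟩ʳ e) → C.LabelIn x e
    transfer⁻ (inj₁ i) e i∈ = Equivalence.from (marks i e) i∈
    transfer⁻ (inj₂ f) e eq = permutation-injective σ eq

    relabelled : ∀ x → labelCount D._≟ₗ_ (relabel ∘ C.label) (relabel x) ≡ labelCount C._≟ₗ_ C.label x
    relabelled x = sum-cong-≗ λ v →
      𝟙-cong (relabel (C.label v) D.≟ₗ relabel x) (C.label v C.≟ₗ x) relabel-injective (cong relabel)

    counts : ∀ x → labelCount D._≟ₗ_ (relabel ∘ C.label) (relabel x) ≡ labelCount D._≟ₗ_ D.label (relabel x)
    counts (inj₁ i) = trans (relabelled (inj₁ i)) (trans (C.marked-count i) (sym (D.marked-count i)))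
    counts (inj₂ e) = trans (relabelled (inj₂ e)) (ℕ.+-cancelʳ-≡ _ _ _ (begin
      labelCount C._≟ₗ_ C.label (inj₂ e) + sum (λ i → 𝟙 (C.marked i ∈? edge G e))
        ≡⟨ C.edge-count e ⟨
      ∣ edge G e ∣
        ≡⟨ trans (uniG e) (sym (uniH (σ ⟨$⟩ʳ e))) ⟩
      ∣ edge H (σ ⟨$⟩ʳ e) ∣
        ≡⟨ D.edge-count (σ ⟨$⟩ʳ e) ⟩
      labelCount D._≟ₗ_ D.label (inj₂ (σ ⟨$⟩ʳ e)) + sum (λ i → 𝟙 (D.marked i ∈? edge H (σ ⟨$⟩ʳ e)))
        ≡⟨ cong (labelCount D._≟ₗ_ D.label (inj₂ (σ ⟨$⟩ʳ e)) +_) (sum-cong-≗ λ i →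
             𝟙-cong (D.marked i ∈? edge H (σ ⟨$⟩ʳ e)) (C.marked i ∈? edge G e)
               (Equivalence.from (marks i e)) (Equivalence.to (marks i e))) ⟩
      labelCount D._≟ₗ_ D.label (inj₂ (σ ⟨$⟩ʳ e)) + sum (λ i → 𝟙 (C.marked i ∈? edge G e)) ∎))
      where open ≡-Reasoning

    relabel-surjective : ∀ y → ∃ λ x → relabel x ≡ y
    relabel-surjective (inj₁ i) = inj₁ i , refl
    relabel-surjective (inj₂ f) = inj₂ (σ ⟨$⟩ˡ f) , cong inj₂ (inverseʳ σ)

    bijection : Σ (Permutation (order G) (order H)) λ π → ∀ v → D.label (π ⟨$⟩ʳ v) ≡ relabel (C.label v)
    bijection = labelled-bijection D._≟ₗ_ (relabel ∘ C.label) D.label λ y → at (relabel-surjective y)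
      where
      at : ∀ {y} → (∃ λ x → relabel x ≡ y) →
        labelCount D._≟ₗ_ (relabel ∘ C.label) y ≡ labelCount D._≟ₗ_ D.label y
      at (x , refl) = counts x

  []-injective : ∀ {a} {A : Set a} → Injective (_≡_ {A = Fin 0}) (_≡_ {A = A}) []
  []-injective {x = ()}

  ∷-injective : ∀ {a} {A : Set a} {n x} {f : Vector A n} → (∀ i → f i ≢ x) → Injective _≡_ _≡_ f →
    Injective _≡_ _≡_ (x ∷ f)
  ∷-injective x∉ inj {zero}  {zero}  _  = refl
  ∷-injective x∉ inj {zero}  {suc j} eq = contradiction (sym eq) (x∉ j)
  ∷-injective x∉ inj {suc i} {zero}  eq = contradiction eq (x∉ i)
  ∷-injective x∉ inj {suc i} {suc j} eq = cong suc (inj eq)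

  triple-injective : ∀ {a} {A : Set a} {x y z : A} → x ≢ y → x ≢ z → y ≢ z →
    Injective _≡_ _≡_ (x ∷ y ∷ z ∷ [])
  triple-injective x≢y x≢z y≢z = ∷-injective (λ { 0F → x≢y ∘ sym ; 1F → x≢z ∘ sym })
    (∷-injective (λ { 0F → y≢z ∘ sym }) (∷-injective (λ ()) []-injective))

  degree-≥3 : ∀ H {v e f g} → e ≢ f → e ≢ g → f ≢ g →
    v ∈ edge H e → v ∈ edge H f → v ∈ edge H g → 3 ≤ degree H v
  degree-≥3 H {v} {e} {f} {g} e≢f e≢g f≢g v∈e v∈f v∈g = begin
    3                                             ≡⟨ cong₂ _+_ (𝟙-true (v ∈? edge H e) v∈e) (cong₂ _+_ (𝟙-true (v ∈? edge H f) v∈f) (cong (_+ 0) (𝟙-true (v ∈? edge H g) v∈g))) ⟨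
    sum ((λ e → 𝟙 (v ∈? edge H e)) ∘ (e ∷ f ∷ g ∷ []))  ≤⟨ sum-∘-≤ (e ∷ f ∷ g ∷ []) (triple-injective e≢f e≢g f≢g) _ ⟩
    sum (λ e → 𝟙 (v ∈? edge H e))                 ≡⟨ degree≡sum H v ⟨
    degree H v                                    ∎
    where open ℕ.≤-Reasoning

  -- `marked 0F` is the hub, contained in every hyperedge except the opposite side `sides 1F`; the
  -- other two corners lie in two sides each. All hyperedges that are not sides are pendant at the
  -- hub.
  record StarTriangle (H : Hypergraph) : Set where
    field
      core      : Core 3 H
      sides     : Fin 3 → Fin (size H)
      sides-inj : Injective _≡_ _≡_ sides

    open Core core public

    field
      hub∈   : ∀ e → marked 0F ∈ edge H e ⇔ e ≢ sides 1F
      first∈ : ∀ e → marked 1F ∈ edge H e ⇔ (e ≡ sides 0F ⊎ e ≡ sides 1F)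
      last∈  : ∀ e → marked 2F ∈ edge H e ⇔ (e ≡ sides 1F ⊎ e ≡ sides 2F)

  -- Incidence with the corners is expressed through the sides alone, so any bijection of the
  -- hyperedges that matches the sides respects it.
  starTriangle-isomorphism : ∀ {k G H} → IsUniform k G → IsUniform k H → size G ≡ size H →
    StarTriangle G → StarTriangle H → G ≅ H
  starTriangle-isomorphism uniG uniH sizes S T
    with σ , maps ← extend-injections sizes (StarTriangle.sides S) (StarTriangle.sides T)
                      (StarTriangle.sides-inj S) (StarTriangle.sides-inj T) =
    core-isomorphism uniG uniH S.core T.core σ λ
      { 0F e → mk⇔
          (λ m∈ → Equivalence.from (T.hub∈ _) λ eq → Equivalence.to (S.hub∈ e) m∈ (side⁻ 1F eq))
          (λ m∈ → Equivalence.from (S.hub∈ e) λ eq → Equivalence.to (T.hub∈ _) m∈ (side⁺ 1F eq))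
      ; 1F e → mk⇔
          (λ m∈ → Equivalence.from (T.first∈ _) (⊎-map (side⁺ 0F) (side⁺ 1F) (Equivalence.to (S.first∈ e) m∈)))
          (λ m∈ → Equivalence.from (S.first∈ e) (⊎-map (side⁻ 0F) (side⁻ 1F) (Equivalence.to (T.first∈ _) m∈)))
      ; 2F e → mk⇔
          (λ m∈ → Equivalence.from (T.last∈ _) (⊎-map (side⁺ 1F) (side⁺ 2F) (Equivalence.to (S.last∈ e) m∈)))
          (λ m∈ → Equivalence.from (S.last∈ e) (⊎-map (side⁻ 1F) (side⁻ 2F) (Equivalence.to (T.last∈ _) m∈))) }
    where
    module S = StarTriangle S
    module T = StarTriangle T
    side⁺ : ∀ i {e} → e ≡ S.sides i → σ ⟨$⟩ʳ e ≡ T.sides i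
    side⁺ i refl = maps i
    side⁻ : ∀ i {e} → σ ⟨$⟩ʳ e ≡ T.sides i → e ≡ S.sides i
    side⁻ i eq = permutation-injective σ (trans eq (sym (maps i)))

  -- Degrees in a linear unicyclic hypergraph

  module UnicyclicDegrees {k m H} (2≤k : 2 ≤ k) (lu : LinearUnicyclic k m H) where

    open LinearUnicyclic lu

    private
      connected = proj₁ unicyclic
      C = proj₁ (proj₂ unicyclic)
      start : Fin (len C)
      start = fromℕ< (ℕ.≤-trans (s≤s z≤n) (2≤len C))

    degreeExcess : Fin (order H) → ℕ
    degreeExcess v = degree H v ∸ 1

    -- Connectedness and the presence of a cycle put every vertex into some hyperedge, so the
    -- subtraction is not truncated.
    degree≡ : ∀ v → degree H v ≡ 1 + degreeExcess v
    degree≡ v with e , v∈ ← connected-covered H k uniform 2≤k connected C v =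
      sym (ℕ.m+[n∸m]≡n (degree-≥1 H v∈))

    order≡ : order H ≡ m * (k ∸ 1)
    order≡ = trans (unicyclic-order H k uniform 2≤k unicyclic) (cong (_* (k ∸ 1)) size≡m)

    -- The degrees sum to mk, and there are m(k - 1) vertices.
    sum-degreeExcess : sum degreeExcess ≡ m
    sum-degreeExcess = ℕ.+-cancelˡ-≡ (order H) _ _ (begin
      order H + sum degreeExcess              ≡⟨ cong (_+ sum degreeExcess) (sum-1 (order H)) ⟨
      sum {order H} (λ _ → 1) + sum degreeExcess  ≡⟨ ∑-distrib-+ (λ _ → 1) degreeExcess ⟨
      sum (λ v → 1 + degreeExcess v)          ≡⟨ sum-cong-≗ degree≡ ⟨
      sum (degree H)                          ≡⟨ handshake H ⟩
      sum (λ e → ∣ edge H e ∣)                ≡⟨ sum-cong-≗ uniform ⟩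
      sum {size H} (λ _ → k)                  ≡⟨ sum-const (size H) k ⟩
      size H * k                              ≡⟨ cong₂ _*_ size≡m (sym (ℕ.m+[n∸m]≡n (ℕ.≤-trans (s≤s z≤n) 2≤k))) ⟩
      m * (1 + (k ∸ 1))                       ≡⟨ ℕ.*-suc m (k ∸ 1) ⟩
      m + m * (k ∸ 1)                         ≡⟨ ℕ.+-comm m _ ⟩
      m * (k ∸ 1) + m                         ≡⟨ cong (_+ m) order≡ ⟨
      order H + m                             ∎)
      where open ≡-Reasoning

    -- The correction depends on m and k alone, so comparing moments amounts to comparing sums of
    -- squared excesses.
    degreeSquares≡ : degreeSquares H ≡ sumSquares degreeExcess + (2 * m + m * (k ∸ 1))
    degreeSquares≡ = begin
      sum (λ v → degree H v * degree H v)
        ≡⟨ sum-cong-≗ (λ v → trans (cong (λ d → d * d) (degree≡ v)) (square (degreeExcess v))) ⟩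
      sum (λ v → degreeExcess v * degreeExcess v + (2 * degreeExcess v + 1))
        ≡⟨ ∑-distrib-+ (λ v → degreeExcess v * degreeExcess v) (λ v → 2 * degreeExcess v + 1) ⟩
      sumSquares degreeExcess + sum (λ v → 2 * degreeExcess v + 1)
        ≡⟨ cong (sumSquares degreeExcess +_) (∑-distrib-+ (λ v → 2 * degreeExcess v) (λ _ → 1)) ⟩
      sumSquares degreeExcess + (sum (λ v → 2 * degreeExcess v) + sum {order H} (λ _ → 1))
        ≡⟨ cong (sumSquares degreeExcess +_) (cong₂ _+_
             (trans (sym (*-distribˡ-sum 2 degreeExcess)) (cong (2 *_) sum-degreeExcess))
             (trans (sum-1 (order H)) order≡)) ⟩
      sumSquares degreeExcess + (2 * m + m * (k ∸ 1)) ∎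
      where
      open ≡-Reasoning
      open +-*-Solver using (solve; _:+_; _:*_; _:=_; con)
      square : ∀ x → (1 + x) * (1 + x) ≡ x * x + (2 * x + 1)
      square = solve 1 (λ x → (con 1 :+ x) :* (con 1 :+ x) := x :* x :+ (con 2 :* x :+ con 1)) refl

    excess-≥1 : ∀ {v e f} → e ≢ f → v ∈ edge H e → v ∈ edge H f → 1 ≤ degreeExcess v
    excess-≥1 {v} e≢f v∈e v∈f = s≤s⁻¹ (subst (2 ≤_) (degree≡ v) (degree-≥2 H e≢f v∈e v∈f))

    cycle-excess : ∀ (D : Cycle H) i → 1 ≤ degreeExcess (vert D i)
    cycle-excess D i with (j , j≢ , v∈) , _ ← other-edges D i = excess-≥1 j≢ v∈ (vert∈ D i)

    -- In a cycle of length 2 both hyperedges would share two vertices, against linearity.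
    cycle-next²≢ : ∀ (D : Cycle H) i → next (next i) ≢ i
    cycle-next²≢ D i eq = next≢ (2≤len D) i (sym (hedge-inj D (linear-≡ {H} linear
      (λ v≡ → next≢ (2≤len D) i (sym (vert-inj D v≡)))
      (vert∈ D i) (subst (λ j → vert D j ∈ edge H (hedge D (next i))) eq (vert-next∈ D (next i)))
      (vert-next∈ D i) (vert∈ D (next i)))))

    -- Every cycle, whatever its length, supplies these three distinct vertices of positive excess,
    -- so the bounds for g = 3 apply to every girth.
    arc₃ : (D : Cycle H) → Fin (len D) → Fin 3 → Fin (order H)
    arc₃ D i = vert D i ∷ vert D (next i) ∷ vert D (next (next i)) ∷ []

    arc₃-injective : ∀ D i → Injective _≡_ _≡_ (arc₃ D i)
    arc₃-injective D i = triple-injective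
      (λ eq → next≢ (2≤len D) i (sym (vert-inj D eq)))
      (λ eq → cycle-next²≢ D i (sym (vert-inj D eq)))
      (λ eq → next≢ (2≤len D) (next i) (sym (vert-inj D eq)))

    arc₃-excess : ∀ D i j → 1 ≤ degreeExcess (arc₃ D i j)
    arc₃-excess D i 0F = cycle-excess D i
    arc₃-excess D i 1F = cycle-excess D (next i)
    arc₃-excess D i 2F = cycle-excess D (next (next i))

    someArc : Σ (Fin 3 → Fin (order H)) λ w → Injective _≡_ _≡_ w × (∀ j → 1 ≤ degreeExcess (w j))
    someArc = arc₃ C start , arc₃-injective C start , arc₃-excess C start

    module _ (hub : Fin (order H)) (large : m ≤ 2 + degreeExcess hub) where

      private
        rest≤2 : ∀ {s} (w : Fin s → Fin (order H)) → Injective _≡_ _≡_ w → (∀ i → w i ≢ hub) →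
          sum (degreeExcess ∘ w) ≤ 2
        rest≤2 w inj avoids = ℕ.+-cancelˡ-≤ (degreeExcess hub) _ _ (begin
          degreeExcess hub + sum (degreeExcess ∘ w)  ≤⟨ sum-∘-≤ (hub ∷ w) (∷-injective avoids inj) degreeExcess ⟩
          sum degreeExcess                           ≡⟨ sum-degreeExcess ⟩
          m                                          ≤⟨ large ⟩
          2 + degreeExcess hub                       ≡⟨ ℕ.+-comm 2 _ ⟩
          degreeExcess hub + 2                       ∎)
          where open ℕ.≤-Reasoning

        no-three : (w : Fin 3 → Fin (order H)) → Injective _≡_ _≡_ w → (∀ i → w i ≢ hub) →
          ¬ (∀ i → 1 ≤ degreeExcess (w i))
        no-three w inj avoids 1≤ with ℕ.≤-trans (sum-mono-≤ 1≤) (rest≤2 w inj avoids)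
        ... | s≤s (s≤s ())

        no-heavy : ∀ {a b} → a ≢ b → a ≢ hub → b ≢ hub → 2 ≤ degreeExcess a → ¬ 1 ≤ degreeExcess b
        no-heavy {a} {b} a≢b a≢ b≢ 2≤a 1≤b
          with ℕ.≤-trans (ℕ.+-mono-≤ 2≤a (ℕ.+-mono-≤ 1≤b (z≤n {0})))
                 (rest≤2 (a ∷ b ∷ []) (∷-injective (λ { 0F → a≢b ∘ sym }) (∷-injective (λ ()) []-injective)) λ { 0F → a≢ ; 1F → b≢ })
        ... | s≤s (s≤s ())

        -- Otherwise three cycle vertices would need excess 3 outside the hub, where at most 2 is
        -- left.
        hub-on-cycle : ∃ λ i → vert C i ≡ hub
        hub-on-cycle with any? (λ i → vert C i ≟ hub)
        ... | yes found = found
        ... | no off    = contradiction (arc₃-excess C start) (no-three (arc₃ C start) (arc₃-injective C start)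
          λ { 0F eq → off (_ , eq) ; 1F eq → off (_ , eq) ; 2F eq → off (_ , eq) })

        -- `large` says that the hub has degree at least m - 1, so at most one hyperedge misses it.
        few-misses : ∀ {e f} → e ≢ f → ¬ hub ∈ edge H e → hub ∈ edge H f
        few-misses {e} {f} e≢f hub∉e with hub ∈? edge H f
        ... | yes hub∈f = hub∈f
        ... | no hub∉f  = contradiction (begin
          2 + degree H hub
            ≤⟨ ℕ.+-monoˡ-≤ (degree H hub) (ℕ.≤-trans
                 (ℕ.≤-reflexive (sym (cong₂ _+_ (𝟙-true (misses? e) hub∉e) (𝟙-true (misses? f) hub∉f))))
                 (two-terms≤sum (λ e → 𝟙 (misses? e)) e≢f)) ⟩
          sum (λ e → 𝟙 (misses? e)) + degree H hub
            ≡⟨ cong (sum (λ e → 𝟙 (misses? e)) +_) (degree≡sum H hub) ⟩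
          sum (λ e → 𝟙 (misses? e)) + sum (λ e → 𝟙 (hub ∈? edge H e))
            ≡⟨ ∑-distrib-+ (λ e → 𝟙 (misses? e)) (λ e → 𝟙 (hub ∈? edge H e)) ⟨
          sum (λ e → 𝟙 (misses? e) + 𝟙 (hub ∈? edge H e))
            ≡⟨ sum-cong-≗ (λ e → complementary (hub ∈? edge H e)) ⟩
          sum {size H} (λ _ → 1)
            ≡⟨ trans (sum-1 (size H)) size≡m ⟩
          m
            ≤⟨ large ⟩
          2 + degreeExcess hub
            ≡⟨ cong ℕ.suc (sym (degree≡ hub)) ⟩
          1 + degree H hub ∎) (ℕ.<⇒≱ ℕ.≤-refl)
          where
          open ℕ.≤-Reasoning
          misses? : ∀ e → Dec (¬ hub ∈ edge H e)
          misses? e = ¬? (hub ∈? edge H e)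
          complementary : ∀ {a} {A : Set a} (P? : Dec A) → 𝟙 (¬? P?) + 𝟙 P? ≡ 1
          complementary (yes _) = refl
          complementary (no _)  = refl

      -- The excess outside the hub is at most 2, so the cycle is a triangle
      -- through the hub and uses up all of it.
      starTriangle : StarTriangle H
      starTriangle with i , refl ← hub-on-cycle = record
        { core = record
          { marked = arc₃ C i
          ; marked-inj = arc₃-injective C i
          ; owner = λ v → proj₁ (covered v)
          ; owner∈ = λ v → proj₂ (covered v)
          ; private-to = λ {v} → private-to v }
        ; sides = hedge C i ∷ hedge C j ∷ hedge C l ∷ []
        ; sides-inj = triple-injective
            (λ eq → i≢j (hedge-inj C eq)) (λ eq → i≢l (hedge-inj C eq)) (λ eq → j≢l (hedge-inj C eq))
        ; hub∈ = λ e → mk⇔ (λ { i∈ refl → hub∉ i∈ }) (hub-member e)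
        ; first∈ = λ e → mk⇔ (first-edges e) λ { (inj₁ refl) → vert-next∈ C i ; (inj₂ refl) → vert∈ C j }
        ; last∈ = λ e → mk⇔ (last-edges e) λ { (inj₁ refl) → vert-next∈ C j ; (inj₂ refl) → vert∈ C l }
        }
        where
        j = next i
        l = next j
        i≢j = next≢ (2≤len C) i ∘ sym
        j≢l = next≢ (2≤len C) j ∘ sym
        i≢l = cycle-next²≢ C i ∘ sym
        covered = connected-covered H k uniform 2≤k connected C

        hub∉ : ¬ vert C i ∈ edge H (hedge C j)
        hub∉ hub∈ = i≢j (hedge-inj C (linear-≡ {H} linear (i≢j ∘ vert-inj C)
          (vert∈ C i) hub∈ (vert-next∈ C i) (vert∈ C j)))

        hub-member : ∀ e → e ≢ hedge C j → vert C i ∈ edge H e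
        hub-member e e≢ = few-misses (e≢ ∘ sym) hub∉

        private-to : ∀ v → (∀ n → arc₃ C i n ≢ v) → ∀ {e} → v ∈ edge H e → e ≡ proj₁ (covered v)
        private-to v unmarked {e} v∈ with e ≟ proj₁ (covered v)
        ... | yes eq = eq
        -- A second hyperedge at v would give a third vertex of positive excess besides the two
        -- corners other than the hub.
        ... | no e≢  = contradiction
          (λ { 0F → excess-≥1 e≢ v∈ (proj₂ (covered v)) ; 1F → cycle-excess C j ; 2F → cycle-excess C l })
          (no-three (v ∷ vert C j ∷ vert C l ∷ [])
            (triple-injective (unmarked 1F ∘ sym) (unmarked 2F ∘ sym) (j≢l ∘ vert-inj C))
            λ { 0F → unmarked 0F ∘ sym ; 1F eq → i≢j (sym (vert-inj C eq)) ; 2F eq → i≢l (sym (vert-inj C eq)) })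

        heavy : ∀ {v e f g} → e ≢ f → e ≢ g → f ≢ g → v ∈ edge H e → v ∈ edge H f → v ∈ edge H g →
          2 ≤ degreeExcess v
        heavy {v} e≢f e≢g f≢g v∈e v∈f v∈g =
          s≤s⁻¹ (subst (3 ≤_) (degree≡ v) (degree-≥3 H e≢f e≢g f≢g v∈e v∈f v∈g))

        first-edges : ∀ e → vert C j ∈ edge H e → e ≡ hedge C i ⊎ e ≡ hedge C j
        first-edges e j∈ with e ≟ hedge C i | e ≟ hedge C j
        ... | yes eq | _      = inj₁ eq
        ... | no _   | yes eq = inj₂ eq
        -- A third hyperedge at this corner raises its excess to 2; with the other corner this makes
        -- 3.
        ... | no e≢i | no e≢j = contradiction (cycle-excess C l) (no-heavy (j≢l ∘ vert-inj C)
          (λ eq → i≢j (sym (vert-inj C eq))) (λ eq → i≢l (sym (vert-inj C eq)))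
          (heavy e≢i e≢j (i≢j ∘ hedge-inj C) j∈ (vert-next∈ C i) (vert∈ C j)))

        last-edges : ∀ e → vert C l ∈ edge H e → e ≡ hedge C j ⊎ e ≡ hedge C l
        last-edges e l∈ with e ≟ hedge C j | e ≟ hedge C l
        ... | yes eq | _      = inj₁ eq
        ... | no _   | yes eq = inj₂ eq
        ... | no e≢j | no e≢l = contradiction (cycle-excess C j) (no-heavy (λ eq → j≢l (sym (vert-inj C eq)))
          (λ eq → i≢l (sym (vert-inj C eq))) (λ eq → i≢j (sym (vert-inj C eq)))
          (heavy e≢j e≢l (j≢l ∘ hedge-inj C) l∈ (vert-next∈ C j) (vert∈ C l)))

-- Comparison of the candidates

module Extremal where

  open Counting
  open MomentFormula
  open Members
  open Isomorphism
  open import Data.Fin.Base using (Fin; suc)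
  open import Data.Fin.Patterns using (0F; 1F; 2F)
  open import Data.Fin.Properties using (_≟_; any?; ↑ˡ-injective)
  open import Data.Nat.Base as ℕ using (ℕ; _∸_; s≤s; z≤n)
  import Data.Nat.Properties as ℕ
  open import Data.Product.Base using (∃; _,_; proj₁; proj₂)
  open import Data.Sum.Base using (inj₁; inj₂)
  open import Data.Vec.Functional using (_∷_)
  open import Function.Base using (_∘_)
  open import Function.Definitions using (Injective)
  open import Relation.Binary.PropositionalEquality as ≡ using (_≡_)
  open import Relation.Nullary using (¬_; yes; no; contradiction)

  C₃-degree : ∀ k n₁ n₂ n₃ (2≤k : 2 ℕ.≤ k) i →
    degree (C₃-pendants k n₁ n₂ n₃) (Frame.joints (C₃-pendants-frame k n₁ n₂ n₃ 2≤k) i) ≡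
    2 ℕ.+ n₁ ℕ.* 𝟙 (i ≟ 0F) ℕ.+ n₂ ℕ.* 𝟙 (i ≟ 1F) ℕ.+ n₃ ℕ.* 𝟙 (i ≟ 2F)
  C₃-degree k n₁ n₂ n₃ 2≤k i = step n₃ H₂ (pendant₂ ∘ pendant₁ ∘ joint k 3) (λ {a} {b} → injective₂ {a} {b}) 2F
    (step n₂ H₁ (pendant₁ ∘ joint k 3) (λ {a} {b} → injective₁ {a} {b}) 1F (step n₁ H₀ (joint k 3) (λ {a} {b} → injective₀ {a} {b}) 0F (triangle-degree k i)))
    where
    H₀ = hypercycle k 3
    H₁ = addPendants k n₁ H₀ (joint k 3 0F)
    pendant₁ = oldVertex k n₁ H₀ (joint k 3 0F)
    H₂ = addPendants k n₂ H₁ (pendant₁ (joint k 3 1F))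
    pendant₂ = oldVertex k n₂ H₁ (pendant₁ (joint k 3 1F))
    injective₀ : Injective _≡_ _≡_ (joint k 3)
    injective₀ {a} {b} = ↑ˡ-injective _ a b
    injective₁ : Injective _≡_ _≡_ (pendant₁ ∘ joint k 3)
    injective₁ {a} {b} eq = injective₀ (↑ˡ-injective _ (joint k 3 a) (joint k 3 b) eq)
    injective₂ : Injective _≡_ _≡_ (pendant₂ ∘ pendant₁ ∘ joint k 3)
    injective₂ {a} {b} eq = injective₁ (↑ˡ-injective _ (pendant₁ (joint k 3 a)) (pendant₁ (joint k 3 b)) eq)
    step : ∀ p H {d} (t : Fin 3 → Fin (order H)) → Injective _≡_ _≡_ t → ∀ j → degree H (t i) ≡ d →
      degree (addPendants k p H (t j)) (oldVertex k p H (t j) (t i)) ≡ d ℕ.+ p ℕ.* 𝟙 (i ≟ j)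
    step p H t t-inj j ≡.refl = ≡.trans (degree-addPendants k p H (t j) (t i))
      (≡.cong (λ x → degree H (t i) ℕ.+ p ℕ.* x) (𝟙-cong (t i ≟ t j) (i ≟ j) t-inj (≡.cong t)))

  module _ {k : ℕ} (2≤k : 2 ℕ.≤ k) where

    module Degrees {m H} (lu : LinearUnicyclic k m H) = UnicyclicDegrees 2≤k lu
    open Degrees using (degreeExcess; sum-degreeExcess)

    girth-bound : ∀ {m g H} → g ℕ.≤ m → (lu : LinearUnicyclic k m H) (w : Fin g → Fin (order H)) →
      Injective _≡_ _≡_ w → (∀ i → 1 ℕ.≤ degreeExcess lu (w i)) →
      let p = m ∸ g in sumSquares (degreeExcess lu) ℕ.≤ p ℕ.* p ℕ.+ (2 ℕ.* p ℕ.+ g)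
    girth-bound {m} {g} g≤m lu w w-inj 1≤ = Excess.largest-bound w w-inj (degreeExcess lu) 1≤ (m ∸ g)
      (≡.trans (sum-degreeExcess lu) (≡.sym (ℕ.m∸n+n≡m g≤m)))

    star-squares : ∀ {m} g p j → 3 ℕ.≤ g → (lu : LinearUnicyclic k m (hypercycle⊙star k g p j)) →
      p ℕ.* p ℕ.+ (2 ℕ.* p ℕ.+ g) ℕ.≤ sumSquares (degreeExcess lu)
    star-squares g p j 3≤g lu = star-bound (Frame.joints frame) (Frame.joints-inj frame) (degreeExcess lu) j p
      (ℕ.≤-trans (ℕ.≤-reflexive (≡.sym (ℕ.+-∸-assoc p (s≤s (z≤n {1}))))) (ℕ.∸-monoˡ-≤ 1 (star-degree k g p j 2≤k 2≤g)))
      (λ i → ℕ.∸-monoˡ-≤ 1 (frame-joint-degree frame 2≤g i))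
      where
      2≤g = ℕ.≤-trans (s≤s (s≤s z≤n)) 3≤g
      frame = hypercycle⊙star-frame k g p j 2≤k 2≤g

    -- The star meets the hypothesis of `starTriangle` itself and is thereby brought into the same
    -- form as any rival with a large vertex.
    star-hub : ∀ {r} (lu : LinearUnicyclic k (3 ℕ.+ r) (hypercycle⊙star k 3 r 0F)) →
      ∃ λ v → 3 ℕ.+ r ℕ.≤ 2 ℕ.+ degreeExcess lu v
    star-hub {r} lu = oldVertex k r (hypercycle k 3) (joint k 3 0F) (joint k 3 0F) , s≤s (s≤s (ℕ.≤-trans (ℕ.≤-reflexive eq)
      (ℕ.∸-monoˡ-≤ 1 (star-degree k 3 r 0F 2≤k (s≤s (s≤s z≤n))))))
      where
      eq : 1 ℕ.+ r ≡ (r ℕ.+ 2) ∸ 1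
      eq = ≡.cong (_∸ 1) (ℕ.+-comm 2 r)

    module _ {r H} (lu : LinearUnicyclic k (5 ℕ.+ r) H) where

      private p = 2 ℕ.+ r

      -- The constant 5 is 2 + g for g = 3, with three consecutive cycle vertices marked.
      not-star-bound : (∀ v → degreeExcess lu v ℕ.≤ p) → sumSquares (degreeExcess lu) ℕ.≤ p ℕ.* p ℕ.+ 5
      not-star-bound ≤p with w , w-inj , 1≤ ← UnicyclicDegrees.someArc 2≤k lu =
        Excess.second-bound w w-inj (degreeExcess lu) 1≤ p
          (≡.trans (sum-degreeExcess lu) (ℕ.+-comm 3 p)) (s≤s (s≤s z≤n)) ≤p

      no-hub : ¬ (∃ λ v → 5 ℕ.+ r ℕ.≤ 2 ℕ.+ degreeExcess lu v) → ∀ v → degreeExcess lu v ℕ.≤ p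
      -- The negation reads 3 + x ≤ 5 + r for the excess x; removing three successors leaves x ≤ p.
      no-hub none v = ℕ.s≤s⁻¹ (ℕ.s≤s⁻¹ (ℕ.s≤s⁻¹ (ℕ.≰⇒> λ large → none (v , large))))

    module SecondMember {r} (lu : LinearUnicyclic k (5 ℕ.+ r) (C₃-pendants k (1 ℕ.+ r) 1 0)) where

      private
        p = 2 ℕ.+ r
        x = degreeExcess lu
        frame = C₃-pendants-frame k (1 ℕ.+ r) 1 0 2≤k
        joints = Frame.joints frame

        -- These values sum to m = p + 3, and their squares sum to p² + 5.
        values : ∀ i → x (joints i) ≡ (p ∷ 2 ∷ 1 ∷ λ ()) i
        values 0F = ≡.trans (≡.cong (_∸ 1) (C₃-degree k (1 ℕ.+ r) 1 0 2≤k 0F)) (≡.cong (2 ℕ.+_) (begin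
          r ℕ.* 1 ℕ.+ 0 ℕ.+ 0   ≡⟨ ℕ.+-identityʳ _ ⟩
          r ℕ.* 1 ℕ.+ 0         ≡⟨ ℕ.+-identityʳ _ ⟩
          r ℕ.* 1               ≡⟨ ℕ.*-identityʳ r ⟩
          r                     ∎))
          where open ≡.≡-Reasoning
        values 1F = ≡.trans (≡.cong (_∸ 1) (C₃-degree k (1 ℕ.+ r) 1 0 2≤k 1F))
          (≡.cong (λ z → 1 ℕ.+ z ℕ.+ 1 ℕ.+ 0) (ℕ.*-zeroʳ r))
        values 2F = ≡.trans (≡.cong (_∸ 1) (C₃-degree k (1 ℕ.+ r) 1 0 2≤k 2F))
          (≡.cong (λ z → 1 ℕ.+ z ℕ.+ 0 ℕ.+ 0) (ℕ.*-zeroʳ r))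

      lower : p ℕ.* p ℕ.+ 5 ℕ.≤ sumSquares x
      lower = ℕ.≤-trans (ℕ.≤-reflexive (≡.sym (sum-cong-≗ λ i → ≡.cong (λ y → y ℕ.* y) (values i))))
        (sum-∘-≤ joints (Frame.joints-inj frame) (λ v → x v ℕ.* x v))

      -- The three joints carry the whole excess.
      x≤p : ∀ v → x v ℕ.≤ p
      x≤p v with any? (λ i → joints i ≟ v)
      ... | yes (0F , ≡.refl) = ℕ.≤-reflexive (values 0F)
      ... | yes (1F , ≡.refl) = ℕ.≤-trans (ℕ.≤-reflexive (values 1F)) (s≤s (s≤s z≤n))
      ... | yes (2F , ≡.refl) = ℕ.≤-trans (ℕ.≤-reflexive (values 2F)) (s≤s z≤n)
      ... | no off = ℕ.≤-trans (ℕ.+-cancelʳ-≤ (5 ℕ.+ r) (x v) 0 (begin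
        x v ℕ.+ (5 ℕ.+ r)               ≡⟨ ≡.cong (x v ℕ.+_) (≡.trans (ℕ.+-comm 3 p) (≡.sym (sum-cong-≗ values))) ⟩
        sum (x ∘ (v ∷ joints))          ≤⟨ sum-∘-≤ (v ∷ joints) (∷-injective (λ i eq → off (i , eq)) (Frame.joints-inj frame)) x ⟩
        sum x                           ≡⟨ sum-degreeExcess lu ⟩
        5 ℕ.+ r                         ∎)) z≤n
        where open ℕ.≤-Reasoning

    second-bound : ∀ {r H} (lu : LinearUnicyclic k (5 ℕ.+ r) H) →
      LinearUnicyclic k (5 ℕ.+ r) (hypercycle⊙star k 3 (2 ℕ.+ r) 0F) →
      ¬ (H ≅ hypercycle⊙star k 3 (2 ℕ.+ r) 0F) →
      sumSquares (degreeExcess lu) ℕ.≤ (2 ℕ.+ r) ℕ.* (2 ℕ.+ r) ℕ.+ 5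
    second-bound {r} lu lu₁ ≇ with any? (λ v → 5 ℕ.+ r ℕ.≤? 2 ℕ.+ degreeExcess lu v)
    ... | no none = not-star-bound lu (no-hub lu none)
    ... | yes (hub , large) with hub₁ , large₁ ← star-hub lu₁ = contradiction
      (starTriangle-isomorphism (LinearUnicyclic.uniform lu) (LinearUnicyclic.uniform lu₁)
        (≡.trans (LinearUnicyclic.size≡m lu) (≡.sym (LinearUnicyclic.size≡m lu₁)))
        (UnicyclicDegrees.starTriangle 2≤k lu hub large) (UnicyclicDegrees.starTriangle 2≤k lu₁ hub₁ large₁)) ≇

    module Comparison {c ℓ₁ ℓ₂} (F : OrderedField c ℓ₁ ℓ₂)
      (α : OrderedField.Carrier F) (0<α : OrderedField._<_ F (OrderedField.0# F) α) where

      open OrderedField F hiding (sum)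
      open Spectral F
      open Moment F
      open import Relation.Binary.Reasoning.Setoid setoid
      open import Relation.Binary.Structures using (IsStrictPartialOrder)
      private module <ₒ = IsStrictPartialOrder isStrictPartialOrder

      private
        scale : ℕ → Carrier
        scale n = fromℕ ((k ∸ 1) ℕ.^ (n ∸ 1))

        0<scale : ∀ n → 0# < scale n
        0<scale n = 0<fromℕ ((k ∸ 1) ℕ.^ (n ∸ 1)) {{ℕ.m^n≢0 (k ∸ 1) (n ∸ 1) {{ℕ.>-nonZero (ℕ.m<n⇒0<n∸m 2≤k)}}}}

        -- n and z are variables so that two hypergraphs of equal order are written with the same
        -- scale factor and the same remainder.
        moment : ∀ {m H} (lu : LinearUnicyclic k m H) → ∀ {n z} → order H ≡ n → degreeSquares H ≡ z →
          spectralMoment k α 2 H ≈ scale n * (α * α * fromℕ z + proj₁ (secondMoment k 2≤k α m))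
        moment {m} {H} lu ≡.refl ≡.refl = proj₂ (secondMoment k 2≤k α m) H
          (LinearUnicyclic.uniform lu) (LinearUnicyclic.linear lu) (LinearUnicyclic.size≡m lu)

      module _ {m G H} (luG : LinearUnicyclic k m G) (luH : LinearUnicyclic k m H) where

        private
          n = m ℕ.* (k ∸ 1)
          orderG = UnicyclicDegrees.order≡ 2≤k luG
          orderH = UnicyclicDegrees.order≡ 2≤k luH
          R = proj₁ (secondMoment k 2≤k α m)

          moment-≡ : degreeSquares G ≡ degreeSquares H → spectralMoment k α 2 G ≈ spectralMoment k α 2 H
          moment-≡ eq = trans (moment luG orderG ≡.refl) (sym (moment luH orderH (≡.sym eq)))

          grow : ∀ z d → scale n * (α * α * fromℕ z + R) < scale n * (α * α * fromℕ (z ℕ.+ ℕ.suc d) + R)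
          grow z d = <ₒ.<-respˡ-≈ (+-identityˡ _) (<ₒ.<-respʳ-≈ (sym expand)
            (+-monoˡ-< _ (*-pos (0<scale n) (*-pos (*-pos 0<α 0<α) (0<fromℕ (ℕ.suc d))))))
            where
            expand : scale n * (α * α * fromℕ (z ℕ.+ ℕ.suc d) + R) ≈
              scale n * (α * α * fromℕ (ℕ.suc d)) + scale n * (α * α * fromℕ z + R)
            expand = begin
              scale n * (α * α * fromℕ (z ℕ.+ ℕ.suc d) + R)
                ≈⟨ *-congˡ (+-congʳ (*-congˡ (trans (fromℕ-+ z (ℕ.suc d)) (+-comm _ _)))) ⟩
              scale n * (α * α * (fromℕ (ℕ.suc d) + fromℕ z) + R)
                ≈⟨ *-congˡ (trans (+-congʳ (distribˡ _ _ _)) (+-assoc _ _ _)) ⟩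
              scale n * (α * α * fromℕ (ℕ.suc d) + (α * α * fromℕ z + R))
                ≈⟨ distribˡ _ _ _ ⟩
              scale n * (α * α * fromℕ (ℕ.suc d)) + scale n * (α * α * fromℕ z + R) ∎

        moment-< : sumSquares (degreeExcess luG) ℕ.< sumSquares (degreeExcess luH) →
          spectralMoment k α 2 G < spectralMoment k α 2 H
        moment-< lt with d , eq ← ℕ.m≤n⇒∃[o]m+o≡n (≡.subst₂ ℕ._<_
            (≡.sym (UnicyclicDegrees.degreeSquares≡ 2≤k luG)) (≡.sym (UnicyclicDegrees.degreeSquares≡ 2≤k luH))
            (ℕ.+-monoˡ-< (2 ℕ.* m ℕ.+ n) lt)) =
          <ₒ.<-respˡ-≈ (sym (moment luG orderG ≡.refl))
            (<ₒ.<-respʳ-≈ (sym (moment luH orderH (≡.trans (≡.sym eq) (≡.sym (ℕ.+-suc (degreeSquares G) d)))))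
              (grow (degreeSquares G) d))

        -- In the field, ≤ is the refutation of the converse <. The split into smaller and equal is
        -- therefore made in ℕ, where it is decidable.
        moment-≤ : sumSquares (degreeExcess luG) ℕ.≤ sumSquares (degreeExcess luH) →
          spectralMoment k α 2 G ≤ spectralMoment k α 2 H
        moment-≤ le H<G with ℕ.m≤n⇒m<n∨m≡n le
        ... | inj₁ lt = <ₒ.irrefl refl (<ₒ.trans H<G (moment-< lt))
        ... | inj₂ eq = <ₒ.irrefl (sym (moment-≡ (≡.trans (UnicyclicDegrees.degreeSquares≡ 2≤k luG)
          (≡.trans (≡.cong (ℕ._+ (2 ℕ.* m ℕ.+ n)) eq) (≡.sym (UnicyclicDegrees.degreeSquares≡ 2≤k luH)))))) H<G

      largest-of-girth : ∀ m g → 3 ℕ.≤ g → g ℕ.≤ m → (j : Fin g) →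
        IsLargest (LinearUnicyclicOfGirth k m g) (spectralMoment k α 2) (hypercycle⊙star k g (m ∸ g) j)
      largest-of-girth m g 3≤g g≤m j = record
        { member = star
        -- The cycle that realises the girth supplies the g distinct vertices to be marked.
        ; bound = λ { H (lu , (C , ≡.refl) , _) → moment-≤ lu (proj₁ star) (ℕ.≤-trans
            (girth-bound g≤m lu (vert C) (vert-inj C) (UnicyclicDegrees.cycle-excess 2≤k lu C))
            (star-squares g (m ∸ g) j 3≤g (proj₁ star))) } }
        where
        star = frame-linearUnicyclic (hypercycle⊙star-frame k g (m ∸ g) j 2≤k (ℕ.≤-trans (s≤s (s≤s z≤n)) 3≤g)) 3≤g
          (ℕ.m+[n∸m]≡n g≤m)

      -- Only three vertices of the cycle are marked, even if it is longer. The bound for girth 3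
      -- thus covers all girths without comparing stars of different girths.
      largest : ∀ m → 3 ℕ.≤ m →
        IsLargest (LinearUnicyclic k m) (spectralMoment k α 2) (hypercycle⊙star k 3 (m ∸ 3) 0F)
      largest m 3≤m = record
        { member = star
        ; bound = λ H lu → moment-≤ lu star (ℕ.≤-trans (bound lu) (star-squares 3 (m ∸ 3) 0F ℕ.≤-refl star)) }
        where
        star = proj₁ (IsLargest.member (largest-of-girth m 3 ℕ.≤-refl 3≤m 0F))
        bound : ∀ {H} (lu : LinearUnicyclic k m H) → sumSquares (degreeExcess lu) ℕ.≤ (m ∸ 3) ℕ.* (m ∸ 3) ℕ.+ (2 ℕ.* (m ∸ 3) ℕ.+ 3)
        bound lu with w , w-inj , 1≤ ← UnicyclicDegrees.someArc 2≤k lu = girth-bound 3≤m lu w w-inj 1≤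

      second-largest : ∀ m → 5 ℕ.≤ m →
        IsSecondLargestAfter (hypercycle⊙star k 3 (m ∸ 3) 0F) (LinearUnicyclic k m) (spectralMoment k α 2)
          (C₃-pendants k (m ∸ 4) 1 0)
      second-largest m@(ℕ.suc (ℕ.suc (ℕ.suc (ℕ.suc (ℕ.suc r))))) (s≤s (s≤s (s≤s (s≤s (s≤s z≤n))))) = record
        { member = second
        ; below = moment-< second star (ℕ.≤-trans (s≤s (not-star-bound second (SecondMember.x≤p second)))
            (ℕ.≤-trans gap (star-squares 3 p 0F ℕ.≤-refl star)))
        ; bound = λ H lu ≇ → moment-≤ lu second (ℕ.≤-trans (second-bound lu star ≇) (SecondMember.lower second)) }
        where
        p = 2 ℕ.+ r
        star = IsLargest.member (largest m (s≤s (s≤s (s≤s z≤n))))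
        second = proj₁ (frame-linearUnicyclic (C₃-pendants-frame k (1 ℕ.+ r) 1 0 2≤k) ℕ.≤-refl
          (≡.trans (ℕ.+-identityʳ _) (ℕ.+-comm (3 ℕ.+ (1 ℕ.+ r)) 1)))
        -- Since p ≥ 2, 2p + 3 is at least 7. For p = 1, that is m = 4, both values would be 6 and
        -- strictness would fail.
        gap : ℕ.suc (p ℕ.* p ℕ.+ 5) ℕ.≤ p ℕ.* p ℕ.+ (2 ℕ.* p ℕ.+ 3)
        gap = ℕ.≤-trans (ℕ.≤-reflexive (≡.sym (ℕ.+-suc (p ℕ.* p) 5))) (ℕ.+-monoʳ-≤ (p ℕ.* p)
          (ℕ.≤-trans (ℕ.n≤1+n 6) (ℕ.+-monoˡ-≤ 3 (ℕ.*-monoʳ-≤ 2 (s≤s (s≤s (z≤n {r})))))))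

theorem7p1 : ∀ {c ℓ₁ ℓ₂} (F : OrderedField c ℓ₁ ℓ₂) →
  let open OrderedField F
      open Spectral F
  in
  (k : ℕ) → 2 ℕ.≤ k →
  (α : Carrier) → 0# < α → α < 1# →
  ((m g : ℕ) → 3 ℕ.≤ g → g ℕ.≤ m → (j : Fin g) →
    IsLargest (LinearUnicyclicOfGirth k m g) (spectralMoment k α 2)
      (hypercycle⊙star k g (m ∸ g) j))
  ×
  ((m : ℕ) → 3 ℕ.≤ m →
    IsLargest (LinearUnicyclic k m) (spectralMoment k α 2)
      (hypercycle⊙star k 3 (m ∸ 3) Fin.zero))
  ×
  ((m : ℕ) → 5 ℕ.≤ m →
    IsSecondLargestAfter (hypercycle⊙star k 3 (m ∸ 3) Fin.zero)
      (LinearUnicyclic k m) (spectralMoment k α 2)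
      (C₃-pendants k (m ∸ 4) 1 0))
theorem7p1 F k 2≤k α 0<α α<1 =
  C.largest-of-girth , C.largest , C.second-largest
  where module C = Extremal.Comparison 2≤k F α 0<α
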